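{- Let $\Bbbk$ be a perfect field and let $K$ be an $n$-dimensional topological local field over $\Bbbk$. The ring $\mathrm{E}(K)$ of local Beilinson-Tate operators satisfies \[ \mathcal{D}^{\mathrm{cont}}_{K/\Bbbk} \subset \mathrm{E}(K) \subset \operatorname{End}^{\mathrm{cont}}_{\Bbbk}(K). \]
   Context: **Continuous operators.** $\operatorname{End}^{\mathrm{cont}}_{\Bbbk}(K)$ is the ring of continuous $\Bbbk$-linear operators $K\to K$. The ring of continuous differential operators $\mathcal{D}^{\mathrm{cont}}_{K/\Bbbk}\subset\operatorname{End}^{\mathrm{cont}}_{\Bbbk}(K)$ is $\bigcup_iF_i$, where $F_i:=0$ for $i\le-1$ and, for $i\ge0$, $F_i$ is the set of $\phi\in\operatorname{End}^{\mathrm{cont}}_{\Bbbk}(K)$ such that $a\circ\phi-\phi\circ a\in F_{i-1}$ for all $a\in K$ (acting by multiplication). **Semi-topological (ST) rings and modules.** $\Bbbk$ is a perfect field with the discrete topology. A $\Bbbk$-linear topology on a $\Bbbk$-module is a module topology in which $0$ has a basis of open neighborhoods consisting of $\Bbbk$-submodules. A commutative ST $\Bbbk$-ring is a commutative $\Bbbk$-ring $A$ with a $\Bbbk$-linear topology such that for every $a \in A$ the map $A \to A$, $b \mapsto ab$, is continuous; homomorphisms of ST $\Bbbk$-rings are the continuous $\Bbbk$-ring homomorphisms. A ST $A$-module is an $A$-module $M$ with a $\Bbbk$-linear topology such that for every $a \in A$ and $m \in M$ the maps $M \to M$, $m' \mapsto a m'$, and $A \to M$, $a' \mapsto a' m$,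 are continuous. The fine $A$-module topology on an $A$-module is the finest $\Bbbk$-linear topology making it a ST $A$-module (it exists). **Laurent series.** For a commutative ST $\Bbbk$-ring $A$: give $A[t]/(t^{i+1})$ the fine $A$-module topology, $A[[t]] = \lim_{\leftarrow i} A[t]/(t^{i+1})$ the inverse limit topology, and $A((t)) = A[[t]][t^{ -1}]$ the fine $A[[t]]$-module topology. Recursively $A((t_1,\ldots,t_n)) := A((t_2,\ldots,t_n))((t_1))$. **Local fields.** An $n$-dimensional local field is a field $K$ with complete discrete valuation rings $\mathcal{O}_1(K),\ldots,\mathcal{O}_n(K)$ such that $K$ is the fraction field of $\mathcal{O}_1(K)$ and for $1\le i\le n-1$ the residue field of $\mathcal{O}_i(K)$ is the fraction field of $\mathcal{O}_{i+1}(K)$. Let $\boldsymbol{k}_i(K)$ be the residue field of $\mathcal{O}_i(K)$, and $\boldsymbol{k}_0(K):=K$. The ring of integers $\mathcal{O}(K) := \mathcal{O}_1(K)\times_{\boldsymbol{k}_1(K)}\mathcal{O}_2(K)\cdots\times_{\boldsymbol{k}_{n-1}(K)}\mathcal{O}_n(K)$ is a subring of $K$ ($\mathcal{O}(K)=K$ if $n=0$). For a finite field extension $\Bbbk'$ of $\Bbbk$ (discrete topology), the standard $n$-dimensional topological local field is $\Bbbk'((t_1,\ldots,t_n))$ with the iterated Laurent series topology (obtained from the discrete topology on $\Bbbk'$ by the recursion $\Bbbk'((t_1,\ldots,t_n)) = \Bbbk'((t_2,\ldots,t_n))((t_1))$, where $A((t))$ has the fine $A[[t]]$-module topology) and with $\mathcal{O}_i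 = \Bbbk'((t_{i+1},\ldots,t_n))[[t_i]]$. An $n$-dimensional topological local field (TLF) over $\Bbbk$ is an $n$-dimensional local field $K$ with a ring homomorphism $\Bbbk\to\mathcal{O}(K)$ such that $\Bbbk\to\boldsymbol{k}_n(K)$ is finite, and a topology making $K$ a ST $\Bbbk$-ring, for which there exists a $\Bbbk$-ring isomorphism $\Bbbk'((t_1,\ldots,t_n)) \to K$, $\Bbbk' := \boldsymbol{k}_n(K)$, that is a homeomorphism and respects the valuation rings (it maps $\mathcal{O}_1$ onto $\mathcal{O}_1$, the induced map on residue fields maps $\mathcal{O}_2$ onto $\mathcal{O}_2$, etc.). Each $\mathcal{O}_i(K)\subset\boldsymbol{k}_{i-1}(K)$ has the subspace topology and each $\boldsymbol{k}_i(K)$ has the quotient topology from $\mathcal{O}_i(K)$; then $\boldsymbol{k}_i(K)$ is an $(n-i)$-dimensional TLF. **Systems of liftings.** A system of liftings for $K$ is a sequence $\boldsymbol{\sigma}=(\sigma_1,\ldots,\sigma_n)$, where each $\sigma_i:\boldsymbol{k}_i(K)\to\mathcal{O}_i(K)$ is a continuous $\Bbbk$-ring homomorphism splitting the canonical surjection $\mathcal{O}_i(K)\to\boldsymbol{k}_i(K)$ (the empty sequence if $n=0$). If $n \geq 1$, $\mathrm{d}_1(\boldsymbol{\sigma}) := (\sigma_2,\ldots,\sigma_n)$, a system of liftings for $\boldsymbol{k}_1(K)$. **Lattices.** "Finite module" means finitely generated. For $n \ge 1$ and a finite $K$-module $M$, an $\mathcal{O}_1(K)$-lattice in $M$ is a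 finite $\mathcal{O}_1(K)$-submodule $L$ with $M = K\cdot L$; $\operatorname{Lat}(M)$ is the set of lattices, and $\operatorname{Lat}(M_1,M_2):=\operatorname{Lat}(M_1)\times\operatorname{Lat}(M_2)$. For lattices $L\subset L'$, $L'/L$ has finite length over $\mathcal{O}_1(K)$, and $\operatorname{rest}_{\sigma_1}(L'/L)$ denotes it as a finite $\boldsymbol{k}_1(K)$-module via $\sigma_1$. For a $\Bbbk$-linear $\phi:M_1\to M_2$ and $(L_1,L_2),(L'_1,L'_2)\in\operatorname{Lat}(M_1,M_2)$, $(L'_1,L'_2)$ is a $\phi$-refinement of $(L_1,L_2)$, written $(L'_1,L'_2)\prec_\phi(L_1,L_2)$, if $L'_1\subset L_1$, $L_2\subset L'_2$, $\phi(L'_1)\subset L_2$ and $\phi(L_1)\subset L'_2$; then there is an induced $\bar\phi:L_1/L'_1\to L'_2/L_2$. **BT operators.** For finite $K$-modules $M_1,M_2$ define $\mathrm{E}^K_{\boldsymbol{\sigma}}(M_1,M_2)\subset\operatorname{Hom}_{\Bbbk}(M_1,M_2)$ recursively. If $n=0$ it is all of $\operatorname{Hom}_{\Bbbk}(M_1,M_2)$. If $n\ge1$, $\phi$ belongs to it iff: (i) every $(L_1,L_2)\in\operatorname{Lat}(M_1,M_2)$ has some $\phi$-refinement; and (ii) for every $\phi$-refinement $(L'_1,L'_2)\prec_\phi(L_1,L_2)$ the induced $\bar\phi$ belongs to $\mathrm{E}^{\boldsymbol{k}_1(K)}_{\mathrm{d}_1(\boldsymbol{\sigma})}(\operatorname{rest}_{\sigma_1}(L_1/L'_1),\operatorname{rest}_{\sigma_1}(L'_2/L_2))$.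 **The ring of local Beilinson-Tate operators.** $\mathrm{E}(K):=\mathrm{E}^K_{\boldsymbol{\sigma}}(K,K)$, where $\boldsymbol{\sigma}$ is any system of liftings for $K$ (such systems exist, and this set does not depend on the choice of $\boldsymbol{\sigma}$). -}

module Defs where

open import Level using (Level; Lift; lift; lower) renaming (suc to lsuc)
open import Algebra.Bundles using (CommutativeMonoid; CommutativeRing; Ring; Semiring)
open import Algebra.Module.Bundles using (LeftModule)
open import Algebra.Module.Morphism.Structures using (module LeftModuleMorphisms)
open import Algebra.Morphism.Structures using (module RingMorphisms)
import Algebra.Definitions.RawMonoid as RawMonoidDefinitions
import Algebra.Definitions.RawSemiring as RawSemiringDefinitions
import Algebra.Module.Construct.TensorUnit as TensorUnit
import Algebra.Properties.AbelianGroup as AbelianGroupProperties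
import Algebra.Properties.CommutativeSemigroup as CommutativeSemigroupProperties
import Algebra.Properties.Ring as RingProperties
import Algebra.Properties.Semiring.Exp as ExpProperties
import Algebra.Solver.Ring.NaturalCoefficients.Default as SemiringSolver
open import Data.Empty using (⊥-elim)
open import Data.Fin.Base using (Fin; toℕ)
open import Data.Integer.Base using (ℤ; +_; -[1+_])
import Data.Integer.Base as ℤ
import Data.Integer.Properties as ℤ
open import Data.List.Base using (List; []; _++_)
open import Data.List.Relation.Unary.All using (All; [])
import Data.List.Relation.Unary.All as All
open import Data.List.Relation.Unary.All.Properties using (++⁺; ++⁻ˡ; ++⁻ʳ)
open import Data.Nat.Base using (ℕ; zero; suc; _∸_)
import Data.Nat.Base as ℕ
import Data.Nat.Properties as ℕ
open import Data.Nat.Primality using (Prime)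
open import Data.Product.Base using (Σ; Σ-syntax; ∃; ∃-syntax; _×_; _,_; proj₁; proj₂)
open import Data.Unit.Polymorphic.Base using (⊤; tt)
open import Function.Base using (_∘_; id)
open import Relation.Binary.Bundles using (Setoid)
open import Relation.Binary.Definitions using (_Respects_)
open import Relation.Binary.PropositionalEquality.Core as ≡ using (_≡_)
import Relation.Binary.Reasoning.Setoid as SetoidReasoning
open import Relation.Nullary using (¬_; yes; no)
open import Relation.Unary using (Pred; _⊆_; _∩_)

private
  variable
    ℓ : Level

------------------------------------------------------------------------
-- Rings, fields, modules

IsRingHom : (R S : Ring ℓ ℓ) →
            (Ring.Carrier R → Ring.Carrier S) → Set ℓ
IsRingHom R S = IsRingHomomorphism
  where open RingMorphisms (Ring.rawRing R) (Ring.rawRing S)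

IsRingIso : (R S : Ring ℓ ℓ) →
            (Ring.Carrier R → Ring.Carrier S) → Set ℓ
IsRingIso R S = IsRingIsomorphism
  where open RingMorphisms (Ring.rawRing R) (Ring.rawRing S)

module _ (R S : Ring ℓ ℓ) where
  private
    module R = Ring R
    module S = Ring S
    open AbelianGroupProperties S.+-abelianGroup using (inverseˡ-unique; identityˡ-unique)

  mkRingHom : (f : R.Carrier → S.Carrier) →
              (∀ {x y} → x R.≈ y → f x S.≈ f y) →
              (∀ x y → f (x R.+ y) S.≈ f x S.+ f y) →
              (∀ x y → f (x R.* y) S.≈ f x S.* f y) →
              f R.1# S.≈ S.1# →
              IsRingHom R S f
  mkRingHom f cong +-homo *-homo 1-homo = record
    { isSemiringHomomorphism = record
      { isNearSemiringHomomorphism = record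
        { +-isMonoidHomomorphism = record
          { isMagmaHomomorphism = record
            { isRelHomomorphism = record { cong = cong }
            ; homo = +-homo
            }
          ; ε-homo = 0-homo
          }
        ; *-homo = *-homo
        }
      ; 1#-homo = 1-homo
      }
    ; -‿homo = λ x → inverseˡ-unique (f (R.- x)) (f x)
        (S.trans (S.sym (+-homo (R.- x) x)) (S.trans (cong (R.-‿inverseˡ x)) 0-homo))
    }
    where
    0-homo : f R.0# S.≈ S.0#
    0-homo = identityˡ-unique (f R.0#) (f R.0#)
      (S.trans (S.sym (+-homo R.0# R.0#)) (cong (R.+-identityˡ R.0#)))

∘-isRingHom : (R S T : Ring ℓ ℓ)
              {f : Ring.Carrier R → Ring.Carrier S}
              {g : Ring.Carrier S → Ring.Carrier T} →
              IsRingHom R S f → IsRingHom S T g → IsRingHom R T (g ∘ f)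
∘-isRingHom R S T {f} {g} f-hom g-hom = mkRingHom R T (g ∘ f)
  (λ eq → g.⟦⟧-cong (f.⟦⟧-cong eq))
  (λ x y → T.trans (g.⟦⟧-cong (f.+-homo x y)) (g.+-homo (f x) (f y)))
  (λ x y → T.trans (g.⟦⟧-cong (f.*-homo x y)) (g.*-homo (f x) (f y)))
  (T.trans (g.⟦⟧-cong f.1#-homo) g.1#-homo)
  where
  module T = Ring T
  module f = RingMorphisms.IsRingHomomorphism f-hom
  module g = RingMorphisms.IsRingHomomorphism g-hom

-- Since equality need not be decidable, "field" is meant in the sense that is
-- correct under excluded middle.
record Field (ℓ : Level) : Set (lsuc ℓ) where
  field
    commutativeRing : CommutativeRing ℓ ℓ
  open CommutativeRing commutativeRing public
  field
    1≉0     : ¬ (1# ≈ 0#)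
    inverse : ∀ x → ¬ (x ≈ 0#) → ∃[ y ] (x * y ≈ 1#)

-- For a field k there is at most one prime p with p · 1 = 0; the condition is
-- void in characteristic zero.
IsPerfect : Field ℓ → Set ℓ
IsPerfect k = ∀ p → Prime p → p · 1# ≈ 0# → ∀ x → ∃[ y ] (y ^ p ≈ x)
  where
  open Field k
  open RawSemiringDefinitions (Semiring.rawSemiring semiring) using (_^_) renaming (_×_ to _·_)

Mod : Ring ℓ ℓ → Set (lsuc ℓ)
Mod {ℓ} R = LeftModule R ℓ ℓ

regular : (R : Ring ℓ ℓ) → Mod R
regular R = TensorUnit.leftModule {R = R}

restrict : (R S : Ring ℓ ℓ)
           {f : Ring.Carrier R → Ring.Carrier S} →
           IsRingHom R S f → Mod S → Mod R
restrict R S {f} f-hom M = record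
  { Carrierᴹ = Carrierᴹ
  ; _≈ᴹ_ = _≈ᴹ_
  ; _+ᴹ_ = _+ᴹ_
  ; _*ₗ_ = λ r m → f r *ₗ m
  ; 0ᴹ = 0ᴹ
  ; -ᴹ_ = -ᴹ_
  ; isLeftModule = record
    { isLeftSemimodule = record
      { +ᴹ-isCommutativeMonoid = +ᴹ-isCommutativeMonoid
      ; isPreleftSemimodule = record
        { *ₗ-cong = λ r≈s → *ₗ-cong (⟦⟧-cong r≈s)
        ; *ₗ-zeroˡ = λ m → ≈ᴹ-trans (*ₗ-congʳ 0#-homo) (*ₗ-zeroˡ m)
        ; *ₗ-distribʳ = λ m r s → ≈ᴹ-trans (*ₗ-congʳ (+-homo r s)) (*ₗ-distribʳ m (f r) (f s))
        ; *ₗ-identityˡ = λ m → ≈ᴹ-trans (*ₗ-congʳ 1#-homo) (*ₗ-identityˡ m)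
        ; *ₗ-assoc = λ r s m → ≈ᴹ-trans (*ₗ-congʳ (*-homo r s)) (*ₗ-assoc (f r) (f s) m)
        ; *ₗ-zeroʳ = λ r → *ₗ-zeroʳ (f r)
        ; *ₗ-distribˡ = λ r → *ₗ-distribˡ (f r)
        }
      }
    ; -ᴹ‿cong = -ᴹ‿cong
    ; -ᴹ‿inverse = -ᴹ‿inverse
    }
  }
  where
  open LeftModule M
  open RingMorphisms.IsRingHomomorphism f-hom

IsLinear : (R : Ring ℓ ℓ) (M N : Mod R) →
           (LeftModule.Carrierᴹ M → LeftModule.Carrierᴹ N) → Set ℓ
IsLinear R M N = IsLeftModuleHomomorphism
  where open LeftModuleMorphisms (LeftModule.rawLeftModule M) (LeftModule.rawLeftModule N)

module _ {R : Ring ℓ ℓ} (M : Mod R) where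
  private module R = Ring R
  open LeftModule M

  combination : ∀ {r} → (Fin r → R.Carrier) → (Fin r → Carrierᴹ) → Carrierᴹ
  combination a m = RawMonoidDefinitions.sum +ᴹ-rawMonoid (λ i → a i *ₗ m i)

  IsFinitelyGenerated : Set ℓ
  IsFinitelyGenerated =
    Σ[ r ∈ ℕ ] Σ[ g ∈ (Fin r → Carrierᴹ) ] ∀ m → ∃[ a ] (m ≈ᴹ combination a g)

  record IsSubmodule (L : Pred Carrierᴹ ℓ) : Set ℓ where
    field
      resp : L Respects _≈ᴹ_
      has0 : L 0ᴹ
      has+ : ∀ {x y} → L x → L y → L (x +ᴹ y)
      has* : ∀ a {x} → L x → L (a *ₗ x)

    has- : ∀ {x} → L x → L (-ᴹ x)
    has- {x} p = resp (inverseˡ-unique (R.- R.1# *ₗ x) x eq) (has* (R.- R.1#) p)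
      where
      open AbelianGroupProperties +ᴹ-abelianGroup using (inverseˡ-unique)
      open SetoidReasoning ≈ᴹ-setoid
      eq : (R.- R.1# *ₗ x) +ᴹ x ≈ᴹ 0ᴹ
      eq = begin
        (R.- R.1# *ₗ x) +ᴹ x              ≈⟨ +ᴹ-congˡ (*ₗ-identityˡ x) ⟨
        (R.- R.1# *ₗ x) +ᴹ (R.1# *ₗ x)    ≈⟨ *ₗ-distribʳ x (R.- R.1#) R.1# ⟨
        (R.- R.1# R.+ R.1#) *ₗ x          ≈⟨ *ₗ-congʳ (R.-‿inverseˡ R.1#) ⟩
        R.0# *ₗ x                         ≈⟨ *ₗ-zeroˡ x ⟩
        0ᴹ                                ∎

  record Submodule : Set (lsuc ℓ) where
    field
      member      : Pred Carrierᴹ ℓ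
      isSubmodule : IsSubmodule member
    open IsSubmodule isSubmodule public

module _ {R : Ring ℓ ℓ} {M : Mod R} where
  open LeftModule M

  submodule : Submodule M → Mod R
  submodule L = record
    { Carrierᴹ = Σ Carrierᴹ member
    ; _≈ᴹ_ = λ x y → proj₁ x ≈ᴹ proj₁ y
    ; _+ᴹ_ = λ x y → proj₁ x +ᴹ proj₁ y , has+ (proj₂ x) (proj₂ y)
    ; _*ₗ_ = λ a x → a *ₗ proj₁ x , has* a (proj₂ x)
    ; 0ᴹ = 0ᴹ , has0
    ; -ᴹ_ = λ x → -ᴹ proj₁ x , has- (proj₂ x)
    ; isLeftModule = record
      { isLeftSemimodule = record
        { +ᴹ-isCommutativeMonoid = record
          { isMonoid = record
            { isSemigroup = record
              { isMagma = record
                { isEquivalence = record { refl = ≈ᴹ-refl ; sym = ≈ᴹ-sym ; trans = ≈ᴹ-trans }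
                ; ∙-cong = +ᴹ-cong
                }
              ; assoc = λ _ _ _ → +ᴹ-assoc _ _ _
              }
            ; identity = (λ _ → +ᴹ-identityˡ _) , (λ _ → +ᴹ-identityʳ _)
            }
          ; comm = λ _ _ → +ᴹ-comm _ _
          }
        ; isPreleftSemimodule = record
          { *ₗ-cong = *ₗ-cong
          ; *ₗ-zeroˡ = λ _ → *ₗ-zeroˡ _
          ; *ₗ-distribʳ = λ _ _ _ → *ₗ-distribʳ _ _ _
          ; *ₗ-identityˡ = λ _ → *ₗ-identityˡ _
          ; *ₗ-assoc = λ _ _ _ → *ₗ-assoc _ _ _
          ; *ₗ-zeroʳ = λ _ → *ₗ-zeroʳ _
          ; *ₗ-distribˡ = λ _ _ _ → *ₗ-distribˡ _ _ _
          }
        }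
      ; -ᴹ‿cong = -ᴹ‿cong
      ; -ᴹ‿inverse = (λ _ → -ᴹ‿inverseˡ _) , (λ _ → -ᴹ‿inverseʳ _)
      }
    }
    where open Submodule L

  quotient : Submodule M → Mod R
  quotient L = record
    { Carrierᴹ = Carrierᴹ
    ; _≈ᴹ_ = _∼_
    ; _+ᴹ_ = _+ᴹ_
    ; _*ₗ_ = _*ₗ_
    ; 0ᴹ = 0ᴹ
    ; -ᴹ_ = -ᴹ_
    ; isLeftModule = record
      { isLeftSemimodule = record
        { +ᴹ-isCommutativeMonoid = record
          { isMonoid = record
            { isSemigroup = record
              { isMagma = record
                { isEquivalence = record
                  { refl = ≈⇒∼ ≈ᴹ-refl
                  ; sym = λ {x} {y} p → resp (⁻¹-anti-homo‿- x y) (has- p)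
                  ; trans = λ {x} {y} {z} p q → resp (telescope x y z) (has+ p q)
                  }
                ; ∙-cong = λ {x} {y} {u} {v} p q → resp (rearrange x y u v) (has+ p q)
                }
              ; assoc = λ x y z → ≈⇒∼ (+ᴹ-assoc x y z)
              }
            ; identity = (λ x → ≈⇒∼ (+ᴹ-identityˡ x)) , (λ x → ≈⇒∼ (+ᴹ-identityʳ x))
            }
          ; comm = λ x y → ≈⇒∼ (+ᴹ-comm x y)
          }
        ; isPreleftSemimodule = record
          { *ₗ-cong = λ {a} {b} {x} {y} a≈b p →
              resp (≈ᴹ-trans (scale a x y) (+ᴹ-congˡ (-ᴹ‿cong (*ₗ-congʳ a≈b)))) (has* a p)
          ; *ₗ-zeroˡ = λ x → ≈⇒∼ (*ₗ-zeroˡ x)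
          ; *ₗ-distribʳ = λ x a b → ≈⇒∼ (*ₗ-distribʳ x a b)
          ; *ₗ-identityˡ = λ x → ≈⇒∼ (*ₗ-identityˡ x)
          ; *ₗ-assoc = λ a b x → ≈⇒∼ (*ₗ-assoc a b x)
          ; *ₗ-zeroʳ = λ a → ≈⇒∼ (*ₗ-zeroʳ a)
          ; *ₗ-distribˡ = λ a x y → ≈⇒∼ (*ₗ-distribˡ a x y)
          }
        }
      ; -ᴹ‿cong = λ {x} {y} p → resp (≈ᴹ-sym (⁻¹-∙-comm x (-ᴹ y))) (has- p)
      ; -ᴹ‿inverse = (λ x → ≈⇒∼ (-ᴹ‿inverseˡ x)) , (λ x → ≈⇒∼ (-ᴹ‿inverseʳ x))
      }
    }
    where
    open Submodule L
    open AbelianGroupProperties +ᴹ-abelianGroup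
      using (⁻¹-anti-homo‿-; ⁻¹-∙-comm; inverseʳ-unique; x≈y⇒x∙y⁻¹≈ε)
    open CommutativeSemigroupProperties
      (CommutativeMonoid.commutativeSemigroup +ᴹ-commutativeMonoid) using (interchange)
    open SetoidReasoning ≈ᴹ-setoid

    _∼_ : Carrierᴹ → Carrierᴹ → Set ℓ
    x ∼ y = member (x +ᴹ -ᴹ y)

    ≈⇒∼ : ∀ {x y} → x ≈ᴹ y → x ∼ y
    ≈⇒∼ p = resp (≈ᴹ-sym (x≈y⇒x∙y⁻¹≈ε p)) has0

    telescope : ∀ x y z → (x +ᴹ -ᴹ y) +ᴹ (y +ᴹ -ᴹ z) ≈ᴹ x +ᴹ -ᴹ z
    telescope x y z = begin
      (x +ᴹ -ᴹ y) +ᴹ (y +ᴹ -ᴹ z)  ≈⟨ +ᴹ-assoc x (-ᴹ y) (y +ᴹ -ᴹ z) ⟩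
      x +ᴹ (-ᴹ y +ᴹ (y +ᴹ -ᴹ z))  ≈⟨ +ᴹ-congˡ (+ᴹ-assoc (-ᴹ y) y (-ᴹ z)) ⟨
      x +ᴹ ((-ᴹ y +ᴹ y) +ᴹ -ᴹ z)  ≈⟨ +ᴹ-congˡ (+ᴹ-congʳ (-ᴹ‿inverseˡ y)) ⟩
      x +ᴹ (0ᴹ +ᴹ -ᴹ z)           ≈⟨ +ᴹ-congˡ (+ᴹ-identityˡ (-ᴹ z)) ⟩
      x +ᴹ -ᴹ z                   ∎

    rearrange : ∀ x y u v → (x +ᴹ -ᴹ y) +ᴹ (u +ᴹ -ᴹ v) ≈ᴹ (x +ᴹ u) +ᴹ -ᴹ (y +ᴹ v)
    rearrange x y u v =
      ≈ᴹ-trans (interchange x (-ᴹ y) u (-ᴹ v)) (+ᴹ-congˡ (⁻¹-∙-comm y v))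

    scale : ∀ a x y → a *ₗ (x +ᴹ -ᴹ y) ≈ᴹ (a *ₗ x) +ᴹ -ᴹ (a *ₗ y)
    scale a x y = ≈ᴹ-trans (*ₗ-distribˡ a x (-ᴹ y)) (+ᴹ-congˡ
      (inverseʳ-unique (a *ₗ y) (a *ₗ -ᴹ y)
        (≈ᴹ-trans (≈ᴹ-sym (*ₗ-distribˡ a y (-ᴹ y)))
          (≈ᴹ-trans (*ₗ-congˡ (-ᴹ‿inverseʳ y)) (*ₗ-zeroʳ a)))))

-- L / L′; only used when L′ ⊆ L.
_/_ : {R : Ring ℓ ℓ} {M : Mod R} (L L′ : Submodule M) → Mod R
L / L′ = quotient {M = submodule L} (record
  { member = λ x → member (proj₁ x)
  ; isSubmodule = record { resp = resp ; has0 = has0 ; has+ = has+ ; has* = λ a → has* a }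
  })
  where open Submodule L′

quotientRing : (R : CommutativeRing ℓ ℓ) →
               Submodule (regular (CommutativeRing.ring R)) → CommutativeRing ℓ ℓ
quotientRing R I = record
  { Carrier = Carrier
  ; _≈_ = λ x y → member (x - y)
  ; _+_ = _+_
  ; _*_ = _*_
  ; -_ = -_
  ; 0# = 0#
  ; 1# = 1#
  ; isCommutativeRing = record
    { isRing = record
      { +-isAbelianGroup = Q.+ᴹ-isAbelianGroup
      ; *-cong = λ {x} {y} {u} {v} p q → resp (eq x y u v) (has+ (has* u p) (has* y q))
      ; *-assoc = λ x y z → ≈⇒∼ (*-assoc x y z)
      ; *-identity = (λ x → ≈⇒∼ (*-identityˡ x)) , (λ x → ≈⇒∼ (*-identityʳ x))
      ; distrib = (λ x y z → ≈⇒∼ (distribˡ x y z)) , (λ x y z → ≈⇒∼ (distribʳ x y z))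
      }
    ; *-comm = λ x y → ≈⇒∼ (*-comm x y)
    }
  }
  where
  open CommutativeRing R
  open Submodule I
  module Q = LeftModule (quotient I)
  open AbelianGroupProperties +-abelianGroup using (x≈y⇒x∙y⁻¹≈ε)
  open RingProperties ring using (x[y-z]≈xy-xz)
  open SetoidReasoning setoid

  ≈⇒∼ : ∀ {x y} → x ≈ y → member (x - y)
  ≈⇒∼ p = resp (sym (x≈y⇒x∙y⁻¹≈ε p)) has0

  eq : ∀ x y u v → u * (x - y) + y * (u - v) ≈ x * u - y * v
  eq x y u v = begin
    u * (x - y) + y * (u - v)
      ≈⟨ +-cong (x[y-z]≈xy-xz u x y) (x[y-z]≈xy-xz y u v) ⟩
    (u * x - u * y) + (y * u - y * v)
      ≈⟨ +-assoc (u * x) (- (u * y)) (y * u - y * v) ⟩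
    u * x + (- (u * y) + (y * u - y * v))
      ≈⟨ +-congˡ (+-assoc (- (u * y)) (y * u) (- (y * v))) ⟨
    u * x + ((- (u * y) + y * u) - y * v)
      ≈⟨ +-congˡ (+-congʳ (trans (+-congˡ (*-comm y u)) (-‿inverseˡ (u * y)))) ⟩
    u * x + (0# - y * v)
      ≈⟨ +-cong (*-comm u x) (+-identityˡ (- (y * v))) ⟩
    x * u - y * v ∎

quotientRing-hom : (R : CommutativeRing ℓ ℓ) (I : Submodule (regular (CommutativeRing.ring R))) →
                   IsRingHom (CommutativeRing.ring R) (CommutativeRing.ring (quotientRing R I)) id
quotientRing-hom R I =
  mkRingHom ring R/I.ring id ≈⇒∼
    (λ x y → R/I.refl {x + y}) (λ x y → R/I.refl {x * y}) (R/I.refl {1#})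
  where
  open CommutativeRing R
  module R/I = CommutativeRing (quotientRing R I)
  open Submodule I
  open AbelianGroupProperties +-abelianGroup using (x≈y⇒x∙y⁻¹≈ε)
  ≈⇒∼ : ∀ {x y} → x ≈ y → member (x - y)
  ≈⇒∼ p = resp (sym (x≈y⇒x∙y⁻¹≈ε p)) has0

record IsSubring (R : CommutativeRing ℓ ℓ) (P : Pred (CommutativeRing.Carrier R) ℓ) :
                 Set ℓ where
  open CommutativeRing R
  field
    has0 : P 0#
    has1 : P 1#
    has+ : ∀ {x y} → P x → P y → P (x + y)
    has* : ∀ {x y} → P x → P y → P (x * y)
    has- : ∀ {x} → P x → P (- x)

subring : (R : CommutativeRing ℓ ℓ) {P : Pred (CommutativeRing.Carrier R) ℓ} →
          IsSubring R P → CommutativeRing ℓ ℓ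
subring R {P} isSubring = record
  { Carrier = Σ Carrier P
  ; _≈_ = λ x y → proj₁ x ≈ proj₁ y
  ; _+_ = λ x y → proj₁ x + proj₁ y , has+ (proj₂ x) (proj₂ y)
  ; _*_ = λ x y → proj₁ x * proj₁ y , has* (proj₂ x) (proj₂ y)
  ; -_ = λ x → - proj₁ x , has- (proj₂ x)
  ; 0# = 0# , has0
  ; 1# = 1# , has1
  ; isCommutativeRing = record
    { isRing = record
      { +-isAbelianGroup = record
        { isGroup = record
          { isMonoid = record
            { isSemigroup = record
              { isMagma = record
                { isEquivalence = record { refl = refl ; sym = sym ; trans = trans }
                ; ∙-cong = +-cong
                }
              ; assoc = λ _ _ _ → +-assoc _ _ _
              }
            ; identity = (λ _ → +-identityˡ _) , (λ _ → +-identityʳ _)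
            }
          ; inverse = (λ _ → -‿inverseˡ _) , (λ _ → -‿inverseʳ _)
          ; ⁻¹-cong = -‿cong
          }
        ; comm = λ _ _ → +-comm _ _
        }
      ; *-cong = *-cong
      ; *-assoc = λ _ _ _ → *-assoc _ _ _
      ; *-identity = (λ _ → *-identityˡ _) , (λ _ → *-identityʳ _)
      ; distrib = (λ _ _ _ → distribˡ _ _ _) , (λ _ _ _ → distribʳ _ _ _)
      }
    ; *-comm = λ _ _ → *-comm _ _
    }
  }
  where
  open CommutativeRing R
  open IsSubring isSubring

subring-incl-hom : (R : CommutativeRing ℓ ℓ) {P : Pred (CommutativeRing.Carrier R) ℓ}
                   (isSubring : IsSubring R P) →
                   IsRingHom (CommutativeRing.ring (subring R isSubring))
                             (CommutativeRing.ring R) proj₁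
subring-incl-hom R isSubring =
  mkRingHom (CommutativeRing.ring (subring R isSubring)) ring proj₁ id
  (λ _ _ → refl) (λ _ _ → refl) refl
  where open CommutativeRing R

------------------------------------------------------------------------
-- Discrete valuations and local fields

-- A normalised discrete valuation K^× → ℤ.
record DiscreteValuation (K : Field ℓ) : Set ℓ where
  open Field K
  field
    v          : ∀ x → ¬ (x ≈ 0#) → ℤ
    v-cong     : ∀ {x y} x≉0 y≉0 → x ≈ y → v x x≉0 ≡ v y y≉0
    v-*        : ∀ {x y} x≉0 y≉0 xy≉0 → v (x * y) xy≉0 ≡ v x x≉0 ℤ.+ v y y≉0
    v-+        : ∀ {x y} x≉0 y≉0 x+y≉0 → v x x≉0 ℤ.⊓ v y y≉0 ℤ.≤ v (x + y) x+y≉0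
    surjective : ∀ i → ∃[ x ] Σ[ x≉0 ∈ ¬ (x ≈ 0#) ] (v x x≉0 ≡ i)

  -- v x ≥ i, with the convention v 0 = ∞.
  v≥ : ℤ → Pred Carrier ℓ
  v≥ i x = ∀ x≉0 → i ℤ.≤ v x x≉0

  v≥-resp : ∀ {i} → v≥ i Respects _≈_
  v≥-resp x≈y p y≉0 =
    ≡.subst (_ ℤ.≤_) (v-cong x≉0 y≉0 x≈y) (p x≉0)
    where x≉0 = λ x≈0 → y≉0 (trans (sym x≈y) x≈0)

  v≥-0 : ∀ {i} → v≥ i 0#
  v≥-0 0≉0 = ⊥-elim (0≉0 refl)

  v≥-+ : ∀ {i x y} → v≥ i x → v≥ i y → v≥ i (x + y)
  v≥-+ {i} {x} {y} p q x+y≉0 with i ℤ.≤? v (x + y) x+y≉0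
  ... | yes i≤v = i≤v
  ... | no  i≰v = ⊥-elim (i≰v (ℤ.≤-trans (ℤ.⊓-glb (p x≉0) (q y≉0)) (v-+ x≉0 y≉0 x+y≉0)))
    where
    x≉0 : ¬ (x ≈ 0#)
    x≉0 x≈0 = i≰v (v≥-resp (trans (sym (+-identityˡ y)) (+-congʳ (sym x≈0))) q x+y≉0)
    y≉0 : ¬ (y ≈ 0#)
    y≉0 y≈0 = i≰v (v≥-resp (trans (sym (+-identityʳ x)) (+-congˡ (sym y≈0))) p x+y≉0)

  v≥-* : ∀ {i j x y} → v≥ i x → v≥ j y → v≥ (i ℤ.+ j) (x * y)
  v≥-* {x = x} {y} p q xy≉0 =
    ≡.subst (_ ℤ.≤_) (≡.sym (v-* x≉0 y≉0 xy≉0)) (ℤ.+-mono-≤ (p x≉0) (q y≉0))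
    where
    x≉0 : ¬ (x ≈ 0#)
    x≉0 x≈0 = xy≉0 (trans (*-congʳ x≈0) (zeroˡ y))
    y≉0 : ¬ (y ≈ 0#)
    y≉0 y≈0 = xy≉0 (trans (*-congˡ y≈0) (zeroʳ x))

  v-1 : ∀ 1≉0 → v 1# 1≉0 ≡ + 0
  v-1 1≉0 = identityˡ-unique (v 1# 1≉0) (v 1# 1≉0)
    (≡.trans (≡.sym (v-* 1≉0 1≉0 1*1≉0)) (v-cong 1*1≉0 1≉0 (*-identityˡ 1#)))
    where
    open AbelianGroupProperties ℤ.+-0-abelianGroup using (identityˡ-unique)
    1*1≉0 = λ eq → 1≉0 (trans (sym (*-identityˡ 1#)) eq)

  v≥0-1 : v≥ (+ 0) 1#
  v≥0-1 1≉0 = ℤ.≤-reflexive (≡.sym (v-1 1≉0))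

  v≥0-neg1 : v≥ (+ 0) (- 1#)
  v≥0-neg1 -1≉0 = ℤ.≤-reflexive (≡.sym (halve (v (- 1#) -1≉0)
    (≡.trans (≡.sym (v-* -1≉0 -1≉0 sq≉0)) (≡.trans (v-cong sq≉0 1≉0 sq≈1) (v-1 1≉0)))))
    where
    open RingProperties ring using (-1*x≈-x)
    open AbelianGroupProperties +-abelianGroup using (⁻¹-involutive)
    sq≈1 : - 1# * - 1# ≈ 1#
    sq≈1 = trans (-1*x≈-x (- 1#)) (⁻¹-involutive 1#)
    sq≉0 = λ eq → 1≉0 (trans (sym sq≈1) eq)
    halve : ∀ i → i ℤ.+ i ≡ + 0 → i ≡ + 0
    halve (+ zero)  _  = ≡.refl
    halve (+ suc n) ()
    halve (-[1+ n ]) ()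

  v≥-neg : ∀ {i x} → v≥ i x → v≥ i (- x)
  v≥-neg {i} {x} p = v≥-resp (-1*x≈-x x)
    (≡.subst (λ j → v≥ j (- 1# * x)) (ℤ.+-identityˡ i) (v≥-* v≥0-neg1 p))
    where open RingProperties ring using (-1*x≈-x)

  𝒪-isSubring : IsSubring commutativeRing (v≥ (+ 0))
  𝒪-isSubring = record
    { has0 = v≥-0 ; has1 = v≥0-1 ; has+ = v≥-+ ; has* = v≥-* ; has- = v≥-neg }

  𝒪 : CommutativeRing ℓ ℓ
  𝒪 = subring commutativeRing 𝒪-isSubring

  𝒪-incl-hom : IsRingHom (CommutativeRing.ring 𝒪) ring proj₁
  𝒪-incl-hom = subring-incl-hom commutativeRing 𝒪-isSubring

  𝔪 : Submodule (regular (CommutativeRing.ring 𝒪))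
  𝔪 = record
    { member = λ x → v≥ (+ 1) (proj₁ x)
    ; isSubmodule = record
      { resp = v≥-resp
      ; has0 = v≥-0
      ; has+ = v≥-+
      ; has* = λ a x∈𝔪 → v≥-* (proj₂ a) x∈𝔪
      }
    }

  residueField : Field ℓ
  residueField = record
    { commutativeRing = quotientRing 𝒪 𝔪
    ; 1≉0 = 1∉𝔪
    ; inverse = inv
    }
    where
    open AbelianGroupProperties +-abelianGroup using (ε⁻¹≈ε; x≈y⇒x∙y⁻¹≈ε)
    x-0≈x : ∀ x → x - 0# ≈ x
    x-0≈x x = trans (+-congˡ ε⁻¹≈ε) (+-identityʳ x)

    1∉𝔪 : ¬ v≥ (+ 1) (1# - 0#)
    1∉𝔪 p with ≡.subst (+ 1 ℤ.≤_) (v-1 1≉0) (v≥-resp (x-0≈x 1#) p 1≉0)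
    ... | ℤ.+≤+ ()

    inv : ∀ x → ¬ v≥ (+ 1) (proj₁ x - 0#) →
          ∃[ y ] v≥ (+ 1) (proj₁ x * proj₁ {B = v≥ (+ 0)} y - 1#)
    inv (x , x∈𝒪) x∉𝔪 = (y , y∈𝒪) , v≥-resp (sym (x≈y⇒x∙y⁻¹≈ε xy≈1)) v≥-0
      where
      x≉0 : ¬ (x ≈ 0#)
      x≉0 x≈0 = x∉𝔪 (v≥-resp (trans (sym x≈0) (sym (x-0≈x x))) v≥-0)
      y = proj₁ (inverse x x≉0)
      xy≈1 = proj₂ (inverse x x≉0)
      xy≉0 : ¬ (x * y ≈ 0#)
      xy≉0 eq = 1≉0 (trans (sym xy≈1) eq)
      vx<1 : ∀ x≉0 → v x x≉0 ℤ.< + 1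
      vx<1 x≉0 = ℤ.≰⇒> (λ 1≤vx → x∉𝔪 (v≥-resp (sym (x-0≈x x))
        (λ x≉0′ → ≡.subst (+ 1 ℤ.≤_) (v-cong x≉0 x≉0′ refl) 1≤vx)))
      vx≡0 : ∀ x≉0 → v x x≉0 ≡ + 0
      vx≡0 x≉0 = ℤ.≤-antisym (ℤ.i<j⇒i≤pred[j] (vx<1 x≉0)) (x∈𝒪 x≉0)
      y∈𝒪 : v≥ (+ 0) y
      y∈𝒪 y≉0 = ℤ.≤-reflexive (≡.sym
        (≡.trans (≡.sym (ℤ.+-identityˡ (v y y≉0)))
        (≡.trans (≡.cong (ℤ._+ v y y≉0) (≡.sym (vx≡0 x≉0)))
        (≡.trans (≡.sym (v-* x≉0 y≉0 xy≉0))
        (≡.trans (v-cong xy≉0 1≉0 xy≈1) (v-1 1≉0))))))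

  IsCauchy : (ℕ → Carrier) → Set ℓ
  IsCauchy s = ∀ N → ∃[ m ] (∀ i j → m ℕ.≤ i → m ℕ.≤ j → v≥ (+ N) (s i - s j))

  _⟶_ : (ℕ → Carrier) → Carrier → Set ℓ
  s ⟶ x = ∀ N → ∃[ m ] (∀ i → m ℕ.≤ i → v≥ (+ N) (s i - x))

-- The subring 𝒪 of K attached to such a V is a complete discrete valuation
-- ring with fraction field K.
record CompleteDiscreteValuation (K : Field ℓ) : Set ℓ where
  field
    valuation : DiscreteValuation K
  open DiscreteValuation valuation public
  field
    complete : ∀ s → (∀ i → v≥ (+ 0) (s i)) → IsCauchy s →
               ∃[ x ] (v≥ (+ 0) x × s ⟶ x)

-- The structure of an n-dimensional local field on K.
LocalFieldStructure : ℕ → Field ℓ → Set ℓ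
LocalFieldStructure zero    K = ⊤
LocalFieldStructure (suc n) K =
  Σ[ V ∈ CompleteDiscreteValuation K ]
    LocalFieldStructure n (CompleteDiscreteValuation.residueField V)

-- Membership in the ring of integers 𝒪₁ ×_{k₁} 𝒪₂ ×_{k₂} ⋯ of K.
Integral : ∀ n {K : Field ℓ} → LocalFieldStructure n K → Pred (Field.Carrier K) ℓ
Integral zero    _       x = ⊤
Integral (suc n) (V , S) x = Σ[ x∈𝒪 ∈ v≥ (+ 0) x ] Integral n S (x , x∈𝒪)
  where open CompleteDiscreteValuation V

------------------------------------------------------------------------
-- Topologies

-- Subsets live at level ℓ, so a union of open sets indexed by a large type
-- need not be a subset at that level.  Open-local (a set containing an open
-- neighbourhood of each of its points is open) is closure under all unions
-- that exist.
record Topology (S : Setoid ℓ ℓ) : Set (lsuc (lsuc ℓ)) where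
  open Setoid S
  field
    Open       : Pred (Pred Carrier ℓ) (lsuc ℓ)
    Open-resp  : ∀ {V} → Open V → V Respects _≈_
    Open-⊤     : Open (λ _ → ⊤)
    Open-∩     : ∀ {V W} → Open V → Open W → Open (V ∩ W)
    Open-local : ∀ {V} → (∀ x → V x → ∃[ U ] (Open U × U x × U ⊆ V)) → Open V

module _ {S T : Setoid ℓ ℓ} (σ : Topology S) (τ : Topology T) where
  private
    module S = Setoid S
    module T = Setoid T
    module σ = Topology σ
    module τ = Topology τ

  Continuous : (S.Carrier → T.Carrier) → Set (lsuc ℓ)
  Continuous f = ∀ V → τ.Open V → σ.Open (V ∘ f)

  IsOpenMap : (S.Carrier → T.Carrier) → Set (lsuc ℓ)
  IsOpenMap f = ∀ U → σ.Open U → τ.Open (λ y → ∃[ x ] (U x × f x T.≈ y))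

discrete : (S : Setoid ℓ ℓ) → Topology S
discrete {ℓ} S = record
  { Open = λ V → Lift (lsuc ℓ) (V Respects _≈_)
  ; Open-resp = lower
  ; Open-⊤ = lift (λ _ _ → tt)
  ; Open-∩ = λ p q → lift (λ x≈y (v , w) → lower p x≈y v , lower q x≈y w)
  ; Open-local = λ loc → lift (λ {x} x≈y v →
      let (_ , U-open , u , U⊆V) = loc x v in U⊆V (lower U-open x≈y u))
  }
  where open Setoid S

subspaceSetoid : (S : Setoid ℓ ℓ) → Pred (Setoid.Carrier S) ℓ → Setoid ℓ ℓ
subspaceSetoid S P = record
  { Carrier = Σ Carrier P
  ; _≈_ = λ x y → proj₁ x ≈ proj₁ y
  ; isEquivalence = record { refl = refl ; sym = sym ; trans = trans }
  }
  where open Setoid S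

subspace : {S : Setoid ℓ ℓ} (P : Pred (Setoid.Carrier S) ℓ) →
           Topology S → Topology (subspaceSetoid S P)
subspace {ℓ} {S} P τ = record
  { Open = λ V → ∃[ W ] (Open W × V ⊆ W ∘ proj₁ × W ∘ proj₁ ⊆ V)
  ; Open-resp = λ (W , W-open , V⊆W , W⊆V) x≈y v → W⊆V (Open-resp W-open x≈y (V⊆W v))
  ; Open-⊤ = (λ _ → ⊤) , Open-⊤ , (λ _ → tt) , (λ _ → tt)
  ; Open-∩ = λ (W , W-open , V⊆W , W⊆V) (W′ , W′-open , V′⊆W′ , W′⊆V′) →
      W ∩ W′ , Open-∩ W-open W′-open ,
      (λ (v , v′) → V⊆W v , V′⊆W′ v′) , (λ (w , w′) → W⊆V w , W′⊆V′ w′)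
  ; Open-local = λ {V} loc →
      let ambient : ∀ x → V x → Pred Carrier ℓ
          ambient x v = proj₁ (proj₁ (proj₂ (loc x v))) in
      (λ y → Σ[ x ∈ Σ Carrier P ] Σ[ v ∈ V x ] ambient x v y) ,
      Open-local (λ y (x , v , w) →
        ambient x v , proj₁ (proj₂ (proj₁ (proj₂ (loc x v)))) , w , λ w′ → x , v , w′) ,
      (λ {x} v → let (_ , (_ , _ , U⊆W , _) , u , _) = loc x v in x , v , U⊆W u) ,
      (λ (x , v , w) → let (_ , (_ , _ , _ , W⊆U) , _ , U⊆V) = loc x v in U⊆V (W⊆U w))
  }
  where
  open Setoid S
  open Topology τ

-- The quotient topology for a map q : S → T; only used when q is surjective.
quotientTopology : {S T : Setoid ℓ ℓ} (q : Setoid.Carrier S → Setoid.Carrier T) →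
                   Topology S → Topology T
quotientTopology {S = S} {T} q τ = record
  { Open = λ V → V Respects T._≈_ × Open (V ∘ q)
  ; Open-resp = proj₁
  ; Open-⊤ = (λ _ _ → tt) , Open-⊤
  ; Open-∩ = λ (r , o) (r′ , o′) → (λ x≈y (v , w) → r x≈y v , r′ x≈y w) , Open-∩ o o′
  ; Open-local = λ loc →
      (λ {x} x≈y v → let (_ , (r , _) , u , U⊆V) = loc x v in U⊆V (r x≈y u)) ,
      Open-local (λ x v →
        let (U , (_ , o) , u , U⊆V) = loc (q x) v in U ∘ q , o , u , (λ {z} → U⊆V {q z}))
  }
  where
  module T = Setoid T
  open Topology τ

-- The topology with a given subbasis.
generated : (S : Setoid ℓ ℓ) {I : Set (lsuc ℓ)} (B : I → Pred (Setoid.Carrier S) ℓ) →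
            (∀ i → B i Respects Setoid._≈_ S) → Topology S
generated S B B-resp = record
  { Open = λ V → ∀ x → V x → ∃[ is ] (x ∈⋂ is × (∀ y → y ∈⋂ is → V y))
  ; Open-resp = λ V-open {x} {y} x≈y v →
      let (is , x∈ , ⋂⊆V) = V-open x v in
      ⋂⊆V y (All.map (λ {i} → B-resp i x≈y) x∈)
  ; Open-⊤ = λ _ _ → [] , [] , λ _ _ → tt
  ; Open-∩ = λ V-open W-open x (v , w) →
      let (is , x∈is , is⊆V) = V-open x v
          (js , x∈js , js⊆W) = W-open x w in
      is ++ js , ++⁺ x∈is x∈js ,
      λ y y∈ → is⊆V y (++⁻ˡ is y∈) , js⊆W y (++⁻ʳ is y∈)
  ; Open-local = λ loc x v →
      let (U , U-open , u , U⊆V) = loc x v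
          (is , x∈ , is⊆U) = U-open x u in
      is , x∈ , λ y y∈ → U⊆V (is⊆U y y∈)
  }
  where
  _∈⋂_ = λ x is → All (λ i → B i x) is

------------------------------------------------------------------------
-- Semi-topological rings and modules

module _ (k : Field ℓ) where
  private module k = Field k

  -- A commutative k-ring with a topology; no compatibility is imposed here.
  record TopRing : Set (lsuc (lsuc ℓ)) where
    field
      commutativeRing : CommutativeRing ℓ ℓ
    open CommutativeRing commutativeRing public
    field
      ι        : k.Carrier → Carrier
      ι-hom    : IsRingHom k.ring ring ι
      topology : Topology setoid

    overBase : Mod ring → Mod k.ring
    overBase = restrict k.ring ring ι-hom

  record IsLinearTopology (M : Mod k.ring) (τ : Topology (LeftModule.≈ᴹ-setoid M)) :
                          Set (lsuc ℓ) where
    open LeftModule M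
    open Topology τ
    field
      +-continuous : ∀ V x y → Open V → V (x +ᴹ y) →
                     ∃[ U ] ∃[ W ] (Open U × Open W × U x × W y ×
                                    (∀ {u w} → U u → W w → V (u +ᴹ w)))
      -- k is discrete, so this is continuity of k × M → M.
      *-continuous : ∀ c → Continuous τ τ (c *ₗ_)
      basis        : ∀ V → Open V → V 0ᴹ → ∃[ U ] (Open U × IsSubmodule M U × U ⊆ V)

  record IsSTRing (A : TopRing) : Set (lsuc ℓ) where
    open TopRing A
    field
      isLinear     : IsLinearTopology (overBase (regular ring)) topology
      *-continuous : ∀ a → Continuous topology topology (a *_)

  module _ (A : TopRing) (M : Mod (TopRing.ring A)) where
    private
      module A = TopRing A
      module τA = Topology A.topology
    open LeftModule M

    record IsSTModule (τ : Topology ≈ᴹ-setoid) : Set (lsuc ℓ) where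
      field
        isLinear      : IsLinearTopology (A.overBase M) τ
        *ₗ-continuous : ∀ a → Continuous τ τ (a *ₗ_)
        *ᵣ-continuous : ∀ m → Continuous A.topology τ (_*ₗ m)

    private
      IsFineSubmodule : Pred (Pred Carrierᴹ ℓ) (lsuc ℓ)
      IsFineSubmodule U = IsSubmodule (A.overBase M) U ×
                          (∀ m → τA.Open (λ a → U (a *ₗ m)))

    -- The open k-submodules are those U for which { a | a m ∈ U } is open in A
    -- for every m; fine-isST and fine-finest show that this is the fine A-module
    -- topology.
    fine : Topology ≈ᴹ-setoid
    fine = record
      { Open = λ V → V Respects _≈ᴹ_ ×
                     (∀ x → V x → ∃[ U ] (IsFineSubmodule U × (∀ {u} → U u → V (x +ᴹ u))))
      ; Open-resp = proj₁
      ; Open-⊤ = (λ _ _ → tt) , λ _ _ →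
          (λ _ → ⊤) ,
          (record { resp = λ _ _ → tt ; has0 = tt ; has+ = λ _ _ → tt ; has* = λ _ _ → tt } ,
           λ _ → τA.Open-⊤) ,
          λ _ → tt
      ; Open-∩ = λ (V-resp , V-open) (W-resp , W-open) →
          (λ x≈y (v , w) → V-resp x≈y v , W-resp x≈y w) ,
          λ x (v , w) →
            let (U₁ , (sub₁ , orb₁) , U₁⊆V) = V-open x v
                (U₂ , (sub₂ , orb₂) , U₂⊆W) = W-open x w
                module U₁ = IsSubmodule sub₁
                module U₂ = IsSubmodule sub₂ in
            U₁ ∩ U₂ ,
            (record
              { resp = λ x≈y (p , q) → U₁.resp x≈y p , U₂.resp x≈y q
              ; has0 = U₁.has0 , U₂.has0
              ; has+ = λ (p , q) (p′ , q′) → U₁.has+ p p′ , U₂.has+ q q′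
              ; has* = λ c (p , q) → U₁.has* c p , U₂.has* c q
              } ,
             λ m → τA.Open-∩ (orb₁ m) (orb₂ m)) ,
            λ (p , q) → U₁⊆V p , U₂⊆W q
      ; Open-local = λ loc →
          (λ {x} x≈y v → let (_ , (r , _) , u , U⊆V) = loc x v in U⊆V (r x≈y u)) ,
          λ x v →
            let (_ , (_ , o) , w , W⊆V) = loc x v
                (U , fineU , U⊆W) = o x w in
            U , fineU , λ u → W⊆V (U⊆W u)
      }

    private
      open AbelianGroupProperties +ᴹ-abelianGroup using (xyx⁻¹≈y)

      module Translation (N : Mod k.ring) (τ : Topology (LeftModule.≈ᴹ-setoid N))
                         (lin : IsLinearTopology N τ) where
        module N = LeftModule N
        open IsLinearTopology lin

        translate : ∀ V x → Topology.Open τ V → Topology.Open τ (λ y → V (x N.+ᴹ y))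
        translate V x V-open = Topology.Open-local τ λ y v →
          let (_ , W , _ , W-open , u , w , U+W⊆V) = +-continuous V x y V-open v in
          W , W-open , w , λ w′ → U+W⊆V u w′

      cancel : ∀ x z → x +ᴹ (z +ᴹ -ᴹ x) ≈ᴹ z
      cancel x z = ≈ᴹ-trans (≈ᴹ-sym (+ᴹ-assoc x z (-ᴹ x))) (xyx⁻¹≈y x z)

      recombine : ∀ x y u w → (x +ᴹ y) +ᴹ ((u +ᴹ -ᴹ x) +ᴹ (w +ᴹ -ᴹ y)) ≈ᴹ u +ᴹ w
      recombine x y u w =
        ≈ᴹ-trans (interchange x y (u +ᴹ -ᴹ x) (w +ᴹ -ᴹ y)) (+ᴹ-cong (cancel x u) (cancel y w))
        where
        open CommutativeSemigroupProperties
          (CommutativeMonoid.commutativeSemigroup +ᴹ-commutativeMonoid) using (interchange)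

      *ₗ-comm : ∀ a b m → a *ₗ (b *ₗ m) ≈ᴹ b *ₗ (a *ₗ m)
      *ₗ-comm a b m = ≈ᴹ-trans (≈ᴹ-sym (*ₗ-assoc a b m))
        (≈ᴹ-trans (*ₗ-congʳ (A.*-comm a b)) (*ₗ-assoc b a m))

      coset : ∀ x {U} → IsFineSubmodule U → Topology.Open fine (λ z → U (z +ᴹ -ᴹ x))
      coset x {U} (sub , orb) =
        (λ y≈z → resp (+ᴹ-congʳ y≈z)) ,
        λ y p → U , (sub , orb) ,
          λ {u} q → resp (≈ᴹ-trans (+ᴹ-assoc y (-ᴹ x) u)
            (≈ᴹ-trans (+ᴹ-congˡ (+ᴹ-comm (-ᴹ x) u)) (≈ᴹ-sym (+ᴹ-assoc y u (-ᴹ x))))) (has+ p q)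
        where open IsSubmodule sub

      *ₗ-cont : ∀ a → Continuous fine fine (a *ₗ_)
      *ₗ-cont a V (V-resp , V-open) =
        (λ x≈y → V-resp (*ₗ-congˡ x≈y)) ,
        λ x v →
          let (U , (sub , orb) , U⊆V) = V-open (a *ₗ x) v
              module U = IsSubmodule sub in
          (λ m → U (a *ₗ m)) ,
          (record
            { resp = λ x≈y → U.resp (*ₗ-congˡ x≈y)
            ; has0 = U.resp (≈ᴹ-sym (*ₗ-zeroʳ a)) U.has0
            ; has+ = λ p q → U.resp (≈ᴹ-sym (*ₗ-distribˡ a _ _)) (U.has+ p q)
            ; has* = λ c p → U.resp (*ₗ-comm (A.ι c) a _) (U.has* c p)
            } ,
           λ m → τA.Open-local λ b p →
             (λ c → U (c *ₗ (a *ₗ m))) , orb (a *ₗ m) , U.resp (*ₗ-comm a b m) p ,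
             λ {c} q → U.resp (*ₗ-comm c a m) q) ,
          λ u → V-resp (≈ᴹ-sym (*ₗ-distribˡ a x _)) (U⊆V u)

    fine-isST : IsSTRing A → IsSTModule fine
    fine-isST A-ST = record
      { isLinear = record
        { +-continuous = λ V x y (V-resp , V-open) v →
            let (U , (sub , orb) , U⊆V) = V-open (x +ᴹ y) v
                module U = IsSubmodule sub in
            (λ z → U (z +ᴹ -ᴹ x)) , (λ z → U (z +ᴹ -ᴹ y)) ,
            coset x (sub , orb) , coset y (sub , orb) ,
            U.resp (≈ᴹ-sym (-ᴹ‿inverseʳ x)) U.has0 , U.resp (≈ᴹ-sym (-ᴹ‿inverseʳ y)) U.has0 ,
            λ {u} {w} p q → V-resp (recombine x y u w) (U⊆V (U.has+ p q))
        ; *-continuous = λ c → *ₗ-cont (A.ι c)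
        ; basis = λ V (V-resp , V-open) v →
            let (U , (sub , orb) , U⊆V) = V-open 0ᴹ v in
            U ,
            (IsSubmodule.resp sub ,
             λ x u → U , (sub , orb) , λ u′ → IsSubmodule.has+ sub u u′) ,
            sub ,
            λ {x} u → V-resp (+ᴹ-identityˡ x) (U⊆V u)
        }
      ; *ₗ-continuous = *ₗ-cont
      ; *ᵣ-continuous = λ m V (V-resp , V-open) → τA.Open-local λ a v →
          let (U , (sub , orb) , U⊆V) = V-open (a *ₗ m) v
              module U = IsSubmodule sub in
          (λ b → U ((A.- a A.+ b) *ₗ m)) ,
          translate (λ b → U (b *ₗ m)) (A.- a) (orb m) ,
          U.resp (≈ᴹ-sym (≈ᴹ-trans (*ₗ-congʳ (A.-‿inverseˡ a)) (*ₗ-zeroˡ m))) U.has0 ,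
          λ {b} u → V-resp (≈ᴹ-trans (≈ᴹ-sym (*ₗ-distribʳ m a (A.- a A.+ b)))
            (*ₗ-congʳ (A.trans (A.sym (A.+-assoc a (A.- a) b))
              (A.trans (A.+-congʳ (A.-‿inverseʳ a)) (A.+-identityˡ b))))) (U⊆V u)
      }
      where open Translation (A.overBase (regular A.ring)) A.topology (IsSTRing.isLinear A-ST)

    fine-finest : ∀ τ → IsSTModule τ → ∀ V → Topology.Open τ V → Topology.Open fine V
    fine-finest τ τ-ST V V-open =
      Topology.Open-resp τ V-open ,
      λ x v →
        let (U , U-open , sub , U⊆V) =
              basis (λ y → V (x +ᴹ y)) (translate V x V-open)
                (Topology.Open-resp τ V-open (≈ᴹ-sym (+ᴹ-identityʳ x)) v) in
        U , (sub , λ m → *ᵣ-continuous m U U-open) , U⊆V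
      where
      open IsSTModule τ-ST
      open IsLinearTopology isLinear
      open Translation (A.overBase M) τ isLinear

------------------------------------------------------------------------
-- Power series and Laurent series

module PowerSeries (R : CommutativeRing ℓ ℓ) where
  open CommutativeRing R
  open RawMonoidDefinitions (Semiring.+-rawMonoid semiring) using (sum)
  open CommutativeSemigroupProperties
    (CommutativeMonoid.commutativeSemigroup +-commutativeMonoid) using (interchange)
  open SetoidReasoning setoid

  Series : Set ℓ
  Series = ℕ → Carrier

  infix 4 _≋_
  _≋_ : Series → Series → Set ℓ
  f ≋ g = ∀ n → f n ≈ g n

  infixl 7 _⋆_
  _⋆_ : Series → Series → Series
  (f ⋆ g) n = sum {suc n} (λ i → f (toℕ i) * g (n ∸ toℕ i))

  const : Carrier → Series
  const a zero    = a
  const a (suc _) = 0#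

  t : Series
  t (suc zero) = 1#
  t _          = 0#

  private
    infixl 6 _⊕_
    _⊕_ : Series → Series → Series
    (f ⊕ g) n = f n + g n

    tail : Series → Series
    tail f n = f (suc n)

    ⋆-cong : ∀ {f f′ g g′} → f ≋ f′ → g ≋ g′ → f ⋆ g ≋ f′ ⋆ g′
    ⋆-cong p q zero    = +-congʳ (*-cong (p 0) (q 0))
    ⋆-cong p q (suc n) = +-cong (*-cong (p 0) (q (suc n))) (⋆-cong (p ∘ suc) q n)

    ⋆-zeroˡ : ∀ {f} → f ≋ (λ _ → 0#) → ∀ g n → (f ⋆ g) n ≈ 0#
    ⋆-zeroˡ p g zero    = trans (+-identityʳ _) (trans (*-congʳ (p 0)) (zeroˡ _))
    ⋆-zeroˡ p g (suc n) =
      trans (+-cong (trans (*-congʳ (p 0)) (zeroˡ _)) (⋆-zeroˡ (p ∘ suc) g n)) (+-identityˡ 0#)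

    ⋆-last : ∀ f g n → (f ⋆ g) (suc n) ≈ (f ⋆ tail g) n + f (suc n) * g 0
    ⋆-last f g zero    = trans (+-congˡ (+-identityʳ _)) (+-congʳ (sym (+-identityʳ _)))
    ⋆-last f g (suc n) = trans (+-congˡ (⋆-last (tail f) g n)) (sym (+-assoc _ _ _))

    ⋆-comm : ∀ f g → f ⋆ g ≋ g ⋆ f
    ⋆-comm f g zero    = +-congʳ (*-comm _ _)
    ⋆-comm f g (suc n) = begin
      f 0 * g (suc n) + (tail f ⋆ g) n  ≈⟨ +-cong (*-comm _ _) (⋆-comm (tail f) g n) ⟩
      g (suc n) * f 0 + (g ⋆ tail f) n  ≈⟨ +-comm _ _ ⟩
      (g ⋆ tail f) n + g (suc n) * f 0  ≈⟨ ⋆-last g f n ⟨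
      (g ⋆ f) (suc n)                   ∎

    ⋆-distribʳ : ∀ h f g → (f ⊕ g) ⋆ h ≋ (f ⋆ h) ⊕ (g ⋆ h)
    ⋆-distribʳ h f g zero = trans (+-congʳ (distribʳ _ _ _))
      (trans (+-congˡ (sym (+-identityˡ 0#))) (interchange _ _ _ _))
    ⋆-distribʳ h f g (suc n) =
      trans (+-cong (distribʳ _ _ _) (⋆-distribʳ h (tail f) (tail g) n)) (interchange _ _ _ _)

    ⋆-scale : ∀ c f g n → ((λ i → c * f i) ⋆ g) n ≈ c * (f ⋆ g) n
    ⋆-scale c f g zero    = trans (+-cong (*-assoc _ _ _) (sym (zeroʳ c))) (sym (distribˡ _ _ _))
    ⋆-scale c f g (suc n) =
      trans (+-cong (*-assoc _ _ _) (⋆-scale c (tail f) g n)) (sym (distribˡ _ _ _))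

    ⋆-assoc : ∀ f g h → (f ⋆ g) ⋆ h ≋ f ⋆ (g ⋆ h)
    ⋆-assoc f g h zero = +-congʳ (begin
      (f 0 * g 0 + 0#) * h 0  ≈⟨ *-congʳ (+-identityʳ _) ⟩
      f 0 * g 0 * h 0         ≈⟨ *-assoc _ _ _ ⟩
      f 0 * (g 0 * h 0)       ≈⟨ *-congˡ (+-identityʳ _) ⟨
      f 0 * (g 0 * h 0 + 0#)  ∎)
    ⋆-assoc f g h (suc n) = begin
      (f 0 * g 0 + 0#) * h (suc n) + (tail (f ⋆ g) ⋆ h) n
        ≈⟨ +-cong (trans (*-congʳ (+-identityʳ _)) (*-assoc _ _ _))
                  (⋆-distribʳ h (λ i → f 0 * tail g i) (tail f ⋆ g) n) ⟩
      f 0 * (g 0 * h (suc n)) + (((λ i → f 0 * tail g i) ⋆ h) n + ((tail f ⋆ g) ⋆ h) n)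
        ≈⟨ +-congˡ (+-cong (⋆-scale (f 0) (tail g) h n) (⋆-assoc (tail f) g h n)) ⟩
      f 0 * (g 0 * h (suc n)) + (f 0 * (tail g ⋆ h) n + (tail f ⋆ (g ⋆ h)) n)
        ≈⟨ +-assoc _ _ _ ⟨
      f 0 * (g 0 * h (suc n)) + f 0 * (tail g ⋆ h) n + (tail f ⋆ (g ⋆ h)) n
        ≈⟨ +-congʳ (distribˡ _ _ _) ⟨
      f 0 * (g ⋆ h) (suc n) + (tail f ⋆ (g ⋆ h)) n ∎

    ⋆-identityˡ : ∀ g → const 1# ⋆ g ≋ g
    ⋆-identityˡ g zero    = trans (+-identityʳ _) (*-identityˡ _)
    ⋆-identityˡ g (suc n) =
      trans (+-cong (*-identityˡ _) (⋆-zeroˡ (λ _ → refl) g n)) (+-identityʳ _)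

  commutativeRing : CommutativeRing ℓ ℓ
  commutativeRing = record
    { Carrier = Series
    ; _≈_ = _≋_
    ; _+_ = _⊕_
    ; _*_ = _⋆_
    ; -_ = λ f n → - f n
    ; 0# = λ _ → 0#
    ; 1# = const 1#
    ; isCommutativeRing = record
      { isRing = record
        { +-isAbelianGroup = record
          { isGroup = record
            { isMonoid = record
              { isSemigroup = record
                { isMagma = record
                  { isEquivalence = record
                    { refl = λ _ → refl
                    ; sym = λ p n → sym (p n)
                    ; trans = λ p q n → trans (p n) (q n)
                    }
                  ; ∙-cong = λ p q n → +-cong (p n) (q n)
                  }
                ; assoc = λ _ _ _ _ → +-assoc _ _ _
                }
              ; identity = (λ _ _ → +-identityˡ _) , (λ _ _ → +-identityʳ _)
              }
            ; inverse = (λ _ _ → -‿inverseˡ _) , (λ _ _ → -‿inverseʳ _)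
            ; ⁻¹-cong = λ p n → -‿cong (p n)
            }
          ; comm = λ _ _ _ → +-comm _ _
          }
        ; *-cong = ⋆-cong
        ; *-assoc = ⋆-assoc
        ; *-identity = ⋆-identityˡ , (λ f n → trans (⋆-comm f (const 1#) n) (⋆-identityˡ f n))
        ; distrib =
            (λ f g h n → trans (⋆-comm f (g ⊕ h) n) (trans (⋆-distribʳ f g h n)
              (+-cong (⋆-comm g f n) (⋆-comm h f n)))) ,
            ⋆-distribʳ
        }
      ; *-comm = ⋆-comm
      }
    }

  const-hom : IsRingHom ring (CommutativeRing.ring commutativeRing) const
  const-hom = mkRingHom ring (CommutativeRing.ring commutativeRing) const
    (λ { p zero → p ; p (suc _) → refl })
    (λ { a b zero → refl ; a b (suc _) → sym (+-identityˡ 0#) })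
    (λ { a b zero → sym (+-identityʳ _)
       ; a b (suc n) → sym (trans (+-cong (zeroʳ a) (⋆-zeroˡ (λ _ → refl) (const b) n))
                                  (+-identityˡ 0#)) })
    (λ _ → refl)

-- R[x⁻¹]; the pair (a , m) stands for a / x ^ m.
module Localization (R : CommutativeRing ℓ ℓ) (x : CommutativeRing.Carrier R) where
  open CommutativeRing R
  open ExpProperties semiring using (_^_; ^-homo-*)
  open SemiringSolver commutativeSemiring using (solve; _:=_; _:+_; _:*_)
  open SetoidReasoning setoid

  Fraction : Set ℓ
  Fraction = Carrier × ℕ

  infix 4 _∼_
  record _∼_ (p q : Fraction) : Set ℓ where
    constructor via
    field
      l          : ℕ
      cross-mult : x ^ l * (x ^ proj₂ q * proj₁ p) ≈ x ^ l * (x ^ proj₂ p * proj₁ q)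

  infixl 6 _⊕_
  _⊕_ : Fraction → Fraction → Fraction
  (a , m) ⊕ (b , n) = x ^ n * a + x ^ m * b , m ℕ.+ n

  infixl 7 _⊗_
  _⊗_ : Fraction → Fraction → Fraction
  (a , m) ⊗ (b , n) = a * b , m ℕ.+ n

  ⊖_ : Fraction → Fraction
  ⊖ (a , m) = - a , m

  embed : Carrier → Fraction
  embed a = a , 0

  private
    hom : ∀ m n → x ^ (m ℕ.+ n) ≈ x ^ m * x ^ n
    hom = ^-homo-* x

    -- Equality with l = 0.
    direct : ∀ {a b} m n → x ^ n * a ≈ x ^ m * b → (a , m) ∼ (b , n)
    direct m n p = via 0 (*-congˡ p)

    refl′ : ∀ p → p ∼ p
    refl′ (a , m) = direct m m refl

    sym′ : ∀ {p q} → p ∼ q → q ∼ p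
    sym′ (via l e) = via l (sym e)

    trans′ : ∀ {p q r} → p ∼ q → q ∼ r → p ∼ r
    trans′ {a , m} {b , n} {c , p} (via l e) (via l′ e′) = via (l ℕ.+ l′ ℕ.+ n) (begin
      x ^ (l ℕ.+ l′ ℕ.+ n) * (x ^ p * a)
        ≈⟨ *-congʳ pow ⟩
      (x ^ l * x ^ l′ * x ^ n) * (x ^ p * a)
        ≈⟨ solve 5 (λ L L′ N P A → (L :* L′ :* N) :* (P :* A) := (L′ :* P) :* (L :* (N :* A)))
             refl (x ^ l) (x ^ l′) (x ^ n) (x ^ p) a ⟩
      (x ^ l′ * x ^ p) * (x ^ l * (x ^ n * a))
        ≈⟨ *-congˡ e ⟩
      (x ^ l′ * x ^ p) * (x ^ l * (x ^ m * b))
        ≈⟨ solve 5 (λ L L′ M P B → (L′ :* P) :* (L :* (M :* B)) := (L :* M) :* (L′ :* (P :* B)))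
             refl (x ^ l) (x ^ l′) (x ^ m) (x ^ p) b ⟩
      (x ^ l * x ^ m) * (x ^ l′ * (x ^ p * b))
        ≈⟨ *-congˡ e′ ⟩
      (x ^ l * x ^ m) * (x ^ l′ * (x ^ n * c))
        ≈⟨ solve 5 (λ L L′ M N C → (L :* M) :* (L′ :* (N :* C)) := (L :* L′ :* N) :* (M :* C))
             refl (x ^ l) (x ^ l′) (x ^ m) (x ^ n) c ⟩
      (x ^ l * x ^ l′ * x ^ n) * (x ^ m * c)
        ≈⟨ *-congʳ pow ⟨
      x ^ (l ℕ.+ l′ ℕ.+ n) * (x ^ m * c) ∎)
      where
      pow : x ^ (l ℕ.+ l′ ℕ.+ n) ≈ x ^ l * x ^ l′ * x ^ n
      pow = trans (hom (l ℕ.+ l′) n) (*-congʳ (hom l l′))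

    ⊕-cong : ∀ {p p′ q q′} → p ∼ p′ → q ∼ q′ → p ⊕ q ∼ p′ ⊕ q′
    ⊕-cong {a , m} {a′ , m′} {b , n} {b′ , n′} (via l e) (via l′ e′) = via (l ℕ.+ l′) (begin
      x ^ (l ℕ.+ l′) * (x ^ (m′ ℕ.+ n′) * (x ^ n * a + x ^ m * b))
        ≈⟨ *-cong (hom l l′) (*-congʳ (hom m′ n′)) ⟩
      (x ^ l * x ^ l′) * ((x ^ m′ * x ^ n′) * (x ^ n * a + x ^ m * b))
        ≈⟨ solve 8 (λ L L′ M N M′ N′ A B →
             (L :* L′) :* ((M′ :* N′) :* (N :* A :+ M :* B)) :=
             (L′ :* N′ :* N) :* (L :* (M′ :* A)) :+ (L :* M′ :* M) :* (L′ :* (N′ :* B)))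
             refl (x ^ l) (x ^ l′) (x ^ m) (x ^ n) (x ^ m′) (x ^ n′) a b ⟩
      (x ^ l′ * x ^ n′ * x ^ n) * (x ^ l * (x ^ m′ * a)) +
      (x ^ l * x ^ m′ * x ^ m) * (x ^ l′ * (x ^ n′ * b))
        ≈⟨ +-cong (*-congˡ e) (*-congˡ e′) ⟩
      (x ^ l′ * x ^ n′ * x ^ n) * (x ^ l * (x ^ m * a′)) +
      (x ^ l * x ^ m′ * x ^ m) * (x ^ l′ * (x ^ n * b′))
        ≈⟨ solve 8 (λ L L′ M N M′ N′ A B →
             (L′ :* N′ :* N) :* (L :* (M :* A)) :+ (L :* M′ :* M) :* (L′ :* (N :* B)) :=
             (L :* L′) :* ((M :* N) :* (N′ :* A :+ M′ :* B)))
             refl (x ^ l) (x ^ l′) (x ^ m) (x ^ n) (x ^ m′) (x ^ n′) a′ b′ ⟩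
      (x ^ l * x ^ l′) * ((x ^ m * x ^ n) * (x ^ n′ * a′ + x ^ m′ * b′))
        ≈⟨ *-cong (hom l l′) (*-congʳ (hom m n)) ⟨
      x ^ (l ℕ.+ l′) * (x ^ (m ℕ.+ n) * (x ^ n′ * a′ + x ^ m′ * b′)) ∎)

    ⊗-cong : ∀ {p p′ q q′} → p ∼ p′ → q ∼ q′ → p ⊗ q ∼ p′ ⊗ q′
    ⊗-cong {a , m} {a′ , m′} {b , n} {b′ , n′} (via l e) (via l′ e′) = via (l ℕ.+ l′) (begin
      x ^ (l ℕ.+ l′) * (x ^ (m′ ℕ.+ n′) * (a * b))
        ≈⟨ *-cong (hom l l′) (*-congʳ (hom m′ n′)) ⟩
      (x ^ l * x ^ l′) * ((x ^ m′ * x ^ n′) * (a * b))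
        ≈⟨ shuffle (x ^ l) (x ^ l′) (x ^ m′) (x ^ n′) a b ⟩
      (x ^ l * (x ^ m′ * a)) * (x ^ l′ * (x ^ n′ * b))
        ≈⟨ *-cong e e′ ⟩
      (x ^ l * (x ^ m * a′)) * (x ^ l′ * (x ^ n * b′))
        ≈⟨ shuffle (x ^ l) (x ^ l′) (x ^ m) (x ^ n) a′ b′ ⟨
      (x ^ l * x ^ l′) * ((x ^ m * x ^ n) * (a′ * b′))
        ≈⟨ *-cong (hom l l′) (*-congʳ (hom m n)) ⟨
      x ^ (l ℕ.+ l′) * (x ^ (m ℕ.+ n) * (a′ * b′)) ∎)
      where
      shuffle = solve 6 (λ L L′ M N A B →
        (L :* L′) :* ((M :* N) :* (A :* B)) := (L :* (M :* A)) :* (L′ :* (N :* B))) refl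

    ⊖-cong : ∀ {p q} → p ∼ q → ⊖ p ∼ ⊖ q
    ⊖-cong {a , m} {b , n} (via l e) = via l
      (trans (pull (x ^ l) (x ^ n) a) (trans (-‿cong e) (sym (pull (x ^ l) (x ^ m) b))))
      where
      open RingProperties ring using (-‿distribʳ-*)
      pull : ∀ u w c → u * (w * - c) ≈ - (u * (w * c))
      pull u w c = trans (*-congˡ (sym (-‿distribʳ-* w c))) (sym (-‿distribʳ-* u (w * c)))

    ⊕-assoc : ∀ p q r → (p ⊕ q) ⊕ r ∼ p ⊕ (q ⊕ r)
    ⊕-assoc (a , m) (b , n) (c , p) = direct (m ℕ.+ n ℕ.+ p) (m ℕ.+ (n ℕ.+ p)) (begin
      x ^ (m ℕ.+ (n ℕ.+ p)) * (x ^ p * (x ^ n * a + x ^ m * b) + x ^ (m ℕ.+ n) * c)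
        ≈⟨ *-cong (trans (hom m (n ℕ.+ p)) (*-congˡ (hom n p))) (+-congˡ (*-congʳ (hom m n))) ⟩
      (x ^ m * (x ^ n * x ^ p)) * (x ^ p * (x ^ n * a + x ^ m * b) + (x ^ m * x ^ n) * c)
        ≈⟨ solve 6 (λ M N P A B C →
             (M :* (N :* P)) :* (P :* (N :* A :+ M :* B) :+ (M :* N) :* C) :=
             ((M :* N) :* P) :* ((N :* P) :* A :+ M :* (P :* B :+ N :* C)))
             refl (x ^ m) (x ^ n) (x ^ p) a b c ⟩
      ((x ^ m * x ^ n) * x ^ p) * ((x ^ n * x ^ p) * a + x ^ m * (x ^ p * b + x ^ n * c))
        ≈⟨ *-cong (trans (hom (m ℕ.+ n) p) (*-congʳ (hom m n))) (+-congʳ (*-congʳ (hom n p))) ⟨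
      x ^ (m ℕ.+ n ℕ.+ p) * (x ^ (n ℕ.+ p) * a + x ^ m * (x ^ p * b + x ^ n * c)) ∎)

    ⊕-comm : ∀ p q → p ⊕ q ∼ q ⊕ p
    ⊕-comm (a , m) (b , n) = direct (m ℕ.+ n) (n ℕ.+ m)
      (*-cong (reflexive (≡.cong (x ^_) (ℕ.+-comm n m))) (+-comm _ _))

    ⊕-identityˡ : ∀ p → embed 0# ⊕ p ∼ p
    ⊕-identityˡ (a , m) = direct m m (*-congˡ
      (trans (+-cong (zeroʳ _) (*-identityˡ a)) (+-identityˡ a)))

    ⊕-inverseˡ : ∀ p → ⊖ p ⊕ p ∼ embed 0#
    ⊕-inverseˡ (a , m) = direct (m ℕ.+ m) 0 (begin
      1# * (x ^ m * - a + x ^ m * a)  ≈⟨ *-identityˡ _ ⟩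
      x ^ m * - a + x ^ m * a         ≈⟨ distribˡ _ _ _ ⟨
      x ^ m * (- a + a)               ≈⟨ *-congˡ (-‿inverseˡ a) ⟩
      x ^ m * 0#                      ≈⟨ zeroʳ _ ⟩
      0#                              ≈⟨ zeroʳ _ ⟨
      x ^ (m ℕ.+ m) * 0#              ∎)

    ⊗-assoc : ∀ p q r → (p ⊗ q) ⊗ r ∼ p ⊗ (q ⊗ r)
    ⊗-assoc (a , m) (b , n) (c , p) = direct (m ℕ.+ n ℕ.+ p) (m ℕ.+ (n ℕ.+ p))
      (*-cong (reflexive (≡.cong (x ^_) (≡.sym (ℕ.+-assoc m n p)))) (*-assoc a b c))

    ⊗-comm : ∀ p q → p ⊗ q ∼ q ⊗ p
    ⊗-comm (a , m) (b , n) = direct (m ℕ.+ n) (n ℕ.+ m)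
      (*-cong (reflexive (≡.cong (x ^_) (ℕ.+-comm n m))) (*-comm a b))

    ⊗-identityˡ : ∀ p → embed 1# ⊗ p ∼ p
    ⊗-identityˡ (a , m) = direct m m (*-congˡ (*-identityˡ a))

    ⊗-distribˡ : ∀ p q r → p ⊗ (q ⊕ r) ∼ (p ⊗ q) ⊕ (p ⊗ r)
    ⊗-distribˡ (a , m) (b , n) (c , p) = direct (m ℕ.+ (n ℕ.+ p)) (m ℕ.+ n ℕ.+ (m ℕ.+ p)) (begin
      x ^ (m ℕ.+ n ℕ.+ (m ℕ.+ p)) * (a * (x ^ p * b + x ^ n * c))
        ≈⟨ *-congʳ (trans (hom (m ℕ.+ n) (m ℕ.+ p)) (*-cong (hom m n) (hom m p))) ⟩
      (x ^ m * x ^ n) * (x ^ m * x ^ p) * (a * (x ^ p * b + x ^ n * c))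
        ≈⟨ solve 6 (λ M N P A B C →
             (M :* N) :* (M :* P) :* (A :* (P :* B :+ N :* C)) :=
             (M :* (N :* P)) :* ((M :* P) :* (A :* B) :+ (M :* N) :* (A :* C)))
             refl (x ^ m) (x ^ n) (x ^ p) a b c ⟩
      (x ^ m * (x ^ n * x ^ p)) * ((x ^ m * x ^ p) * (a * b) + (x ^ m * x ^ n) * (a * c))
        ≈⟨ *-cong (trans (hom m (n ℕ.+ p)) (*-congˡ (hom n p)))
                  (+-cong (*-congʳ (hom m p)) (*-congʳ (hom m n))) ⟨
      x ^ (m ℕ.+ (n ℕ.+ p)) * (x ^ (m ℕ.+ p) * (a * b) + x ^ (m ℕ.+ n) * (a * c)) ∎)

  commutativeRing : CommutativeRing ℓ ℓ
  commutativeRing = record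
    { Carrier = Fraction
    ; _≈_ = _∼_
    ; _+_ = _⊕_
    ; _*_ = _⊗_
    ; -_ = ⊖_
    ; 0# = embed 0#
    ; 1# = embed 1#
    ; isCommutativeRing = record
      { isRing = record
        { +-isAbelianGroup = record
          { isGroup = record
            { isMonoid = record
              { isSemigroup = record
                { isMagma = record
                  { isEquivalence = record
                    { refl = λ {p} → refl′ p
                    ; sym = sym′
                    ; trans = trans′
                    }
                  ; ∙-cong = ⊕-cong
                  }
                ; assoc = ⊕-assoc
                }
              ; identity = ⊕-identityˡ ,
                           (λ p → trans′ (⊕-comm p (embed 0#)) (⊕-identityˡ p))
              }
            ; inverse = ⊕-inverseˡ , (λ p → trans′ (⊕-comm p (⊖ p)) (⊕-inverseˡ p))
            ; ⁻¹-cong = ⊖-cong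
            }
          ; comm = ⊕-comm
          }
        ; *-cong = ⊗-cong
        ; *-assoc = ⊗-assoc
        ; *-identity = ⊗-identityˡ ,
                       (λ p → trans′ (⊗-comm p (embed 1#)) (⊗-identityˡ p))
        ; distrib = ⊗-distribˡ ,
            (λ p q r → trans′ (⊗-comm (q ⊕ r) p)
              (trans′ (⊗-distribˡ p q r) (⊕-cong (⊗-comm p q) (⊗-comm p r))))
        }
      ; *-comm = ⊗-comm
      }
    }

  embed-hom : IsRingHom ring (CommutativeRing.ring commutativeRing) embed
  embed-hom = mkRingHom ring (CommutativeRing.ring commutativeRing) embed
    (λ p → direct 0 0 (*-congˡ p))
    (λ a b → direct 0 0 (*-congˡ (sym (+-cong (*-identityˡ a) (*-identityˡ b)))))
    (λ a b → refl′ (embed (a * b)))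
    (refl′ (embed 1#))

-- A[t]/(tⁱ⁺¹) as an A-module, in terms of coefficients.
truncated : (R : CommutativeRing ℓ ℓ) → ℕ → Mod (CommutativeRing.ring R)
truncated R i = record
  { Carrierᴹ = Fin (suc i) → Carrier
  ; _≈ᴹ_ = λ f g → ∀ j → f j ≈ g j
  ; _+ᴹ_ = λ f g j → f j + g j
  ; _*ₗ_ = λ a f j → a * f j
  ; 0ᴹ = λ _ → 0#
  ; -ᴹ_ = λ f j → - f j
  ; isLeftModule = record
    { isLeftSemimodule = record
      { +ᴹ-isCommutativeMonoid = record
        { isMonoid = record
          { isSemigroup = record
            { isMagma = record
              { isEquivalence = record
                { refl = λ _ → refl
                ; sym = λ p j → sym (p j)
                ; trans = λ p q j → trans (p j) (q j)
                }
              ; ∙-cong = λ p q j → +-cong (p j) (q j)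
              }
            ; assoc = λ _ _ _ _ → +-assoc _ _ _
            }
          ; identity = (λ _ _ → +-identityˡ _) , (λ _ _ → +-identityʳ _)
          }
        ; comm = λ _ _ _ → +-comm _ _
        }
      ; isPreleftSemimodule = record
        { *ₗ-cong = λ p q j → *-cong p (q j)
        ; *ₗ-zeroˡ = λ _ _ → zeroˡ _
        ; *ₗ-distribʳ = λ _ _ _ _ → distribʳ _ _ _
        ; *ₗ-identityˡ = λ _ _ → *-identityˡ _
        ; *ₗ-assoc = λ _ _ _ _ → *-assoc _ _ _
        ; *ₗ-zeroʳ = λ _ _ → zeroʳ _
        ; *ₗ-distribˡ = λ _ _ _ _ → distribˡ _ _ _
        }
      }
    ; -ᴹ‿cong = λ p j → -‿cong (p j)
    ; -ᴹ‿inverse = (λ _ _ → -‿inverseˡ _) , (λ _ _ → -‿inverseʳ _)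
    }
  }
  where open CommutativeRing R

module _ {k : Field ℓ} where
  private module k = Field k

  module _ (A : TopRing k) where
    private
      module A = TopRing A
      module A[[t]] = PowerSeries A.commutativeRing
      module A[[t]]ʳ = CommutativeRing A[[t]].commutativeRing
      module A⸨t⸩ = Localization A[[t]].commutativeRing A[[t]].t
      module A⸨t⸩ʳ = CommutativeRing A⸨t⸩.commutativeRing

    -- A[[t]] with the inverse limit topology.
    powerSeries : TopRing k
    powerSeries = record
      { commutativeRing = A[[t]].commutativeRing
      ; ι = A[[t]].const ∘ A.ι
      ; ι-hom = ∘-isRingHom k.ring A.ring A[[t]]ʳ.ring A.ι-hom A[[t]].const-hom
      ; topology = generated A[[t]]ʳ.setoid
          {I = Σ[ i ∈ ℕ ] ∃ (Topology.Open (fine k A (truncated A.commutativeRing i)))}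
          (λ (i , W , _) f → W (f ∘ toℕ))
          (λ (i , W , W-open) f≋g →
            Topology.Open-resp (fine k A (truncated A.commutativeRing i)) W-open (f≋g ∘ toℕ))
      }

    -- A((t)) with the fine A[[t]]-module topology.
    laurent : TopRing k
    laurent = record
      { commutativeRing = A⸨t⸩.commutativeRing
      ; ι = A⸨t⸩.embed ∘ P.ι
      ; ι-hom = ∘-isRingHom k.ring P.ring A⸨t⸩ʳ.ring P.ι-hom A⸨t⸩.embed-hom
      ; topology = fine k powerSeries
          (restrict P.ring A⸨t⸩ʳ.ring A⸨t⸩.embed-hom (regular A⸨t⸩ʳ.ring))
      }
      where module P = TopRing powerSeries

    laurent-embed : TopRing.Carrier powerSeries → TopRing.Carrier laurent
    laurent-embed = A⸨t⸩.embed

    laurent-const : A.Carrier → TopRing.Carrier laurent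
    laurent-const = A⸨t⸩.embed ∘ A[[t]].const

  iteratedLaurent : ℕ → TopRing k → TopRing k
  iteratedLaurent zero    A = A
  iteratedLaurent (suc n) A = laurent (iteratedLaurent n A)

------------------------------------------------------------------------
-- Topological local fields

-- An n-dimensional local field K with a ring homomorphism k → 𝒪(K) and a
-- topology, subject to no further conditions.
record LocalFieldData (k : Field ℓ) (n : ℕ) : Set (lsuc (lsuc ℓ)) where
  private module k = Field k
  field
    K          : Field ℓ
    structure  : LocalFieldStructure n K
  open Field K public
  field
    ι          : k.Carrier → Carrier
    ι-hom      : IsRingHom k.ring ring ι
    ι-integral : ∀ c → Integral n structure (ι c)
    topology   : Topology setoid

  topRing : TopRing k
  topRing = record
    { commutativeRing = commutativeRing ; ι = ι ; ι-hom = ι-hom ; topology = topology }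

  open TopRing topRing public using (overBase)

module _ {k : Field ℓ} where
  private module k = Field k

  module FirstValuation {n : ℕ} (T : LocalFieldData k (suc n)) where
    private module T = LocalFieldData T
    open CompleteDiscreteValuation (proj₁ T.structure) public
    module 𝒪 = CommutativeRing 𝒪
    module k₁ = Field residueField

    ι-𝒪 : k.Carrier → 𝒪.Carrier
    ι-𝒪 c = T.ι c , proj₁ (T.ι-integral c)

    ι-𝒪-hom : IsRingHom k.ring 𝒪.ring ι-𝒪
    ι-𝒪-hom = mkRingHom k.ring 𝒪.ring ι-𝒪 ⟦⟧-cong +-homo *-homo 1#-homo
      where open RingMorphisms.IsRingHomomorphism T.ι-hom

    𝒪-topology : Topology 𝒪.setoid
    𝒪-topology = subspace (v≥ (+ 0)) T.topology

    residue : LocalFieldData k n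
    residue = record
      { K = residueField
      ; structure = proj₂ T.structure
      ; ι = ι-𝒪
      ; ι-hom = ∘-isRingHom k.ring 𝒪.ring k₁.ring ι-𝒪-hom (quotientRing-hom 𝒪 𝔪)
      ; ι-integral = λ c → proj₂ (T.ι-integral c)
      ; topology = quotientTopology {T = k₁.setoid} id 𝒪-topology
      }

  open FirstValuation using (residue) public

  lastResidue : ∀ {n} → LocalFieldData k n → LocalFieldData k 0
  lastResidue {zero}  T = T
  lastResidue {suc n} T = lastResidue (residue T)

  -- f maps A((t₂,…,tₙ))[[t₁]] onto 𝒪₁, the induced map of residue fields
  -- A((t₂,…,tₙ)) → k₁ maps A((t₃,…,tₙ))[[t₂]] onto 𝒪₂, and so on.
  RespectsValuations : ∀ {n} (A : TopRing k) (T : LocalFieldData k n) →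
    (TopRing.Carrier (iteratedLaurent n A) → LocalFieldData.Carrier T) → Set ℓ
  RespectsValuations {n = zero}  A T f = ⊤
  RespectsValuations {n = suc n} A T f =
    Σ[ into ∈ (∀ g → v≥ (+ 0) (f (laurent-embed Aₙ g))) ]
      ((∀ y → v≥ (+ 0) y → ∃[ g ] (f (laurent-embed Aₙ g) T.≈ y)) ×
       RespectsValuations A (residue T)
         (λ a → f (laurent-const Aₙ a) , into (PowerSeries.const (TopRing.commutativeRing Aₙ) a)))
    where
    module T = LocalFieldData T
    open FirstValuation T using (v≥)
    Aₙ = iteratedLaurent n A

  module _ {n : ℕ} (T : LocalFieldData k n) where
    private
      module T = LocalFieldData T
      module k′ = LocalFieldData (lastResidue T)

    -- k′ = kₙ(K) with the discrete topology.
    coefficientField : TopRing k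
    coefficientField = record
      { commutativeRing = k′.commutativeRing
      ; ι = k′.ι
      ; ι-hom = k′.ι-hom
      ; topology = discrete k′.setoid
      }

    standardField : TopRing k
    standardField = iteratedLaurent n coefficientField

    private module S = TopRing standardField

    record IsParametrization (f : S.Carrier → T.Carrier) : Set (lsuc ℓ) where
      field
        isRingIso          : IsRingIso S.ring T.ring f
        over-k             : ∀ c → f (S.ι c) T.≈ T.ι c
        continuous         : Continuous S.topology T.topology f
        open-map           : IsOpenMap S.topology T.topology f
        respectsValuations : RespectsValuations coefficientField T f

    record IsTLF : Set (lsuc ℓ) where
      field
        finite          : IsFinitelyGenerated (k′.overBase (regular k′.ring))
        isSTRing        : IsSTRing k T.topRing
        parametrization : ∃ IsParametrization

record TopologicalLocalField (k : Field ℓ) (n : ℕ) : Set (lsuc (lsuc ℓ)) where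
  field
    localField : LocalFieldData k n
    isTLF      : IsTLF localField
  open LocalFieldData localField public
  open IsTLF isTLF public

------------------------------------------------------------------------
-- Beilinson–Tate operators

module _ {k : Field ℓ} where
  private module k = Field k

  module _ {n : ℕ} (T : LocalFieldData k (suc n)) where
    private module T = LocalFieldData T
    open FirstValuation T hiding (residue)

    record Lifting : Set (lsuc ℓ) where
      field
        σ          : k₁.Carrier → 𝒪.Carrier
        isRingHom  : IsRingHom k₁.ring 𝒪.ring σ
        over-k     : ∀ c → σ (LocalFieldData.ι (residue T) c) 𝒪.≈ ι-𝒪 c
        continuous : Continuous (LocalFieldData.topology (residue T)) 𝒪-topology σ
        -- The canonical surjection 𝒪 → k₁ is the identity on representatives.
        splits     : ∀ x → σ x k₁.≈ x

      rest : Mod 𝒪.ring → Mod k₁.ring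
      rest = restrict k₁.ring 𝒪.ring isRingHom

    over𝒪 : Mod T.ring → Mod 𝒪.ring
    over𝒪 = restrict 𝒪.ring T.ring 𝒪-incl-hom

    record Lattice (M : Mod T.ring) : Set (lsuc ℓ) where
      open LeftModule M using (Carrierᴹ; _≈ᴹ_)
      field
        L      : Submodule (over𝒪 M)
      open Submodule L public
      field
        finite : IsFinitelyGenerated (submodule L)
        spans  : ∀ m → Σ[ r ∈ ℕ ] Σ[ c ∈ (Fin r → T.Carrier) ] Σ[ l ∈ (Fin r → Carrierᴹ) ]
                   ((∀ i → member (l i)) × m ≈ᴹ combination M c l)

    module _ {M₁ M₂ : Mod T.ring} (φ : LeftModule.Carrierᴹ M₁ → LeftModule.Carrierᴹ M₂) where

      -- (L₁′ , L₂′) ≺_φ (L₁ , L₂)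
      record Refines (L₁′ : Lattice M₁) (L₂′ : Lattice M₂)
                     (L₁ : Lattice M₁) (L₂ : Lattice M₂) : Set ℓ where
        private
          module L₁  = Lattice L₁
          module L₂  = Lattice L₂
          module L₁′ = Lattice L₁′
          module L₂′ = Lattice L₂′
        field
          L₁′⊆L₁  : L₁′.member ⊆ L₁.member
          L₂⊆L₂′  : L₂.member ⊆ L₂′.member
          φL₁′⊆L₂ : ∀ {x} → L₁′.member x → L₂.member (φ x)
          φL₁⊆L₂′ : ∀ {x} → L₁.member x → L₂′.member (φ x)

        induced : LeftModule.Carrierᴹ (L₁.L / L₁′.L) → LeftModule.Carrierᴹ (L₂′.L / L₂.L)
        induced (x , x∈L₁) = φ x , φL₁⊆L₂′ x∈L₁

  SystemOfLiftings : ∀ {n} → LocalFieldData k n → Set (lsuc ℓ)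
  SystemOfLiftings {zero}  T = ⊤
  SystemOfLiftings {suc n} T = Lifting T × SystemOfLiftings (residue T)

  IsBaseLinear : ∀ {n} (T : LocalFieldData k n) (M₁ M₂ : Mod (LocalFieldData.ring T)) →
                 (LeftModule.Carrierᴹ M₁ → LeftModule.Carrierᴹ M₂) → Set ℓ
  IsBaseLinear T M₁ M₂ = IsLinear k.ring (T.overBase M₁) (T.overBase M₂)
    where module T = LocalFieldData T

  -- The subset E^K_σ(M₁ , M₂) of Hom_k(M₁ , M₂).  The definition makes sense for
  -- all modules; started at finite ones, the recursion only meets finite ones.
  BT : ∀ {n} (T : LocalFieldData k n) → SystemOfLiftings T →
       (M₁ M₂ : Mod (LocalFieldData.ring T)) →
       Pred (LeftModule.Carrierᴹ M₁ → LeftModule.Carrierᴹ M₂) (lsuc ℓ)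
  BT {zero}  T _ M₁ M₂ φ = Lift (lsuc ℓ) (IsBaseLinear T M₁ M₂ φ)
  BT {suc n} T (σ₁ , σ) M₁ M₂ φ =
    Lift (lsuc ℓ) (IsBaseLinear T M₁ M₂ φ) ×
    (∀ (L₁ : Lattice T M₁) (L₂ : Lattice T M₂) →
      ∃[ L₁′ ] ∃[ L₂′ ] Refines T φ L₁′ L₂′ L₁ L₂) ×
    (∀ {L₁ L₁′ : Lattice T M₁} {L₂ L₂′ : Lattice T M₂} (r : Refines T φ L₁′ L₂′ L₁ L₂) →
      BT (residue T) σ
        (rest (L₁ .L / L₁′ .L)) (rest (L₂′ .L / L₂ .L)) (Refines.induced r))
    where
    open Lifting σ₁ using (rest)
    open Lattice using (L)

  module _ {n : ℕ} (T : TopologicalLocalField k n) where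
    private module T = TopologicalLocalField T

    Operator : Set ℓ
    Operator = T.Carrier → T.Carrier

    -- E(K), computed with the system of liftings σ.
    LocalBT : SystemOfLiftings T.localField → Pred Operator (lsuc ℓ)
    LocalBT σ = BT T.localField σ (regular T.ring) (regular T.ring)

    ContinuousEnd : Pred Operator (lsuc ℓ)
    ContinuousEnd φ = IsBaseLinear T.localField (regular T.ring) (regular T.ring) φ ×
                      Continuous T.topology T.topology φ

    -- DifferentialOrder< i is F_{i-1}.
    DifferentialOrder< : ℕ → Pred Operator (lsuc ℓ)
    DifferentialOrder< zero    φ = Lift (lsuc ℓ) (∀ x → φ x T.≈ T.0#)
    DifferentialOrder< (suc i) φ =
      ContinuousEnd φ × (∀ a → DifferentialOrder< i (λ x → a T.* φ x T.- φ (a T.* x)))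

    ContinuousDifferential : Pred Operator (lsuc ℓ)
    ContinuousDifferential φ = ∃[ i ] DifferentialOrder< i φ

{-# OPTIONS --safe #-}
-- Fix a lifting σ₁ and a uniformizer π.  Expanding along powers of π shows that a
-- k-submodule U of K is open if and only if it contains a ball {v ≥ N} and
-- {c ∈ k₁ | σ₁(c) m ∈ U} is open in k₁ for every m ∈ K; the same criterion describes
-- the fine topology of a finite K-module M.  Hence the fine k₁-topology of a quotient
-- L / L′ of lattices, viewed as a k₁-module via σ₁, is the subquotient topology of M,
-- and both inclusions follow by induction on n, for operators between finite modules.
--
-- A Beilinson–Tate operator φ is continuous because the criterion for φ⁻¹(U) only
-- involves refinements (L₁′ , L₂′) ≺ (L₁ , L₂) with L₂ ⊆ U and the induced maps.
--
-- A continuous differential operator φ induces continuous differential operators on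
-- the quotients, so only refinements have to be found.  Induction on the order bounds
-- φ on A g, where A is any k-algebra generated by finitely many elements of 𝒪₁; some
-- such A is dense in 𝒪₁ and lattices are closed, so φ(L₁) lies in a lattice L₂′.
-- Finally φ(πᵈ x) ≡ πᵈ φ(x) up to commutators gives N with φ(πᴺ L₁) ⊆ L₂.
--
-- Both closedness of lattices and continuity on quotients need an open submodule of M
-- with prescribed trace on a k₁-subspace W containing a lattice: M is spanned by W and
-- countably many further vectors, which are adjoined one at a time.
module Submission where

open import Level using (Level; Lift; lift) renaming (suc to lsuc)
open import Axiom.ExcludedMiddle using (ExcludedMiddle)
open import Algebra.Bundles using (AbelianGroup; CommutativeRing; Ring)
open import Algebra.Module.Bundles using (LeftModule)
open import Algebra.Module.Morphism.Structures using (module LeftModuleMorphisms)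
open import Algebra.Morphism.Structures using (module RingMorphisms)
import Algebra.Properties.AbelianGroup as AbelianGroupProperties
import Algebra.Properties.CommutativeSemigroup as CommutativeSemigroupProperties
import Algebra.Properties.Semiring.Exp as ExpProperties
import Algebra.Properties.Semiring.Sum as SumProperties
open import Data.Empty using (⊥-elim)
open import Data.Fin.Base using (Fin; toℕ; fromℕ<; inject₁) renaming (zero to fzero; suc to fsuc)
open import Data.Fin.Properties using (toℕ<n; toℕ-fromℕ<; toℕ-inject₁)
open import Data.Integer.Base using (ℤ; +_; -[1+_])
import Data.Integer.Base as ℤ
import Data.Integer.Properties as ℤ
open import Data.List.Base using (List; []; _∷_; _++_)
import Data.List.Base as List
open import Data.List.Relation.Unary.All using (All; []; _∷_)
import Data.List.Relation.Unary.All as All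
open import Data.List.Relation.Unary.All.Properties using (++⁺; ++⁻ˡ; ++⁻ʳ; map⁺; tabulate⁺)
open import Data.List.Relation.Unary.Any using (here; there)
open import Data.List.Membership.Propositional using (_∈_)
open import Data.List.Membership.Propositional.Properties using (∈-map⁺)
open import Data.Nat.Base using (ℕ; zero; suc; _∸_)
import Data.Nat.Base as ℕ
import Data.Nat.Properties as ℕ
open import Data.Product.Base using (Σ; Σ-syntax; ∃; ∃-syntax; _×_; _,_; proj₁; proj₂)
open import Data.Unit.Polymorphic.Base using (⊤; tt)
open import Function.Base using (_∘_; id)
open import Relation.Binary.Bundles using (Setoid)
open import Relation.Binary.Definitions using (_Respects_)
open import Relation.Binary.PropositionalEquality.Core as ≡ using (_≡_)
import Relation.Binary.Reasoning.Setoid as SetoidReasoning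
open import Relation.Nullary using (¬_; yes; no)
open import Relation.Unary using (Pred; _⊆_; _∩_)
open import Defs

-- The lifting `σ₁` is arbitrary, whereas a parametrization `A((t)) ≅ K` brings its own section
-- `s : A → K` of the residue map, in general a different one. The two are compared by writing
-- `s(a)` as a sum of terms `πⁱ σ₁(rᵢ(a))`; the digits `rᵢ` are continuous and `k`-linear but need
-- not be multiplicative, which is enough to test openness along any lifting. Vectors are adjoined
-- one at a time because a lattice has no preferred `k₁`-linear complement; excluded middle decides
-- whether a vector is new, and if it is, the whole line through it can be added without changing
-- the trace on the old subspace. Closedness of lattices also needs an open `k`-submodule `O` of
-- `k₁` with `1 ∉ O`. It is found by climbing the tower: `O = 0` in dimension zero, and once `k₁`
-- has such an `O`, the ideal `𝔪` is closed in `K`, so that some open submodule of `K` contains `𝔪`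
-- but not `1`.

private
  variable
    ℓ : Level

-- Groups, modules and linear maps

module GroupLemmas {ℓ} (G : AbelianGroup ℓ ℓ) where
  open AbelianGroup G renaming (_∙_ to _+_; ε to 0#; _⁻¹ to -_)
  open AbelianGroupProperties G public
    using (⁻¹-anti-homo‿-; ⁻¹-∙-comm; ε⁻¹≈ε; inverseˡ-unique; identityˡ-unique; x≈y⇒x∙y⁻¹≈ε)
  open CommutativeSemigroupProperties commutativeSemigroup public using (interchange)

  x+[y-x]≈y : ∀ x y → x + (y + - x) ≈ y
  x+[y-x]≈y x y = trans (∙-congˡ (comm y (- x)))
    (trans (sym (assoc x (- x) y)) (trans (∙-congʳ (inverseʳ x)) (identityˡ y)))

  [x+y]-x≈y : ∀ x y → (x + y) + - x ≈ y
  [x+y]-x≈y x y = trans (assoc x y (- x)) (x+[y-x]≈y x y)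

  x+[-x+y]≈y : ∀ x y → x + (- x + y) ≈ y
  x+[-x+y]≈y x y = trans (sym (assoc x (- x) y)) (trans (∙-congʳ (inverseʳ x)) (identityˡ y))

  x-0≈x : ∀ x → x + - 0# ≈ x
  x-0≈x x = trans (∙-congˡ ε⁻¹≈ε) (identityʳ x)

  [x-y]+y≈x : ∀ x y → (x + - y) + y ≈ x
  [x-y]+y≈x x y = trans (assoc x (- y) y) (trans (∙-congˡ (inverseˡ y)) (identityʳ x))

  [x+u]-[y+v]≈[x-y]+[u-v] : ∀ x y u v → (x + u) + - (y + v) ≈ (x + - y) + (u + - v)
  [x+u]-[y+v]≈[x-y]+[u-v] x y u v =
    sym (trans (interchange x (- y) u (- v)) (∙-congˡ (⁻¹-∙-comm y v)))

module ModuleLemmas {ℓ} {R : Ring ℓ ℓ} (M : Mod R) where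
  private module R = Ring R
  open LeftModule M
  open GroupLemmas +ᴹ-abelianGroup public

  *ₗ-neg : ∀ a x → a *ₗ (-ᴹ x) ≈ᴹ -ᴹ (a *ₗ x)
  *ₗ-neg a x = inverseˡ-unique _ _ (≈ᴹ-trans (≈ᴹ-sym (*ₗ-distribˡ a (-ᴹ x) x))
    (≈ᴹ-trans (*ₗ-congˡ (-ᴹ‿inverseˡ x)) (*ₗ-zeroʳ a)))

  *ₗ-sub : ∀ a x y → a *ₗ (x +ᴹ -ᴹ y) ≈ᴹ (a *ₗ x) +ᴹ -ᴹ (a *ₗ y)
  *ₗ-sub a x y = ≈ᴹ-trans (*ₗ-distribˡ a x (-ᴹ y)) (+ᴹ-congˡ (*ₗ-neg a y))

  neg-*ₗ : ∀ a x → (R.- a) *ₗ x ≈ᴹ -ᴹ (a *ₗ x)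
  neg-*ₗ a x = inverseˡ-unique _ _ (≈ᴹ-trans (≈ᴹ-sym (*ₗ-distribʳ x (R.- a) a))
    (≈ᴹ-trans (*ₗ-congʳ (R.-‿inverseˡ a)) (*ₗ-zeroˡ x)))

  sub-*ₗ : ∀ a b x → (a R.- b) *ₗ x ≈ᴹ (a *ₗ x) +ᴹ -ᴹ (b *ₗ x)
  sub-*ₗ a b x = ≈ᴹ-trans (*ₗ-distribʳ x a (R.- b)) (+ᴹ-congˡ (neg-*ₗ b x))

module _ {R : Ring ℓ ℓ} (M N : Mod R) where
  private
    module M = LeftModule M
    module N = LeftModule N
    module NL = ModuleLemmas N

  -- Only the independent laws are fields; zero and negation follow from additivity, which spares
  -- two proofs for each of the many maps below. `isLinear` and `toLinearMap` convert to and from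
  -- the library's notion.
  record LinearMap (φ : M.Carrierᴹ → N.Carrierᴹ) : Set ℓ where
    field
      cong : ∀ {x y} → x M.≈ᴹ y → φ x N.≈ᴹ φ y
      add  : ∀ x y → φ (x M.+ᴹ y) N.≈ᴹ φ x N.+ᴹ φ y
      scal : ∀ a x → φ (a M.*ₗ x) N.≈ᴹ a N.*ₗ φ x

    zer : φ M.0ᴹ N.≈ᴹ N.0ᴹ
    zer = NL.identityˡ-unique _ _ (N.≈ᴹ-trans (N.≈ᴹ-sym (add M.0ᴹ M.0ᴹ)) (cong (M.+ᴹ-identityˡ M.0ᴹ)))

    neg : ∀ x → φ (M.-ᴹ x) N.≈ᴹ N.-ᴹ φ x
    neg x = NL.inverseˡ-unique _ _
      (N.≈ᴹ-trans (N.≈ᴹ-sym (add (M.-ᴹ x) x)) (N.≈ᴹ-trans (cong (M.-ᴹ‿inverseˡ x)) zer))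

    sub : ∀ x y → φ (x M.+ᴹ M.-ᴹ y) N.≈ᴹ φ x N.+ᴹ N.-ᴹ φ y
    sub x y = N.≈ᴹ-trans (add x (M.-ᴹ y)) (N.+ᴹ-congˡ (neg y))

    preimage : ∀ {U} → IsSubmodule N U → IsSubmodule M (U ∘ φ)
    preimage U-sub = record
      { resp = λ x≈y → U.resp (cong x≈y)
      ; has0 = U.resp (N.≈ᴹ-sym zer) U.has0
      ; has+ = λ p q → U.resp (N.≈ᴹ-sym (add _ _)) (U.has+ p q)
      ; has* = λ a p → U.resp (N.≈ᴹ-sym (scal a _)) (U.has* a p)
      }
      where module U = IsSubmodule U-sub

    image : ∀ {U} → IsSubmodule M U → IsSubmodule N (λ y → ∃[ x ] (U x × φ x N.≈ᴹ y))
    image U-sub = record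
      { resp = λ y≈z (x , u , e) → x , u , N.≈ᴹ-trans e y≈z
      ; has0 = M.0ᴹ , U.has0 , zer
      ; has+ = λ (x , u , e) (x′ , u′ , e′) →
          x M.+ᴹ x′ , U.has+ u u′ , N.≈ᴹ-trans (add x x′) (N.+ᴹ-cong e e′)
      ; has* = λ a (x , u , e) → a M.*ₗ x , U.has* a u , N.≈ᴹ-trans (scal a x) (N.*ₗ-congˡ e)
      }
      where module U = IsSubmodule U-sub

    isLinear : IsLinear R M N φ
    isLinear = record
      { +ᴹ-isGroupHomomorphism = record
        { isMonoidHomomorphism = record
          { isMagmaHomomorphism = record
            { isRelHomomorphism = record { cong = cong }
            ; homo = add
            }
          ; ε-homo = zer
          }
        ; ⁻¹-homo = neg
        }
      ; *ₗ-homo = scal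
      }

  toLinearMap : ∀ {φ} → IsLinear R M N φ → LinearMap φ
  toLinearMap φ-lin = record { cong = ⟦⟧-cong ; add = +ᴹ-homo ; scal = *ₗ-homo }
    where open LeftModuleMorphisms.IsLeftModuleHomomorphism φ-lin

module _ {R : Ring ℓ ℓ} {M : Mod R} where
  open LeftModule M

  submodule-sub : ∀ {U} → IsSubmodule M U → ∀ {x y} → U x → U y → U (x +ᴹ -ᴹ y)
  submodule-sub U-sub p q = has+ p (has- q)
    where open IsSubmodule U-sub

  ⊤-isSubmodule : IsSubmodule M (λ _ → ⊤)
  ⊤-isSubmodule = record { resp = λ _ _ → tt ; has0 = tt ; has+ = λ _ _ → tt ; has* = λ _ _ → tt }

  0-isSubmodule : IsSubmodule M (_≈ᴹ 0ᴹ)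
  0-isSubmodule = record
    { resp = λ x≈y x≈0 → ≈ᴹ-trans (≈ᴹ-sym x≈y) x≈0
    ; has0 = ≈ᴹ-refl
    ; has+ = λ p q → ≈ᴹ-trans (+ᴹ-cong p q) (+ᴹ-identityˡ 0ᴹ)
    ; has* = λ a p → ≈ᴹ-trans (*ₗ-congˡ p) (*ₗ-zeroʳ a)
    }

  ∩-isSubmodule : ∀ {U V} → IsSubmodule M U → IsSubmodule M V → IsSubmodule M (U ∩ V)
  ∩-isSubmodule U-sub V-sub = record
    { resp = λ e (u , v) → U.resp e u , V.resp e v
    ; has0 = U.has0 , V.has0
    ; has+ = λ (u , v) (u′ , v′) → U.has+ u u′ , V.has+ v v′
    ; has* = λ a (u , v) → U.has* a u , V.has* a v
    }
    where
    module U = IsSubmodule U-sub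
    module V = IsSubmodule V-sub

module _ {S : Setoid ℓ ℓ} (τ : Topology S) where
  open Topology τ

  -- Mutually inclusive predicates need not be equal, so openness is carried across by locality, the
  -- same open set serving at every point.
  open-cong : ∀ {V W} → V ⊆ W → W ⊆ V → Open V → Open W
  open-cong V⊆W W⊆V V-open = Open-local λ x w → _ , V-open , W⊆V w , V⊆W

-- Linear topologies

module LinearTopology (k : Field ℓ) (N : Mod (Field.ring k)) (τ : Topology (LeftModule.≈ᴹ-setoid N)) where
  open LeftModule N
  open Topology τ
  open ModuleLemmas N

  -- A submodule satisfies `U + U ⊆ U` and `c U ⊆ U`. Hence cosets of open submodules serve as the
  -- neighbourhoods that continuity of addition and of scalars asks for.
  isLinearTopology :
    (∀ V x → Open V → V x →
       ∃[ U ] (Open U × IsSubmodule N U × (∀ {u} → U u → V (x +ᴹ u)))) →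
    (∀ U x → Open U → IsSubmodule N U → Open (λ z → U (z +ᴹ -ᴹ x))) →
    IsLinearTopology k N τ
  isLinearTopology nbhd coset = record
    { +-continuous = λ V x y V-open v →
        let (U , U-open , U-sub , x+y+U⊆V) = nbhd V (x +ᴹ y) V-open v
            open IsSubmodule U-sub in
        (λ z → U (z +ᴹ -ᴹ x)) , (λ z → U (z +ᴹ -ᴹ y)) ,
        coset U x U-open U-sub , coset U y U-open U-sub ,
        resp (≈ᴹ-sym (-ᴹ‿inverseʳ x)) has0 , resp (≈ᴹ-sym (-ᴹ‿inverseʳ y)) has0 ,
        λ {u} {w} p q → Open-resp V-open
          (≈ᴹ-trans (interchange x y (u +ᴹ -ᴹ x) (w +ᴹ -ᴹ y))
            (+ᴹ-cong (x+[y-x]≈y x u) (x+[y-x]≈y y w)))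
          (x+y+U⊆V (has+ p q))
    ; *-continuous = λ c V V-open → Open-local λ x v →
        let (U , U-open , U-sub , cx+U⊆V) = nbhd V (c *ₗ x) V-open v
            open IsSubmodule U-sub in
        (λ z → U (z +ᴹ -ᴹ x)) , coset U x U-open U-sub ,
        resp (≈ᴹ-sym (-ᴹ‿inverseʳ x)) has0 ,
        λ {z} p → Open-resp V-open
          (≈ᴹ-trans (≈ᴹ-sym (*ₗ-distribˡ c x (z +ᴹ -ᴹ x))) (*ₗ-congˡ (x+[y-x]≈y x z)))
          (cx+U⊆V (has* c p))
    ; basis = λ V V-open v →
        let (U , U-open , U-sub , U⊆V) = nbhd V 0ᴹ V-open v in
        U , U-open , U-sub , λ {x} u → Open-resp V-open (+ᴹ-identityˡ x) (U⊆V u)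
    }

  module _ (lin : IsLinearTopology k N τ) where
    open IsLinearTopology lin

    translate : ∀ V x → Open V → Open (λ y → V (x +ᴹ y))
    translate V x V-open = Open-local λ y v →
      let (_ , W , _ , W-open , u , w , U+W⊆V) = +-continuous V x y V-open v in
      W , W-open , w , λ w′ → U+W⊆V u w′

    neighbourhood : ∀ V x → Open V → V x →
                    ∃[ U ] (Open U × IsSubmodule N U × (∀ {u} → U u → V (x +ᴹ u)))
    neighbourhood V x V-open v =
      basis (λ y → V (x +ᴹ y)) (translate V x V-open) (Open-resp V-open (≈ᴹ-sym (+ᴹ-identityʳ x)) v)

    -- Around each of its points `V` contains a translate of `U`. Since `U` is any open set around
    -- zero, finite intersections of open conditions can be used directly; many openness proofs
    -- below end here.
    submodule-open : ∀ {U V} → IsSubmodule N V → Open U → U 0ᴹ → U ⊆ V → Open V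
    submodule-open {U} V-sub U-open u U⊆V = Open-local λ x v →
      (λ y → U (-ᴹ x +ᴹ y)) , translate U (-ᴹ x) U-open ,
      Open-resp U-open (≈ᴹ-sym (-ᴹ‿inverseˡ x)) u ,
      λ {y} p → resp (x+[-x+y]≈y x y) (has+ v (U⊆V p))
      where open IsSubmodule V-sub

module _ {k : Field ℓ} {M N : Mod (Field.ring k)}
         {σ : Topology (LeftModule.≈ᴹ-setoid M)} {τ : Topology (LeftModule.≈ᴹ-setoid N)}
         (σ-lin : IsLinearTopology k M σ) (τ-lin : IsLinearTopology k N τ)
         {φ : LeftModule.Carrierᴹ M → LeftModule.Carrierᴹ N} (φ-lin : LinearMap M N φ) where
  private
    module M = LeftModule M
    module N = LeftModule N
    module ML = ModuleLemmas M
    module NL = ModuleLemmas N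
    module σ = Topology σ
    module τ = Topology τ
    open LinearMap φ-lin

  -- Every neighbourhood contains a coset of an open submodule and translations are continuous, so
  -- it suffices to test open submodules. The same holds for open maps.
  linear-continuous : (∀ U → τ.Open U → IsSubmodule N U → σ.Open (U ∘ φ)) → Continuous σ τ φ
  linear-continuous pre V V-open = σ.Open-local λ x v →
    let (U , U-open , U-sub , φx+U⊆V) = LinearTopology.neighbourhood k N τ τ-lin V (φ x) V-open v
        open IsSubmodule U-sub in
    (λ y → U (φ (M.-ᴹ x M.+ᴹ y))) ,
    LinearTopology.translate k M σ σ-lin (U ∘ φ) (M.-ᴹ x) (pre U U-open U-sub) ,
    resp (N.≈ᴹ-sym (N.≈ᴹ-trans (cong (M.-ᴹ‿inverseˡ x)) zer)) has0 ,
    λ {y} u → τ.Open-resp V-open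
      (N.≈ᴹ-trans (N.≈ᴹ-sym (add x (M.-ᴹ x M.+ᴹ y))) (cong (ML.x+[-x+y]≈y x y))) (φx+U⊆V u)

  linear-open : (∀ U → σ.Open U → IsSubmodule M U → τ.Open (λ y → ∃[ x ] (U x × φ x N.≈ᴹ y))) →
                IsOpenMap σ τ φ
  linear-open img V V-open = τ.Open-local λ y (x , v , φx≈y) →
    let (U , U-open , U-sub , x+U⊆V) = LinearTopology.neighbourhood k M σ σ-lin V x V-open v in
    (λ z → ∃[ u ] (U u × φ u N.≈ᴹ N.-ᴹ y N.+ᴹ z)) ,
    LinearTopology.translate k N τ τ-lin _ (N.-ᴹ y) (img U U-open U-sub) ,
    (M.0ᴹ , IsSubmodule.has0 U-sub , N.≈ᴹ-trans zer (N.≈ᴹ-sym (N.-ᴹ‿inverseˡ y))) ,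
    λ {z} (u , p , e) → x M.+ᴹ u , x+U⊆V p ,
      N.≈ᴹ-trans (add x u) (N.≈ᴹ-trans (N.+ᴹ-cong φx≈y e) (NL.x+[-x+y]≈y y z))

-- Power series

module SeriesLemmas (R : CommutativeRing ℓ ℓ) where
  open CommutativeRing R
  open PowerSeries R using (Series; _≋_; _⋆_; const; t)
  open SumProperties semiring using (sum; sum-cong-≋; *-distribˡ-sum)
  private
    module P = CommutativeRing (PowerSeries.commutativeRing R)
  open ExpProperties P.semiring using (_^_)

  -- The ideal `tᴺ A[[t]]`, described by coefficients; `vanishes⇒t^⋆` performs the division by `tᴺ`.
  VanishesBelow : ℕ → Pred Series _
  VanishesBelow N f = ∀ i → i ℕ.< N → f i ≈ 0#

  scale : Carrier → Series → Series
  scale a f n = a * f n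

  monomial : Carrier → ℕ → Series
  monomial a zero            = const a
  monomial a (suc i) zero    = 0#
  monomial a (suc i) (suc j) = monomial a i j

  truncateBelow : ℕ → Series → Series
  truncateBelow zero    f         = f
  truncateBelow (suc N) f zero    = 0#
  truncateBelow (suc N) f (suc j) = truncateBelow N (f ∘ suc) j

  sum-zero : ∀ {n} (f : Fin n → Carrier) → (∀ i → f i ≈ 0#) → sum f ≈ 0#
  sum-zero {zero}  f p = refl
  sum-zero {suc n} f p = trans (+-cong (p fzero) (sum-zero (f ∘ fsuc) (p ∘ fsuc))) (+-identityˡ 0#)

  monomial-scale : ∀ a i → monomial a i ≋ scale a (monomial 1# i)
  monomial-scale a zero    zero    = sym (*-identityʳ a)
  monomial-scale a zero    (suc j) = sym (zeroʳ a)
  monomial-scale a (suc i) zero    = sym (zeroʳ a)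
  monomial-scale a (suc i) (suc j) = monomial-scale a i j

  truncateBelow-suc : ∀ N f n →
    truncateBelow N f n ≈ monomial (f N) N n + truncateBelow (suc N) f n
  truncateBelow-suc zero    f zero    = sym (+-identityʳ _)
  truncateBelow-suc zero    f (suc n) = sym (+-identityˡ _)
  truncateBelow-suc (suc N) f zero    = sym (+-identityˡ 0#)
  truncateBelow-suc (suc N) f (suc n) = truncateBelow-suc N (f ∘ suc) n

  truncateBelow-vanishes : ∀ N f → VanishesBelow N (truncateBelow N f)
  truncateBelow-vanishes (suc N) f zero    _           = refl
  truncateBelow-vanishes (suc N) f (suc i) (ℕ.s≤s i<N) = truncateBelow-vanishes N (f ∘ suc) i i<N

  ⋆-vanishes : ∀ N g {f} → VanishesBelow N f → VanishesBelow N (g ⋆ f)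
  ⋆-vanishes N g {f} p n n<N = sum-zero {suc n} (λ i → g (toℕ i) * f (n ∸ toℕ i)) λ i →
    trans (*-congˡ (p (n ∸ toℕ i) (ℕ.≤-<-trans (ℕ.m∸n≤m n (toℕ i)) n<N))) (zeroʳ _)

  ⋆-scale : ∀ a g f → g ⋆ scale a f ≋ scale a (g ⋆ f)
  ⋆-scale a g f n = trans
    (sum-cong-≋ {suc n} {λ i → g (toℕ i) * (a * f (n ∸ toℕ i))} {λ i → a * (g (toℕ i) * f (n ∸ toℕ i))}
      (λ i → trans (sym (*-assoc _ _ _)) (trans (*-congʳ (*-comm _ _)) (*-assoc _ _ _))))
    (sym (*-distribˡ-sum {suc n} a (λ i → g (toℕ i) * f (n ∸ toℕ i))))

  const-⋆ : ∀ a f → const a ⋆ f ≋ scale a f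
  const-⋆ a f zero    = +-identityʳ _
  const-⋆ a f (suc n) = trans (+-congˡ
      (sum-zero {suc n} (λ i → 0# * f (n ∸ toℕ i)) (λ i → zeroˡ _))) (+-identityʳ _)

  t⋆-zero : ∀ f → (t ⋆ f) 0 ≈ 0#
  t⋆-zero f = trans (+-identityʳ _) (zeroˡ _)

  t⋆-suc : ∀ f n → (t ⋆ f) (suc n) ≈ f n
  t⋆-suc f n = trans (+-cong (zeroˡ _) (tail n)) (+-identityˡ _)
    where
    tail : ∀ n → sum {suc n} (λ i → t (suc (toℕ i)) * f (n ∸ toℕ i)) ≈ f n
    tail zero    = trans (+-identityʳ _) (*-identityˡ _)
    tail (suc n) = trans (+-cong (*-identityˡ _)
      (sum-zero {suc n} (λ i → 0# * f (n ∸ toℕ i)) (λ i → zeroˡ _))) (+-identityʳ _)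

  t^⋆-coeff : ∀ N f i → (t ^ N ⋆ f) (N ℕ.+ i) ≈ f i
  t^⋆-coeff zero    f i = P.*-identityˡ f i
  t^⋆-coeff (suc N) f i = trans (P.*-assoc t (t ^ N) f (suc (N ℕ.+ i)))
    (trans (t⋆-suc (t ^ N ⋆ f) (N ℕ.+ i)) (t^⋆-coeff N f i))

  t^⋆-vanishes : ∀ N f → VanishesBelow N (t ^ N ⋆ f)
  t^⋆-vanishes (suc N) f zero    _           =
    trans (P.*-assoc t (t ^ N) f 0) (t⋆-zero (t ^ N ⋆ f))
  t^⋆-vanishes (suc N) f (suc i) (ℕ.s≤s i<N) =
    trans (P.*-assoc t (t ^ N) f (suc i)) (trans (t⋆-suc (t ^ N ⋆ f) i) (t^⋆-vanishes N f i i<N))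

  vanishes⇒t^⋆ : ∀ N f → VanishesBelow N f → f ≋ t ^ N ⋆ (λ i → f (N ℕ.+ i))
  vanishes⇒t^⋆ zero    f p n       = sym (P.*-identityˡ f n)
  vanishes⇒t^⋆ (suc N) f p zero    = trans (p 0 (ℕ.s≤s ℕ.z≤n))
      (sym (t^⋆-vanishes (suc N) (λ i → f (suc N ℕ.+ i)) 0 (ℕ.s≤s ℕ.z≤n)))
  vanishes⇒t^⋆ (suc N) f p (suc n) = trans
    (vanishes⇒t^⋆ N (f ∘ suc) (λ i i<N → p (suc i) (ℕ.s≤s i<N)) n)
    (sym (trans (P.*-assoc t (t ^ N) (λ i → f (suc N ℕ.+ i)) (suc n))
      (t⋆-suc (t ^ N ⋆ (λ i → f (suc N ℕ.+ i))) n)))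

-- Laurent series form a semi-topological ring

module _ {k : Field ℓ} (A : TopRing k) (M : Mod (TopRing.ring A)) where
  private
    module A = TopRing A
  open LeftModule M

  -- Repeats the private predicate inside the definition of `fine`, so that the data unpacked from a
  -- fine open set has this type definitionally.
  FineSubmodule : Pred (Pred Carrierᴹ ℓ) (lsuc ℓ)
  FineSubmodule U = IsSubmodule (A.overBase M) U ×
                    (∀ m → Topology.Open A.topology (λ a → U (a *ₗ m)))

  fineSubmodule-open : ∀ {U} → FineSubmodule U → Topology.Open (fine k A M) U
  fineSubmodule-open {U} (U-sub , orb) =
    IsSubmodule.resp U-sub , λ x u → U , (U-sub , orb) , λ u′ → IsSubmodule.has+ U-sub u u′

module _ (S : Setoid ℓ ℓ) where
  ⋂-open : (τ : Topology S) → ∀ {m} (V : Fin m → Pred (Setoid.Carrier S) ℓ) →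
           (∀ j → Topology.Open τ (V j)) → Topology.Open τ (λ a → ∀ j → V j a)
  ⋂-open τ {zero}  V V-open = open-cong τ (λ _ ()) (λ _ → tt) Open-⊤
    where open Topology τ
  ⋂-open τ {suc m} V V-open = open-cong τ
    (λ { (p , q) fzero → p ; (p , q) (fsuc j) → q j }) (λ p → p fzero , p ∘ fsuc)
    (Open-∩ (V-open fzero) (⋂-open τ (V ∘ fsuc) (V-open ∘ fsuc)))
    where open Topology τ

module _ {k : Field ℓ} (A : TopRing k) where
  private
    module A = TopRing A

  discrete-isSTRing : (∀ V → V Respects A._≈_ → Topology.Open A.topology V) → IsSTRing k A
  discrete-isSTRing all-open = record
    { isLinear = LinearTopology.isLinearTopology k (A.overBase (regular A.ring)) A.topology
        (λ V x V-open v →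
          (λ y → y A.≈ A.0#) , all-open _ (λ x≈y x≈0 → A.trans (A.sym x≈y) x≈0) ,
          0-isSubmodule {M = A.overBase (regular A.ring)} ,
          λ {u} u≈0 → Open-resp V-open (A.trans (A.sym (A.+-identityʳ x)) (A.+-congˡ (A.sym u≈0))) v)
        (λ U x U-open _ → all-open _ λ y≈z → Open-resp U-open (A.+-congʳ y≈z))
    ; *-continuous = λ a V V-open → all-open _ λ y≈z → Open-resp V-open (A.*-congˡ y≈z)
    }
    where open Topology A.topology

module PowerSeriesTopology {k : Field ℓ} (A : TopRing k) (A-ST : IsSTRing k A) where
  private
    module k = Field k
    module A = TopRing A
    module τA = Topology A.topology
    module P = TopRing (powerSeries A)
    module τ = Topology P.topology
    module A-ST = IsSTRing A-ST
  open PowerSeries A.commutativeRing using (Series; _≋_; _⋆_; const)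
  open SeriesLemmas A.commutativeRing

  private
    N : Mod k.ring
    N = P.overBase (regular P.ring)
    module NL = ModuleLemmas N

    trunc : ℕ → Mod A.ring
    trunc = truncated A.commutativeRing

    module Trunc (i : ℕ) where
      open LeftModule (trunc i) public
      open Topology (fine k A (trunc i)) public
      open IsSTModule (fine-isST k A (trunc i) A-ST) public
      module T = LinearTopology k (A.overBase (trunc i)) (fine k A (trunc i))

    Index : Set _
    Index = Σ[ i ∈ ℕ ] ∃ (Trunc.Open i)

    Basic : Index → Pred Series _
    Basic (i , W , _) f = W (f ∘ toℕ)

    ⋂ : List Index → Pred Series _
    ⋂ is f = All (λ i → Basic i f) is

    basic-open : ∀ i → τ.Open (Basic i)
    basic-open i x p = i ∷ [] , p ∷ [] , λ { y (q ∷ []) → q }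

    preimage-isSubmodule : ∀ i {S} → IsSubmodule (A.overBase (trunc i)) S →
                           IsSubmodule N (λ f → S (f ∘ toℕ))
    preimage-isSubmodule i S-sub = record
      { resp = λ f≋g → S.resp (f≋g ∘ toℕ)
      ; has0 = S.has0
      ; has+ = S.has+
      ; has* = λ c {f} p → S.resp (λ j → A.sym (const-⋆ (A.ι c) f (toℕ j))) (S.has* c p)
      }
      where module S = IsSubmodule S-sub

    neighbourhoods : ∀ is x → ⋂ is x →
      ∃[ U ] (τ.Open U × IsSubmodule N U × (∀ {u} → U u → ⋂ is (x P.+ u)))
    neighbourhoods [] x [] = (λ _ → ⊤) , τ.Open-⊤ ,
      ⊤-isSubmodule {M = N} , λ _ → []
    neighbourhoods ((i , W , _ , W-open) ∷ is) x (w ∷ x∈) =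
      let (S , S-fine , S⊆W) = W-open (x ∘ toℕ) w
          (U , U-open , U-sub , U⊆⋂) = neighbourhoods is x x∈ in
      (λ f → S (f ∘ toℕ)) ∩ U ,
      τ.Open-∩ (basic-open (i , S , fineSubmodule-open A (trunc i) S-fine)) U-open ,
      ∩-isSubmodule {M = N} (preimage-isSubmodule i (proj₁ S-fine)) U-sub ,
      λ (s , u) → S⊆W s ∷ U⊆⋂ u

    -- Translates of subbasic sets are again subbasic. The translation is done index by index, since
    -- an open set is presented through lists of indices.
    shifted : Series → List Index → List Index
    shifted y [] = []
    shifted y ((i , W , W-open) ∷ is) =
      (i , (λ f → W (Trunc._+ᴹ_ i (Trunc.-ᴹ_ i (y ∘ toℕ)) f)) ,
       Trunc.T.translate i (Trunc.isLinear i) W (Trunc.-ᴹ_ i (y ∘ toℕ)) W-open) ∷ shifted y is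

    shifted⁺ : ∀ y {z} is → ⋂ is (P.- y P.+ z) → ⋂ (shifted y is) z
    shifted⁺ y     []       []      = []
    shifted⁺ y {z} (_ ∷ is) (p ∷ q) = p ∷ shifted⁺ y {z} is q

    shifted⁻ : ∀ y {z} is → ⋂ (shifted y is) z → ⋂ is (P.- y P.+ z)
    shifted⁻ y     []       []      = []
    shifted⁻ y {z} (_ ∷ is) (p ∷ q) = p ∷ shifted⁻ y {z} is q

    ⋂-resp : ∀ is → ⋂ is Respects _≋_
    ⋂-resp is f≋g = All.map (λ {i} → τ.Open-resp (basic-open i) f≋g)

  P-isLinear : IsLinearTopology k N P.topology
  P-isLinear = LinearTopology.isLinearTopology k N P.topology
    (λ V x V-open v →
      let (is , x∈ , ⋂⊆V) = V-open x v
          (U , U-open , U-sub , x+U⊆⋂) = neighbourhoods is x x∈ in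
      U , U-open , U-sub , λ u → ⋂⊆V _ (x+U⊆⋂ u))
    (λ U x U-open U-sub y p →
      let open IsSubmodule U-sub
          (is , 0∈ , ⋂⊆U) = U-open P.0# has0 in
      shifted y is ,
      shifted⁺ y {y} is (⋂-resp is (P.sym (P.-‿inverseˡ y)) 0∈) ,
      λ z z∈ → resp
        (P.trans (P.sym (P.+-assoc (y P.- x) (P.- y) z))
          (P.trans (P.+-congʳ {z} (NL.[x+y]-x≈y y (P.- x))) (P.+-comm (P.- x) z)))
        (has+ p (⋂⊆U _ (shifted⁻ y {z} is z∈))))

  scale-continuous : ∀ f → Continuous A.topology P.topology (λ a → scale a f)
  scale-continuous f V V-open = τA.Open-local λ a v →
    let (is , a∈ , ⋂⊆V) = V-open (scale a f) v in
    pre is , pre-open is , to-pre is a∈ , λ {b} p → ⋂⊆V (scale b f) (from-pre is p)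
    where
    -- All over Index would live one level too high for an open set.
    pre : List Index → Pred A.Carrier ℓ
    pre []                 b = ⊤
    pre ((i , W , _) ∷ is) b = W (scale b f ∘ toℕ) × pre is b

    pre-open : ∀ is → τA.Open (pre is)
    pre-open []                      = τA.Open-⊤
    pre-open ((i , W , W-open) ∷ is) =
      τA.Open-∩ (Trunc.*ᵣ-continuous i (f ∘ toℕ) W W-open) (pre-open is)

    to-pre : ∀ is {b} → ⋂ is (scale b f) → pre is b
    to-pre []       []      = tt
    to-pre (_ ∷ is) (p ∷ q) = p , to-pre is q

    from-pre : ∀ is {b} → pre is b → ⋂ is (scale b f)
    from-pre []       _       = []
    from-pre (_ ∷ is) (p , q) = p ∷ from-pre is q

  -- A subbasic set looks at finitely many coefficients only.
  open⇒vanishing : ∀ {U} → τ.Open U → U P.0# → ∃[ N ] (∀ {f} → VanishesBelow N f → U f)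
  open⇒vanishing U-open u =
    let (is , 0∈ , ⋂⊆U) = U-open P.0# u
        (N , N∈) = bound is 0∈ in
    N , λ p → ⋂⊆U _ (N∈ p)
    where
    bound : ∀ is → ⋂ is P.0# → ∃[ N ] (∀ {f} → VanishesBelow N f → ⋂ is f)
    bound [] [] = 0 , λ _ → []
    bound ((i , W , W-open) ∷ is) (w ∷ 0∈) =
      let (N , N∈) = bound is 0∈ in
      -- `trunc i` has the coefficients of degrees `0` to `i`, hence `suc i`.
      suc i ℕ.⊔ N , λ {f} p →
        Trunc.Open-resp i W-open
          (λ j → A.sym (p (toℕ j) (ℕ.≤-trans (toℕ<n j) (ℕ.m≤m⊔n (suc i) N)))) w ∷
        N∈ (λ j j<N → p j (ℕ.≤-trans j<N (ℕ.m≤n⊔m (suc i) N)))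

  module _ {U : Pred Series ℓ} (U-sub : IsSubmodule N U) (n : ℕ)
           (vanishing⊆U : ∀ {f} → VanishesBelow n f → U f) where
    open IsSubmodule U-sub
    private
      assemble : ∀ f m → (∀ j → j ℕ.< m → U (monomial (f j) j)) → U (truncateBelow m f) → U f
      assemble f zero    p q = q
      assemble f (suc m) p q = assemble f m (λ j j<m → p j (ℕ.m<n⇒m<1+n j<m))
        (resp (P.sym (truncateBelow-suc m f)) (has+ (p m ℕ.≤-refl) q))

      finite : ∀ f → (∀ (j : Fin n) → U (monomial (f (toℕ j)) (toℕ j))) → U f
      finite f p = assemble f n
        (λ j j<n → ≡.subst (λ i → U (monomial (f i) i)) (toℕ-fromℕ< j<n) (p (fromℕ< j<n)))
        (vanishing⊆U (truncateBelow-vanishes n f))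

    module _ (coeff-open : ∀ i → τA.Open (λ a → U (monomial a i))) where
      private
        coeff-open′ : ∀ b i → τA.Open (λ a → U (monomial (a A.* b) i))
        coeff-open′ b i = open-cong A.topology (λ {a} → comm {b} {a}) (λ {a} → comm {a} {b})
          (A-ST.*-continuous b _ (coeff-open i))
          where
          comm : ∀ {a b} → U (monomial (a A.* b) i) → U (monomial (b A.* a) i)
          comm {a} {b} = τA.Open-resp (coeff-open i) (A.*-comm a b)

      -- Modulo `tⁿ` only the finitely many conditions on the monomials of `a f` of degree below `n`
      -- remain.
      scale-open : ∀ f → τA.Open (λ a → U (scale a f))
      scale-open f = LinearTopology.submodule-open k (A.overBase (regular A.ring)) A.topology A-ST.isLinear
        (record
          { resp = λ a≈b → resp (λ _ → A.*-congʳ a≈b)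
          ; has0 = resp (λ _ → A.sym (A.zeroˡ _)) has0
          ; has+ = λ p q → resp (λ _ → A.sym (A.distribʳ _ _ _)) (has+ p q)
          ; has* = λ c {a} p → resp
              (λ j → A.trans (const-⋆ (A.ι c) (scale a f) j) (A.sym (A.*-assoc _ _ _))) (has* c p)
          })
        (⋂-open A.setoid A.topology (λ j a → U (monomial (a A.* f (toℕ j)) (toℕ j)))
          (λ j → coeff-open′ (f (toℕ j)) (toℕ j)))
        (λ j → resp (λ i → A.sym (A.trans (monomial-scale _ (toℕ j) i)
            (A.trans (A.*-congʳ (A.zeroˡ _)) (A.zeroˡ _)))) has0)
        (λ {a} p → finite (scale a f) p)

      -- Modulo `tⁿ` a series is a finite sum of monomials, so `U` contains every series whose
      -- monomials of degree below `n` lie in `U`. Asking this of each monomial separately defines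
      -- the fine submodule `W` of a truncation.
      vanishing∧coeff⇒open : τ.Open U
      vanishing∧coeff⇒open = LinearTopology.submodule-open k N P.topology P-isLinear U-sub
        (basic-open (n , W , fineSubmodule-open A (trunc n) (W-sub , W-orb)))
        (IsSubmodule.has0 W-sub)
        -- `trunc n` records the degrees up to `n`, one more than `finite` asks for; `inject₁` drops
        -- the last.
        (λ {f} p → finite f (λ j → ≡.subst (λ i → U (monomial (f i) i)) (toℕ-inject₁ j) (p (inject₁ j))))
        where
        W : Pred (LeftModule.Carrierᴹ (trunc n)) ℓ
        W w = ∀ j → U (monomial (w j) (toℕ j))

        W-sub : IsSubmodule (A.overBase (trunc n)) W
        W-sub = record
          { resp = λ w≈w′ p j → τA.Open-resp (coeff-open (toℕ j)) (w≈w′ j) (p j)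
          ; has0 = λ j → resp (λ i → A.sym (A.trans (monomial-scale _ (toℕ j) i) (A.zeroˡ _))) has0
          ; has+ = λ p q j → resp
              (λ i → A.trans (A.+-cong (monomial-scale _ (toℕ j) i) (monomial-scale _ (toℕ j) i))
                (A.trans (A.sym (A.distribʳ _ _ _)) (A.sym (monomial-scale _ (toℕ j) i))))
              (has+ (p j) (q j))
          ; has* = λ c {w} p j → resp
              (λ i → A.trans (const-⋆ (A.ι c) (monomial (w j) (toℕ j)) i)
                (A.trans (A.*-congˡ (monomial-scale _ (toℕ j) i))
                (A.trans (A.sym (A.*-assoc _ _ _)) (A.sym (monomial-scale _ (toℕ j) i)))))
              (has* c (p j))
          }

        W-orb : ∀ w → τA.Open (λ a → ∀ j → U (monomial (a A.* w j) (toℕ j)))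
        W-orb w = ⋂-open A.setoid A.topology _ (λ j → coeff-open′ (w j) (toℕ j))

  -- The preimage of `U` passes the coefficient test again: `tⁿ A[[t]]` is an ideal, and
  -- `g (a tⁱ) = a (g tⁱ)` reduces each coefficient to `scale-open`.
  P-*-continuous : ∀ g → Continuous P.topology P.topology (g ⋆_)
  P-*-continuous g = linear-continuous P-isLinear P-isLinear ⋆-linear λ U U-open U-sub →
    let open IsSubmodule U-sub
        (n , vanishing⊆U) = open⇒vanishing U-open has0
        coeff-open = λ i → open-cong P-A (λ {a} → resp (P.sym (monomial-scale a i)))
          (λ {a} → resp (monomial-scale a i)) (scale-continuous (monomial A.1# i) U U-open) in
    vanishing∧coeff⇒open (LinearMap.preimage ⋆-linear U-sub) n
      (λ p → vanishing⊆U (⋆-vanishes n g p))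
      (λ i → open-cong P-A
        (λ {a} → resp (P.sym (P.trans (P.*-congˡ {g} (monomial-scale a i))
          (⋆-scale a g (monomial A.1# i)))))
        (λ {a} → resp (P.trans (P.*-congˡ {g} (monomial-scale a i)) (⋆-scale a g (monomial A.1# i))))
        (scale-open U-sub n vanishing⊆U coeff-open (g ⋆ monomial A.1# i)))
    where
    P-A = A.topology
    ⋆-linear : LinearMap N N (g ⋆_)
    ⋆-linear = record
      { cong = P.*-congˡ {g}
      ; add = P.distribˡ g
      ; scal = λ c f → P.trans (P.sym (P.*-assoc g (P.ι c) f))
          (P.trans (P.*-congʳ {f} (P.*-comm g (P.ι c))) (P.*-assoc (P.ι c) g f))
      }

  P-isSTRing : IsSTRing k (powerSeries A)
  P-isSTRing = record { isLinear = P-isLinear ; *-continuous = P-*-continuous }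

module LaurentTopology {k : Field ℓ} (A : TopRing k) (A-ST : IsSTRing k A) where
  private
    module k = Field k
    module A = TopRing A
    module τA = Topology A.topology
    module P = TopRing (powerSeries A)
    module τP = Topology P.topology
    module S = TopRing (laurent A)
    module τ = Topology S.topology
    module PT = PowerSeriesTopology A A-ST
  open PowerSeries A.commutativeRing using (Series; _≋_; _⋆_; const)
  open SeriesLemmas A.commutativeRing

  private
    embed : Series → S.Carrier
    embed = laurent-embed A

    module A[[t]] = PowerSeries A.commutativeRing
    module A⸨t⸩ = Localization A[[t]].commutativeRing A[[t]].t
    module A⸨t⸩ʳ = CommutativeRing A⸨t⸩.commutativeRing

    embed-hom : IsRingHom P.ring A⸨t⸩ʳ.ring embed
    embed-hom = A⸨t⸩.embed-hom
    module embed = RingMorphisms.IsRingHomomorphism embed-hom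

    M : Mod P.ring
    M = restrict P.ring A⸨t⸩ʳ.ring A⸨t⸩.embed-hom (regular A⸨t⸩ʳ.ring)

    N : Mod k.ring
    N = S.overBase (regular S.ring)

    NP : Mod k.ring
    NP = P.overBase (regular P.ring)

    -- `N` and `P.overBase M` have the same operations but differ in the proofs of their laws, so
    -- the fields are copied over.
    toN : ∀ {U} → IsSubmodule (P.overBase M) U → IsSubmodule N U
    toN U-sub = record { resp = resp ; has0 = has0 ; has+ = has+ ; has* = has* }
      where open IsSubmodule U-sub

    fromN : ∀ {U} → IsSubmodule N U → IsSubmodule (P.overBase M) U
    fromN U-sub = record { resp = resp ; has0 = has0 ; has+ = has+ ; has* = has* }
      where open IsSubmodule U-sub

    S-isSTModule : IsSTModule k (powerSeries A) M S.topology
    S-isSTModule = fine-isST k (powerSeries A) M PT.P-isSTRing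

  S-isLinear : IsLinearTopology k N S.topology
  S-isLinear = record
    { +-continuous = +-continuous
    ; *-continuous = *-continuous
    ; basis = λ V V-open v → let (U , U-open , U-sub , U⊆V) = basis V V-open v in
        U , U-open , toN U-sub , U⊆V
    }
    where open IsLinearTopology (IsSTModule.isLinear S-isSTModule)

  orbit : ∀ m → LinearMap NP N (λ g → embed g S.* m)
  orbit m = record
    { cong = λ e → S.*-congʳ {m} (embed.⟦⟧-cong e)
    ; add = λ x y → S.trans (S.*-congʳ {m} (embed.+-homo x y)) (S.distribʳ m (embed x) (embed y))
    ; scal = λ c x → S.trans (S.*-congʳ {m} (embed.*-homo (P.ι c) x)) (S.*-assoc (S.ι c) (embed x) m)
    }

  const-orbit : ∀ m → LinearMap (A.overBase (regular A.ring)) N (λ a → laurent-const A a S.* m)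
  const-orbit m = record
    { cong = λ e → S.*-congʳ {m} (embed.⟦⟧-cong (const.⟦⟧-cong e))
    ; add = λ x y → S.trans (S.*-congʳ {m}
        (S.trans (embed.⟦⟧-cong (const.+-homo x y)) (embed.+-homo (const x) (const y))))
        (S.distribʳ m (laurent-const A x) (laurent-const A y))
    ; scal = λ c x → S.trans (S.*-congʳ {m}
        (S.trans (embed.⟦⟧-cong (const.*-homo (A.ι c) x)) (embed.*-homo (P.ι c) (const x))))
        (S.*-assoc (S.ι c) (laurent-const A x) m)
    }
    where module const = RingMorphisms.IsRingHomomorphism (PowerSeries.const-hom A.commutativeRing)

  S-*-continuous : ∀ u → Continuous S.topology S.topology (u S.*_)
  S-*-continuous u V (V-resp , V-open) =
    (λ x≈y → V-resp (S.*-congˡ {u} x≈y)) ,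
    λ x v →
      let (U , (U-sub , orb) , U⊆V) = V-open (u S.* x) v
          module U = IsSubmodule U-sub in
      (λ m → U (u S.* m)) ,
      (fromN (LinearMap.preimage u-linear (toN U-sub)) ,
       λ m → open-cong P.topology (λ {g} → U.resp (S.sym (comm (embed g) m)))
         (λ {g} → U.resp (comm (embed g) m)) (orb (u S.* m))) ,
      λ {w} p → V-resp (S.sym (S.distribˡ u x w)) (U⊆V p)
    where
    comm : ∀ a m → u S.* (a S.* m) S.≈ a S.* (u S.* m)
    comm a m = S.trans (S.sym (S.*-assoc u a m))
        (S.trans (S.*-congʳ {m} (S.*-comm u a)) (S.*-assoc a u m))

    u-linear : LinearMap N N (u S.*_)
    u-linear = record { cong = S.*-congˡ {u} ; add = S.distribˡ u ; scal = λ c x → comm (S.ι c) x }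

  S-isSTRing : IsSTRing k (laurent A)
  S-isSTRing = record { isLinear = S-isLinear ; *-continuous = S-*-continuous }

  module _ {U : Pred S.Carrier ℓ} (U-sub : IsSubmodule N U) where
    private module U = IsSubmodule U-sub

    module _ (U-open : τ.Open U) where
      private
        orbit-open : ∀ m → τP.Open (λ g → U (embed g S.* m))
        orbit-open m = IsSTModule.*ᵣ-continuous S-isSTModule m U U-open

      open⇒vanishing : ∀ m → ∃[ n ] (∀ {g} → VanishesBelow n g → U (embed g S.* m))
      open⇒vanishing m = PT.open⇒vanishing (orbit-open m)
        (IsSubmodule.has0 (LinearMap.preimage (orbit m) U-sub))

      open⇒const : ∀ m → τA.Open (λ a → U (laurent-const A a S.* m))
      open⇒const m = open-cong A.topology (λ {a} → U.resp (eq a)) (λ {a} → U.resp (S.sym (eq a)))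
        (PT.scale-continuous (const A.1#) _ (orbit-open m))
        where
        eq : ∀ a → embed (scale a (const A.1#)) S.* m S.≈ laurent-const A a S.* m
        eq a = S.*-congʳ {m} (embed.⟦⟧-cong (P.sym (monomial-scale a 0)))

    -- Testing constants suffices because `m` is arbitrary: `(a tⁱ) m = a (tⁱ m)`. This brings the
    -- fine `A[[t]]`-module topology down to the topology of `A`.
    vanishing∧const⇒open :
      (∀ m → ∃[ n ] (∀ {g} → VanishesBelow n g → U (embed g S.* m))) →
      (∀ m → τA.Open (λ a → U (laurent-const A a S.* m))) → τ.Open U
    vanishing∧const⇒open vanishing const-open = fineSubmodule-open (powerSeries A) M
      (fromN U-sub , λ m →
        let (n , n∈) = vanishing m in
        PT.vanishing∧coeff⇒open (LinearMap.preimage (orbit m) U-sub) n n∈ λ i →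
          open-cong A.topology (λ {a} → U.resp (eq m i a)) (λ {a} → U.resp (S.sym (eq m i a)))
            (const-open (embed (monomial A.1# i) S.* m)))
      where
      eq : ∀ m i a → laurent-const A a S.* (embed (monomial A.1# i) S.* m) S.≈ embed (monomial a i) S.* m
      eq m i a = S.trans (S.sym (S.*-assoc (laurent-const A a) (embed (monomial A.1# i)) m))
        (S.*-congʳ {m} (S.trans (S.sym (embed.*-homo (const a) (monomial A.1# i)))
          (embed.⟦⟧-cong (P.trans (const-⋆ a (monomial A.1# i)) (P.sym (monomial-scale a i))))))

iteratedLaurent-isSTRing : {k : Field ℓ} (n : ℕ) (A : TopRing k) → IsSTRing k A →
                           IsSTRing k (iteratedLaurent n A)
iteratedLaurent-isSTRing zero    A A-ST = A-ST
iteratedLaurent-isSTRing (suc n) A A-ST =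
  LaurentTopology.S-isSTRing (iteratedLaurent n A) (iteratedLaurent-isSTRing n A A-ST)

-- Valuations

module ValuationLemmas {K : Field ℓ} (V : DiscreteValuation K) where
  open Field K
  open DiscreteValuation V

  ¬v≥1-1 : ¬ v≥ (+ 1) 1#
  ¬v≥1-1 p with ≡.subst (+ 1 ℤ.≤_) (v-1 1≉0) (p 1≉0)
  ... | ℤ.+≤+ ()

  unit≉0 : ∀ {x y} → x * y ≈ 1# → ¬ (x ≈ 0#)
  unit≉0 xy≈1 x≈0 = 1≉0 (trans (sym xy≈1) (trans (*-congʳ x≈0) (zeroˡ _)))

  v≥-mono : ∀ {i j x} → i ℤ.≤ j → v≥ j x → v≥ i x
  v≥-mono i≤j p x≉0 = ℤ.≤-trans i≤j (p x≉0)

  v≥-inverse : ∀ {x y} → x * y ≈ 1# → ∀ x≉0 → v≥ (ℤ.- v x x≉0) y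
  v≥-inverse {x} {y} xy≈1 x≉0 y≉0 = ℤ.≤-reflexive (≡.sym (inverseʳ-unique (v x x≉0) (v y y≉0)
    (≡.trans (≡.sym (v-* x≉0 y≉0 xy≉0)) (≡.trans (v-cong xy≉0 1≉0 xy≈1) (v-1 1≉0)))))
    where
    open AbelianGroupProperties ℤ.+-0-abelianGroup using (inverseʳ-unique)
    xy≉0 = λ e → 1≉0 (trans (sym xy≈1) e)

  unit-inverse : ∀ {x y} → ¬ v≥ (+ 1) x → x * y ≈ 1# → v≥ (+ 0) y
  unit-inverse {x} ¬p xy≈1 = v≥-mono (ℤ.neg-mono-≤ vx≤0) (v≥-inverse xy≈1 x≉0)
    where
    x≉0 = unit≉0 xy≈1
    vx≤0 : v x x≉0 ℤ.≤ + 0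
    vx≤0 = ℤ.i<j⇒i≤pred[j] (ℤ.≰⇒> λ 1≤vx → ¬p λ x≉0′ → ≡.subst (+ 1 ℤ.≤_) (v-cong x≉0 x≉0′ refl) 1≤vx)

  module _ (em : ExcludedMiddle ℓ) where
    bounded-below : ∀ x → ∃[ N ] v≥ (ℤ.- + N) x
    bounded-below x with em {x ≈ 0#}
    ... | yes x≈0 = 0 , v≥-resp (sym x≈0) v≥-0
    ... | no  x≉0 = ℤ.∣ v x x≉0 ∣ , λ x≉0′ → ≡.subst (ℤ.- + ℤ.∣ v x x≉0 ∣ ℤ.≤_)
        (v-cong x≉0 x≉0′ refl) (-∣i∣≤i (v x x≉0))
      where
      -∣i∣≤i : ∀ i → ℤ.- + ℤ.∣ i ∣ ℤ.≤ i
      -∣i∣≤i (+ n)    = ℤ.neg-≤-pos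
      -∣i∣≤i -[1+ n ] = ℤ.≤-refl

    absorb : ∀ x M → ∃[ N ] (∀ {a} → v≥ (+ N) a → v≥ (+ M) (a * x))
    absorb x M = let (N , p) = bounded-below x in
      M ℕ.+ N , λ {a} q → ≡.subst (λ i → v≥ i (a * x)) ([i+j]-j≡i (+ M) (+ N)) (v≥-* q p)
      where
      [i+j]-j≡i : ∀ i j → (i ℤ.+ j) ℤ.- j ≡ i
      [i+j]-j≡i i j = ≡.trans (ℤ.+-assoc i j (ℤ.- j))
          (≡.trans (≡.cong (λ z → i ℤ.+ z) (ℤ.+-inverseʳ j)) (ℤ.+-identityʳ i))

  π : Carrier
  π = proj₁ (surjective (+ 1))

  private
    π≉0 = proj₁ (proj₂ (surjective (+ 1)))
    vπ≡1 = proj₂ (proj₂ (surjective (+ 1)))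

  π⁻¹ : Carrier
  π⁻¹ = proj₁ (inverse π π≉0)

  π*π⁻¹≈1 : π * π⁻¹ ≈ 1#
  π*π⁻¹≈1 = proj₂ (inverse π π≉0)

  π⁻¹*π≈1 : π⁻¹ * π ≈ 1#
  π⁻¹*π≈1 = trans (*-comm π⁻¹ π) π*π⁻¹≈1

  v≥1-π : v≥ (+ 1) π
  v≥1-π π≉0′ = ≡.subst (+ 1 ℤ.≤_) (≡.trans (≡.sym vπ≡1) (v-cong π≉0 π≉0′ refl)) ℤ.≤-refl

  v≥0-π : v≥ (+ 0) π
  v≥0-π = v≥-mono (ℤ.+≤+ ℕ.z≤n) v≥1-π

  v≥-1-π⁻¹ : v≥ (ℤ.- + 1) π⁻¹
  v≥-1-π⁻¹ = ≡.subst (λ i → v≥ (ℤ.- i) π⁻¹) vπ≡1 (v≥-inverse π*π⁻¹≈1 π≉0)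

  v≥-π⁻¹* : ∀ {N x} → v≥ (+ suc N) x → v≥ (+ N) (π⁻¹ * x)
  v≥-π⁻¹* = v≥-* v≥-1-π⁻¹

-- The residue field of a topological local field

module ResidueTopology {k : Field ℓ} {n : ℕ} (T : LocalFieldData k (suc n))
                       (K-ST : IsSTRing k (LocalFieldData.topRing T)) where
  private
    module T = LocalFieldData T
    module τ = Topology T.topology
    module T₁ = LocalFieldData (residue T)
    module τ₁ = Topology T₁.topology
    module K-ST = IsSTRing K-ST
    open FirstValuation T hiding (residue)
    NK = T.overBase (regular T.ring)
    N₁ = T₁.overBase (regular T₁.ring)
    module KL = LinearTopology k NK T.topology

  ∼-from-≈ : ∀ {x y} → x 𝒪.≈ y → x k₁.≈ y
  ∼-from-≈ {x} {y} = ⟦⟧-cong {x} {y}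
    where open RingMorphisms.IsRingHomomorphism (quotientRing-hom 𝒪 𝔪)

  residue-open : ∀ {V W} → IsSubmodule N₁ V → τ.Open W → W T.0# → (∀ y → W (proj₁ y) → V y) → τ₁.Open V
  residue-open {V} {W} V-sub W-open w W⊆V =
    resp ,
    -- An open subset of `K` whose trace on `𝒪` is `V`: the union of the translates of `W` by the
    -- points of `V`.
    (λ y → Σ[ x ∈ 𝒪.Carrier ] (V x × W (T.- proj₁ x T.+ y))) ,
    τ.Open-local (λ y (x , v , p) → (λ z → W (T.- proj₁ x T.+ z)) ,
      KL.translate K-ST.isLinear W (T.- proj₁ x) W-open , p , λ q → x , v , q) ,
    (λ {x} v → x , v , τ.Open-resp W-open (T.sym (T.-‿inverseˡ (proj₁ x))) w) ,
    (λ {y} (x , v , p) → resp (∼-from-≈ {x 𝒪.+ (𝒪.- x 𝒪.+ y)} {y} (GL.x+[-x+y]≈y x y))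
      (has+ v (W⊆V (𝒪.- x 𝒪.+ y) p)))
    where
    open IsSubmodule V-sub
    module GL = GroupLemmas 𝒪.+-abelianGroup

  residue-neighbourhood : ∀ {V} x → τ₁.Open V → V x →
    ∃[ U ] (τ.Open U × IsSubmodule NK U × (∀ u → U (proj₁ u) → V (x 𝒪.+ u)))
  residue-neighbourhood x (_ , W , W-open , V⊆W , W⊆V) v =
    let (U , U-open , U-sub , x+U⊆W) = KL.neighbourhood K-ST.isLinear W (proj₁ x) W-open (V⊆W v) in
    U , U-open , U-sub , λ u p → W⊆V (x+U⊆W p)

  residue-isSTRing : IsSTRing k T₁.topRing
  residue-isSTRing = record
    { isLinear = LinearTopology.isLinearTopology k N₁ T₁.topology
        (λ V x V-open v →
          let (U , U-open , U-sub , x+U⊆V) = residue-neighbourhood x V-open v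
              Ū-sub = image U-sub in
          Ū U , residue-open Ū-sub U-open (IsSubmodule.has0 U-sub) (λ y u → y , u , k₁.refl {y}) , Ū-sub ,
          λ {z} (u , p , u∼z) → proj₁ V-open (k₁.+-congˡ {x} {u} {z} u∼z) (x+U⊆V u p))
        (λ { U x (U-resp , W , W-open , U⊆W , W⊆U) U-sub →
          (λ {y} {z} y∼z → U-resp (k₁.+-congʳ {𝒪.- x} {y} {z} y∼z)) ,
          (λ y → W (y T.- proj₁ x)) ,
          open-cong T.topology (λ {y} → τ.Open-resp W-open (T.+-comm (T.- proj₁ x) y))
            (λ {y} → τ.Open-resp W-open (T.+-comm y (T.- proj₁ x)))
            (KL.translate K-ST.isLinear W (T.- proj₁ x) W-open) ,
          U⊆W , W⊆U })
    ; *-continuous = λ { a V (V-resp , W , W-open , V⊆W , W⊆V) →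
        (λ {y} {z} y∼z → V-resp (k₁.*-congˡ {a} {y} {z} y∼z)) ,
        (λ y → W (proj₁ a T.* y)) , K-ST.*-continuous (proj₁ a) W W-open , V⊆W , W⊆V }
    }
    where
    -- The image of `U ∩ 𝒪` in `k₁`, saturated under congruence modulo `𝔪`.
    Ū : Pred T.Carrier ℓ → Pred 𝒪.Carrier ℓ
    Ū U z = ∃[ u ] (U (proj₁ {B = v≥ (+ 0)} u) × u k₁.≈ z)

    image : ∀ {U} → IsSubmodule NK U → IsSubmodule N₁ (Ū U)
    image U-sub = record
      { resp = λ {y} {z} y∼z (u , p , e) → u , p , k₁.trans {u} {y} {z} e y∼z
      ; has0 = 𝒪.0# , has0 , k₁.refl {𝒪.0#}
      ; has+ = λ {y} {z} (u , p , e) (u′ , p′ , e′) →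
          u 𝒪.+ u′ , has+ p p′ , k₁.+-cong {u} {y} {u′} {z} e e′
      ; has* = λ c {z} (u , p , e) → ι-𝒪 c 𝒪.* u , has* c p , k₁.*-congˡ {ι-𝒪 c} {u} {z} e
      }
      where open IsSubmodule U-sub

-- All that is used about S = A((t)).

record IsLaurent {k : Field ℓ} (A S : TopRing k) : Set (lsuc ℓ) where
  private
    module A = TopRing A
    module S = TopRing S
    module P = CommutativeRing (PowerSeries.commutativeRing A.commutativeRing)
    NA = A.overBase (regular A.ring)
    NS = S.overBase (regular S.ring)
  open SeriesLemmas A.commutativeRing
  open PowerSeries A.commutativeRing using (Series; _≋_; _⋆_; const; t)
  open ExpProperties P.semiring using (_^_)
  field
    embed            : Series → S.Carrier
    embed-cong       : ∀ {g h} → g ≋ h → embed g S.≈ embed h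
    embed-+          : ∀ g h → embed (g P.+ h) S.≈ embed g S.+ embed h
    embed-⋆          : ∀ g h → embed (g ⋆ h) S.≈ embed g S.* embed h
    embed-0          : embed P.0# S.≈ S.0#
    embed-1          : embed P.1# S.≈ S.1#
    embed-ι          : ∀ c → embed (const (A.ι c)) S.≈ S.ι c
    embed-injective  : ∀ {g h} → embed g S.≈ embed h → g ≋ h
    denominator      : ∀ u → ∃[ h ] ∃[ m ] (embed (t ^ m) S.* u S.≈ embed h)
    -- The coefficient of `t⁰`. It extends the reduction `A[[t]] → A` to all of `S`, so that open
    -- submodules of `A` can be pulled back to open submodules of `S`.
    c₀               : S.Carrier → A.Carrier
    c₀-linear        : LinearMap NS NA c₀
    c₀-embed         : ∀ g → c₀ (embed g) A.≈ g 0
    c₀-const         : ∀ u a → c₀ (embed (const a) S.* u) A.≈ c₀ u A.* a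
    c₀-vanishing     : ∀ u → ∃[ m ] (∀ {g} → VanishesBelow m g → c₀ (embed g S.* u) A.≈ A.0#)
    S-isSTRing       : IsSTRing k S
    const-orbit      : ∀ m → LinearMap NA NS (λ a → embed (const a) S.* m)
    open⇒vanishing   : ∀ {U} → IsSubmodule NS U → Topology.Open S.topology U →
                       ∀ m → ∃[ n ] (∀ {g} → VanishesBelow n g → U (embed g S.* m))
    open⇒const       : ∀ {U} → IsSubmodule NS U → Topology.Open S.topology U →
                       ∀ m → Topology.Open A.topology (λ a → U (embed (const a) S.* m))
    vanishing∧const⇒open : ∀ {U} → IsSubmodule NS U →
      (∀ m → ∃[ n ] (∀ {g} → VanishesBelow n g → U (embed g S.* m))) →
      (∀ m → Topology.Open A.topology (λ a → U (embed (const a) S.* m))) →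
      Topology.Open S.topology U

module _ {k : Field ℓ} (A : TopRing k) (A-ST : IsSTRing k A) where
  private
    module A = TopRing A
    module A[[t]] = PowerSeries A.commutativeRing
    module P = CommutativeRing A[[t]].commutativeRing
    module A⸨t⸩ = Localization A[[t]].commutativeRing A[[t]].t
    module S = TopRing (laurent A)
    module embed = RingMorphisms.IsRingHomomorphism A⸨t⸩.embed-hom
    module LT = LaurentTopology A A-ST
    NA = A.overBase (regular A.ring)
    NS = S.overBase (regular S.ring)
    open SeriesLemmas A.commutativeRing
    open A[[t]] using (_≋_; _⋆_; t)
    open ExpProperties P.semiring using (_^_)

    embed-injective : ∀ {g h} → laurent-embed A g S.≈ laurent-embed A h → g ≋ h
    embed-injective {g} {h} (A⸨t⸩.via l e) i = A.trans (A.sym (coeff g))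
        (A.trans (e (l ℕ.+ i)) (coeff h))
      where
      coeff : ∀ g → (t ^ l ⋆ (P.1# ⋆ g)) (l ℕ.+ i) A.≈ g i
      coeff g = A.trans (t^⋆-coeff l (P.1# ⋆ g) i) (P.*-identityˡ g i)

    -- The pair stands for `g / tᵐ`, whose constant coefficient is the coefficient of `tᵐ` in `g`.
    c₀ : S.Carrier → A.Carrier
    c₀ (g , m) = g m

    t^⋆-at : ∀ m g n i → n ≡ m ℕ.+ i → (t ^ m ⋆ g) n A.≈ g i
    t^⋆-at m g n i ≡.refl = t^⋆-coeff m g i

    c₀-linear : LinearMap NS NA c₀
    c₀-linear = record
      { cong = λ { {g , m} {h , n} (A⸨t⸩.via l e) → A.trans (A.sym (A.trans
            (t^⋆-coeff l (t ^ n ⋆ g) (n ℕ.+ m)) (t^⋆-coeff n g m)))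
          (A.trans (e (l ℕ.+ (n ℕ.+ m))) (A.trans (t^⋆-coeff l (t ^ m ⋆ h) (n ℕ.+ m))
            (t^⋆-at m h (n ℕ.+ m) n (ℕ.+-comm n m)))) }
      ; add = λ { (g , m) (h , n) → A.+-cong (t^⋆-at n g (m ℕ.+ n) m (ℕ.+-comm m n)) (t^⋆-coeff m h n) }
      ; scal = λ { c (g , m) → const-⋆ (A.ι c) g m }
      }

  laurent-isLaurent : IsLaurent A (laurent A)
  laurent-isLaurent = record
    { embed = laurent-embed A
    ; embed-cong = embed.⟦⟧-cong
    ; embed-+ = embed.+-homo
    ; embed-⋆ = embed.*-homo
    ; embed-0 = S.refl {A⸨t⸩.embed P.0#}
    ; embed-1 = S.refl {A⸨t⸩.embed P.1#}
    ; embed-ι = λ c → S.refl {S.ι c}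
    ; embed-injective = embed-injective
    ; denominator = λ (h , m) → h , m , A⸨t⸩.via 0 (P.*-congˡ {P.1#} (P.*-identityˡ (t ^ m ⋆ h)))
    ; c₀ = c₀
    ; c₀-linear = c₀-linear
    ; c₀-embed = λ g → A.refl
    ; c₀-const = λ (h , m) a → A.trans (const-⋆ a h m) (A.*-comm a (h m))
    -- The constant coefficient of `g h / tᵐ` involves `g` up to degree `m`, hence `suc m`.
    ; c₀-vanishing = λ (h , m) → suc m , λ {g} p →
        A.trans (P.*-comm g h m) (⋆-vanishes (suc m) h p m ℕ.≤-refl)
    ; S-isSTRing = LT.S-isSTRing
    ; const-orbit = LT.const-orbit
    ; open⇒vanishing = LT.open⇒vanishing
    ; open⇒const = LT.open⇒const
    ; vanishing∧const⇒open = LT.vanishing∧const⇒open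
    }

-- Open submodules in terms of a lifting

module LiftingLemmas {k : Field ℓ} {n : ℕ} (T : LocalFieldData k (suc n)) (σ₁ : Lifting T) where
  private
    module T = LocalFieldData T
    module T₁ = LocalFieldData (residue T)
    NK = T.overBase (regular T.ring)
  open FirstValuation T hiding (residue; surjective)
  open Lifting σ₁ using (σ; isRingHom; splits) renaming (continuous to σ-continuous)
  module σ = RingMorphisms.IsRingHomomorphism isRingHom

  lift₁ : k₁.Carrier → T.Carrier
  lift₁ c = proj₁ (σ c)

  lift₁-integral : ∀ c → v≥ (+ 0) (lift₁ c)
  lift₁-integral c = proj₂ (σ c)

  lift₁-cong : ∀ {c d} → c k₁.≈ d → lift₁ c T.≈ lift₁ d
  lift₁-cong {c} {d} = σ.⟦⟧-cong {c} {d}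

  lift₁-splits : ∀ x → v≥ (+ 1) (proj₁ x T.- lift₁ x)
  lift₁-splits x = k₁.sym {σ x} {x} (splits x)

  lift₁-hom : IsRingHom k₁.ring T.ring lift₁
  lift₁-hom = ∘-isRingHom k₁.ring 𝒪.ring T.ring isRingHom 𝒪-incl-hom

  lift₁-continuous : Continuous T₁.topology T.topology lift₁
  lift₁-continuous W W-open = σ-continuous (W ∘ proj₁) (W , W-open , id , id)

  record OpenCriterion : Set (lsuc ℓ) where
    private
      module τ = Topology T.topology
      module τ₁ = Topology T₁.topology
    field
      open⇒ball  : ∀ {U} → IsSubmodule NK U → τ.Open U → ∃[ N ] (∀ {x} → v≥ (+ N) x → U x)
      open⇒slice : ∀ {U} → IsSubmodule NK U → τ.Open U → ∀ m → τ₁.Open (λ c → U (lift₁ c T.* m))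
      ball∧slice⇒open : ∀ {U} → IsSubmodule NK U → ∃[ N ] (∀ {x} → v≥ (+ N) x → U x) →
                        (∀ m → τ₁.Open (λ c → U (lift₁ c T.* m))) → τ.Open U

-- Transport along a parametrization

module Parametrization (em : ExcludedMiddle ℓ) {k : Field ℓ} {n : ℕ} (T : LocalFieldData k (suc n))
  (K-ST : IsSTRing k (LocalFieldData.topRing T))
  {A S : TopRing k} (A-ST : IsSTRing k A) (S-isLaurent : IsLaurent A S)
  (f : TopRing.Carrier S → LocalFieldData.Carrier T)
  (f-iso : IsRingIso (TopRing.ring S) (LocalFieldData.ring T) f)
  (f-over-k : ∀ c → LocalFieldData._≈_ T (f (TopRing.ι S c)) (LocalFieldData.ι T c))
  (f-continuous : Continuous (TopRing.topology S) (LocalFieldData.topology T) f)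
  (f-open : IsOpenMap (TopRing.topology S) (LocalFieldData.topology T) f)
  (into : ∀ g → FirstValuation.v≥ T (+ 0) (f (IsLaurent.embed S-isLaurent g)))
  (onto : ∀ y → FirstValuation.v≥ T (+ 0) y →
          ∃[ g ] (LocalFieldData._≈_ T (f (IsLaurent.embed S-isLaurent g)) y))
  where
  private
    module T = LocalFieldData T
    module T₁ = LocalFieldData (residue T)
    module τ₁ = Topology T₁.topology
    module A = TopRing A
    module τA = Topology A.topology
    module A[[t]] = PowerSeries A.commutativeRing
    module P = CommutativeRing A[[t]].commutativeRing
    module S = TopRing S
    module const = RingMorphisms.IsRingHomomorphism A[[t]].const-hom
    module RT = ResidueTopology T K-ST
    NK = T.overBase (regular T.ring)
    N₁ = T₁.overBase (regular T₁.ring)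
    NA = A.overBase (regular A.ring)
    NS = S.overBase (regular S.ring)
    module KG = GroupLemmas T.+-abelianGroup
  open IsLaurent S-isLaurent
  open FirstValuation T hiding (residue; surjective)
  open ValuationLemmas valuation
  open SeriesLemmas A.commutativeRing
  open PowerSeries A.commutativeRing using (Series; _≋_; _⋆_; const; t)
  open ExpProperties P.semiring using (_^_)
  open RingMorphisms.IsRingIsomorphism f-iso
    using (injective; surjective; ⟦⟧-cong; +-homo; *-homo; 1#-homo; 0#-homo)

  f-linear : LinearMap NS NK f
  f-linear = record
    { cong = ⟦⟧-cong
    ; add = +-homo
    ; scal = λ c x → T.trans (*-homo (S.ι c) x) (T.*-congʳ (f-over-k c))
    }

  private
    f-+ : ∀ g h → f (embed (g P.+ h)) T.≈ f (embed g) T.+ f (embed h)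
    f-+ g h = T.trans (⟦⟧-cong (embed-+ g h)) (+-homo (embed g) (embed h))

    f-⋆ : ∀ g h → f (embed (g ⋆ h)) T.≈ f (embed g) T.* f (embed h)
    f-⋆ g h = T.trans (⟦⟧-cong (embed-⋆ g h)) (*-homo (embed g) (embed h))

    f-1 : f (embed P.1#) T.≈ T.1#
    f-1 = T.trans (⟦⟧-cong embed-1) 1#-homo

    f-embed-injective : ∀ {g h} → f (embed g) T.≈ f (embed h) → g ≋ h
    f-embed-injective e = embed-injective (injective e)

    1≉0 : ¬ (A.1# A.≈ A.0#)
    1≉0 1≈0 = T.1≉0 (T.trans (T.sym f-1)
      (T.trans (⟦⟧-cong (embed-cong (const.⟦⟧-cong 1≈0)))
      (T.trans (⟦⟧-cong (embed-cong const.0#-homo)) (T.trans (⟦⟧-cong embed-0) 0#-homo))))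

    ¬unit : ∀ {g h} → v≥ (+ 1) (f (embed g)) → ¬ (g ⋆ h ≋ P.1#)
    ¬unit {g} {h} p gh≋1 = ¬v≥1-1 (v≥-resp
      (T.trans (T.sym (f-⋆ g h)) (T.trans (⟦⟧-cong (embed-cong gh≋1)) f-1))
      (v≥-* p (into h)))

  -- That `f` matches the valuation rings says nothing about `t` directly. If `f(t)` were a unit of
  -- `𝒪`, its inverse would be some `f(g)` with `g` in `A[[t]]`, and `t g = 1` fails at the constant
  -- term.
  v≥1-t : v≥ (+ 1) (f (embed t))
  v≥1-t with em {v≥ (+ 1) (f (embed t))}
  ... | yes p = p
  ... | no ¬p = λ ft≉0 →
    let (y , fty≈1) = T.inverse (f (embed t)) ft≉0
        (g , fg≈y) = onto y (unit-inverse ¬p fty≈1)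
        tg≋1 = f-embed-injective (T.trans (f-⋆ t g)
            (T.trans (T.*-congˡ fg≈y) (T.trans fty≈1 (T.sym f-1)))) in
    ⊥-elim (1≉0 (A.trans (A.sym (tg≋1 0)) (t⋆-zero g)))

  constant-term : ∀ g → v≥ (+ 1) (f (embed (const (g 0))) T.- f (embed g))
  constant-term g = v≥-resp (T.sym eq) (v≥-neg (v≥-* v≥1-t (into tail)))
    where
    tail : Series
    tail i = g (suc i)
    c = f (embed (const (g 0)))
    z = f (embed t) T.* f (embed tail)
    g≋ : g ≋ const (g 0) P.+ (t ⋆ tail)
    g≋ zero    = A.sym (A.trans (A.+-congˡ (t⋆-zero tail)) (A.+-identityʳ _))
    g≋ (suc i) = A.sym (A.trans (A.+-congˡ (t⋆-suc tail i)) (A.+-identityˡ _))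
    eq : c T.- f (embed g) T.≈ T.- z
    eq = T.trans (T.+-congˡ (T.trans
        (T.-‿cong (T.trans (⟦⟧-cong (embed-cong g≋))
          (T.trans (f-+ (const (g 0)) (t ⋆ tail)) (T.+-congˡ (f-⋆ t tail)))))
        (T.sym (KG.⁻¹-∙-comm c z))))
      (KG.x+[-x+y]≈y c (T.- z))

  s : A.Carrier → T.Carrier
  s a = f (embed (const a))

  f̄ : A.Carrier → 𝒪.Carrier
  f̄ a = s a , into (const a)

  private
    s-+ : ∀ a b → s (a A.+ b) T.≈ s a T.+ s b
    s-+ a b = T.trans (⟦⟧-cong (embed-cong (const.+-homo a b))) (f-+ (const a) (const b))

    s-* : ∀ a b → s (a A.* b) T.≈ s a T.* s b
    s-* a b = T.trans (⟦⟧-cong (embed-cong (const.*-homo a b))) (f-⋆ (const a) (const b))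

    s-over-k : ∀ c → s (A.ι c) T.≈ T.ι c
    s-over-k c = T.trans (⟦⟧-cong (embed-ι c)) (f-over-k c)

  s-linear : LinearMap NA NK s
  s-linear = record
    { cong = λ e → ⟦⟧-cong (embed-cong (const.⟦⟧-cong e))
    ; add = s-+
    ; scal = λ c a → T.trans (s-* (A.ι c) a) (T.*-congʳ (s-over-k c))
    }

  f̄-over-k : ∀ c → f̄ (A.ι c) k₁.≈ T₁.ι c
  f̄-over-k c = RT.∼-from-≈ {f̄ (A.ι c)} {T₁.ι c} (s-over-k c)

  private
    f̄-hom : IsRingHom A.ring T₁.ring f̄
    f̄-hom = mkRingHom A.ring T₁.ring f̄
      (λ {a} {b} e → RT.∼-from-≈ {f̄ a} {f̄ b} (LinearMap.cong s-linear e))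
      (λ a b → RT.∼-from-≈ {f̄ (a A.+ b)} {f̄ a 𝒪.+ f̄ b} (s-+ a b))
      (λ a b → RT.∼-from-≈ {f̄ (a A.* b)} {f̄ a 𝒪.* f̄ b} (s-* a b))
      (RT.∼-from-≈ {f̄ A.1#} {𝒪.1#} f-1)

    f̄-linear : LinearMap NA N₁ f̄
    f̄-linear = record
      { cong = λ {a} {b} e → RT.∼-from-≈ {f̄ a} {f̄ b} (LinearMap.cong s-linear e)
      ; add = λ a b → RT.∼-from-≈ {f̄ (a A.+ b)} {f̄ a 𝒪.+ f̄ b} (s-+ a b)
      ; scal = λ c a → RT.∼-from-≈ {f̄ (A.ι c A.* a)} {T₁.ι c 𝒪.* f̄ a} (LinearMap.scal s-linear c a)
      }

    -- For `a ≠ b` the constant `c = a - b` acquires an inverse in `S`, because `K` is a field.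
    -- Clearing its denominator gives `c h = tᵐ`, whose coefficient of degree `m` shows that `a - b`
    -- is a unit of `A`. Then `f(c)` cannot lie in `𝔪`.
    f̄-injective : ∀ {a b} → f̄ a k₁.≈ f̄ b → a A.≈ b
    f̄-injective {a} {b} p with em {a A.≈ b}
    ... | yes a≈b = a≈b
    ... | no  a≉b =
      let (y , cy≈1) = T.inverse (f (embed c)) fc≉0
          (u , fu≈y) = surjective y
          (h , m , t^m*u≈h) = denominator u
          cu≈1 = injective {embed c S.* u} {S.1#}
            (T.trans (*-homo (embed c) u) (T.trans (T.*-congˡ (fu≈y (S.refl {u})))
              (T.trans cy≈1 (T.sym 1#-homo))))
          ch≋t^m = embed-injective {c ⋆ h} {t ^ m ⋆ P.1#} (begin
            embed (c ⋆ h)                     ≈⟨ embed-⋆ c h ⟩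
            embed c S.* embed h               ≈⟨ S.*-congˡ t^m*u≈h ⟨
            embed c S.* (embed (t ^ m) S.* u) ≈⟨ S.*-assoc _ _ _ ⟨
            embed c S.* embed (t ^ m) S.* u   ≈⟨ S.*-congʳ (S.*-comm _ _) ⟩
            embed (t ^ m) S.* embed c S.* u   ≈⟨ S.*-assoc _ _ _ ⟩
            embed (t ^ m) S.* (embed c S.* u) ≈⟨ S.*-congˡ cu≈1 ⟩
            embed (t ^ m) S.* S.1#            ≈⟨ S.*-congˡ embed-1 ⟨
            embed (t ^ m) S.* embed P.1#      ≈⟨ embed-⋆ (t ^ m) P.1# ⟨
            embed (t ^ m ⋆ P.1#)              ∎) in
      ⊥-elim (¬unit fc∈𝔪 (P.trans (P.sym (const.*-homo (a A.- b) (h m))) (const.⟦⟧-cong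
        (A.trans (A.sym (const-⋆ (a A.- b) h m)) (A.trans (ch≋t^m m)
        (A.trans (A.reflexive (≡.cong (t ^ m ⋆ P.1#) (≡.sym (ℕ.+-identityʳ m))))
          (t^⋆-coeff m P.1# 0)))))))
      where
      open SetoidReasoning S.setoid
      open GroupLemmas A.+-abelianGroup
      c = const (a A.- b)
      fc∈𝔪 : v≥ (+ 1) (f (embed c))
      fc∈𝔪 = v≥-resp (T.sym (LinearMap.sub s-linear a b)) p
      fc≉0 : ¬ (f (embed c) T.≈ T.0#)
      fc≉0 e = a≉b (A.trans (A.sym ([x-y]+y≈x a b)) (A.trans
        (A.+-congʳ (f-embed-injective {c} {P.0#}
          (T.trans e (T.sym (T.trans (⟦⟧-cong embed-0) 0#-homo))) 0)) (A.+-identityˡ b)))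

    f̄-surjective : ∀ y → ∃[ a ] (f̄ a k₁.≈ y)
    f̄-surjective y =
      let (g , fg≈y) = onto (proj₁ y) (proj₂ y) in
      g 0 , v≥-resp (T.+-congˡ (T.-‿cong fg≈y)) (constant-term g)

    c₀-open : ∀ U → τA.Open U → IsSubmodule NA U → Topology.Open S.topology (U ∘ c₀)
    c₀-open U U-open U-sub = vanishing∧const⇒open (LinearMap.preimage c₀-linear U-sub)
      (λ u → let (m , p) = c₀-vanishing u in m , λ q → U.resp (A.sym (p q)) U.has0)
      (λ u → open-cong A.topology (λ {a} → U.resp (A.sym (c₀-const u a))) (λ {a} → U.resp (c₀-const u a))
        (IsSTRing.*-continuous A-ST (c₀ u) U U-open))
      where module U = IsSubmodule U-sub

  f̄-iso : IsRingIso A.ring T₁.ring f̄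
  f̄-iso = record
    { isRingMonomorphism = record { isRingHomomorphism = f̄-hom ; injective = f̄-injective }
    ; surjective = λ y → let (a , p) = f̄-surjective y in
        a , λ {b} b≈a → k₁.trans {f̄ b} {f̄ a} {y} (LinearMap.cong f̄-linear b≈a) p
    }

  -- The image of `U` consists of the residues of the open set `f(c₀⁻¹(U))`: an integral element of
  -- that set is `f(g)` with `g 0 ∈ U`.
  f̄-open : IsOpenMap A.topology T₁.topology f̄
  f̄-open = linear-open (IsSTRing.isLinear A-ST) (IsSTRing.isLinear RT.residue-isSTRing) f̄-linear
    λ U U-open U-sub → RT.residue-open (LinearMap.image f̄-linear U-sub)
      (f-open (U ∘ c₀) (c₀-open U U-open U-sub))
      (S.0# , IsSubmodule.resp U-sub (A.sym (LinearMap.zer c₀-linear))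
        (IsSubmodule.has0 U-sub) , 0#-homo)
      (λ y (h , u , fh≈y) →
        let (g , fg≈y) = onto (proj₁ y) (proj₂ y) in
        g 0 ,
        IsSubmodule.resp U-sub (A.trans (LinearMap.cong c₀-linear {h} {embed g}
          (injective (T.trans fh≈y (T.sym fg≈y)))) (c₀-embed g)) u ,
        v≥-resp (T.+-congˡ (T.-‿cong fg≈y)) (constant-term g))

  private
    const-continuous : Continuous A.topology S.topology (embed ∘ const)
    const-continuous V V-open = open-cong A.topology
      (λ {a} → Topology.Open-resp S.topology V-open (S.*-identityʳ (embed (const a))))
      (λ {a} → Topology.Open-resp S.topology V-open (S.sym (S.*-identityʳ (embed (const a)))))
      (linear-continuous (IsSTRing.isLinear A-ST) (IsSTRing.isLinear S-isSTRing) (const-orbit S.1#)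
        (λ U U-open U-sub → open⇒const U-sub U-open S.1#) V V-open)

  s-continuous : Continuous A.topology T.topology s
  s-continuous V V-open = const-continuous (V ∘ f) (f-continuous V V-open)

  f̄-continuous : Continuous A.topology T₁.topology f̄
  f̄-continuous V (_ , W , W-open , V⊆W , W⊆V) =
    open-cong A.topology W⊆V V⊆W (s-continuous W W-open)

  private
    v≥-vanishing : ∀ N {g} → VanishesBelow N g → v≥ (+ N) (f (embed g))
    v≥-vanishing N {g} p = v≥-resp (⟦⟧-cong (embed-cong (P.sym (vanishes⇒t^⋆ N g p))))
        (powers N (λ i → g (N ℕ.+ i)))
      where
      powers : ∀ N g → v≥ (+ N) (f (embed (t ^ N ⋆ g)))
      powers zero    g = into (t ^ 0 ⋆ g)
      powers (suc N) g = v≥-resp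
        (T.trans (T.sym (f-⋆ t (t ^ N ⋆ g))) (⟦⟧-cong (embed-cong (P.sym (P.*-assoc t (t ^ N) g)))))
        (v≥-* v≥1-t (powers N g))

    -- `N′` is chosen so that elements of valuation at least `N′` stay integral after division by
    -- `f(tᴺ)`; the quotient is then some `f(g)`.
    vanishing-onto : ∀ N → ∃[ N′ ] (∀ {x} → v≥ (+ N′) x → ∃[ g ] (VanishesBelow N g × f (embed g) T.≈ x))
    vanishing-onto N =
      let (y , ty≈1) = T.inverse z z≉0
          (N′ , integral) = absorb em y 0 in
      N′ , λ {x} p →
        let (g , fg≈xy) = onto (x T.* y) (integral p) in
        t ^ N ⋆ g , t^⋆-vanishes N g , (begin
          f (embed (t ^ N ⋆ g)) ≈⟨ f-⋆ (t ^ N) g ⟩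
          z T.* f (embed g)     ≈⟨ T.*-congˡ fg≈xy ⟩
          z T.* (x T.* y)       ≈⟨ T.*-congˡ (T.*-comm x y) ⟩
          z T.* (y T.* x)       ≈⟨ T.*-assoc z y x ⟨
          z T.* y T.* x         ≈⟨ T.*-congʳ ty≈1 ⟩
          T.1# T.* x            ≈⟨ T.*-identityˡ x ⟩
          x                     ∎)
      where
      open SetoidReasoning T.setoid
      z = f (embed (t ^ N))
      z≉0 : ¬ (z T.≈ T.0#)
      z≉0 z≈0 = 1≉0 (A.trans (A.sym (t^⋆-coeff N P.1# 0)) (A.trans (P.*-identityʳ (t ^ N) (N ℕ.+ 0))
        (f-embed-injective {t ^ N} {P.0#}
          (T.trans z≈0 (T.sym (T.trans (⟦⟧-cong embed-0) 0#-homo))) (N ℕ.+ 0))))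

  module _ (σ₁ : Lifting T) where
    open LiftingLemmas T σ₁
    private
      module lift₁ = RingMorphisms.IsRingHomomorphism lift₁-hom

      -- The maps met while expanding `s` along `σ₁`. Multiplicativity may be lost once a digit is
      -- removed, so only integrality, linearity and continuity are kept; `next` passes from `r` to
      -- `π⁻¹ (r - σ₁ r̄)`.
      record IntegralMap (r : A.Carrier → T.Carrier) : Set (lsuc ℓ) where
        field
          integral   : ∀ a → v≥ (+ 0) (r a)
          linear     : LinearMap NA NK r
          continuous : Continuous A.topology T.topology r

        r̄ : A.Carrier → 𝒪.Carrier
        r̄ a = r a , integral a

        r̄-continuous : Continuous A.topology T₁.topology r̄
        r̄-continuous V (_ , W , W-open , V⊆W , W⊆V) = open-cong A.topology W⊆V V⊆W (continuous W W-open)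

        private
          open LinearMap linear

          q r′ : A.Carrier → T.Carrier
          q a = r a T.- lift₁ (r̄ a)
          r′ a = π⁻¹ T.* q a

          lift₁r̄-linear : LinearMap NA NK (lift₁ ∘ r̄)
          lift₁r̄-linear = record
            { cong = λ {a} {b} e → lift₁-cong {r̄ a} {r̄ b} (RT.∼-from-≈ {r̄ a} {r̄ b} (cong e))
            ; add = λ a b → T.trans
                (lift₁-cong {r̄ (a A.+ b)} {r̄ a 𝒪.+ r̄ b}
                  (RT.∼-from-≈ {r̄ (a A.+ b)} {r̄ a 𝒪.+ r̄ b} (add a b)))
                (lift₁.+-homo (r̄ a) (r̄ b))
            ; scal = λ c a → T.trans
                (lift₁-cong {r̄ (A.ι c A.* a)} {T₁.ι c 𝒪.* r̄ a}
                  (RT.∼-from-≈ {r̄ (A.ι c A.* a)} {T₁.ι c 𝒪.* r̄ a} (scal c a)))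
                (T.trans (lift₁.*-homo (T₁.ι c) (r̄ a)) (T.*-congʳ (Lifting.over-k σ₁ c)))
            }
          module l = LinearMap lift₁r̄-linear
          module KL = ModuleLemmas NK

          q-linear : LinearMap NA NK q
          q-linear = record
            { cong = λ e → T.+-cong (cong e) (T.-‿cong (l.cong e))
            ; add = λ a b → T.trans (T.+-cong (add a b) (T.-‿cong (l.add a b)))
                (KG.[x+u]-[y+v]≈[x-y]+[u-v] (r a) (lift₁ (r̄ a)) (r b) (lift₁ (r̄ b)))
            ; scal = λ c a → T.trans (T.+-cong (scal c a) (T.-‿cong (l.scal c a)))
                (T.sym (KL.*ₗ-sub c (r a) (lift₁ (r̄ a))))
            }

          q-continuous : Continuous A.topology T.topology q
          q-continuous = linear-continuous (IsSTRing.isLinear A-ST) (IsSTRing.isLinear K-ST) q-linear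
            λ U U-open U-sub → LinearTopology.submodule-open k NA A.topology (IsSTRing.isLinear A-ST)
              (LinearMap.preimage q-linear U-sub)
              (τA.Open-∩ (continuous U U-open) (r̄-continuous _ (lift₁-continuous U U-open)))
              (IsSubmodule.has0 (LinearMap.preimage linear U-sub) , IsSubmodule.has0
                (LinearMap.preimage lift₁r̄-linear U-sub))
              (λ (p , p′) → submodule-sub {M = NK} U-sub p p′)

        next : IntegralMap r′
        next = record
          { integral = λ a → v≥-π⁻¹* (lift₁-splits (r̄ a))
          ; linear = record
            { cong = λ e → T.*-congˡ (LinearMap.cong q-linear e)
            ; add = λ a b → T.trans (T.*-congˡ (LinearMap.add q-linear a b)) (T.distribˡ π⁻¹ (q a) (q b))
            ; scal = λ c a → T.trans (T.*-congˡ (LinearMap.scal q-linear c a))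
                (T.trans (T.sym (T.*-assoc π⁻¹ (T.ι c) (q a)))
                (T.trans (T.*-congʳ (T.*-comm π⁻¹ (T.ι c))) (T.*-assoc (T.ι c) π⁻¹ (q a))))
            }
          ; continuous = λ V V-open → q-continuous _ (IsSTRing.*-continuous K-ST π⁻¹ V V-open)
          }

        expand : ∀ a m → lift₁ (r̄ a) T.* m T.+ r′ a T.* (π T.* m) T.≈ r a T.* m
        expand a m = begin
          lift₁ (r̄ a) T.* m T.+ π⁻¹ T.* q a T.* (π T.* m) ≈⟨ T.+-congˡ (T.*-assoc _ π m) ⟨
          lift₁ (r̄ a) T.* m T.+ π⁻¹ T.* q a T.* π T.* m   ≈⟨ T.+-congˡ (T.*-congʳ eq) ⟩
          lift₁ (r̄ a) T.* m T.+ q a T.* m                 ≈⟨ T.distribʳ m _ _ ⟨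
          (lift₁ (r̄ a) T.+ q a) T.* m                     ≈⟨ T.*-congʳ (KG.x+[y-x]≈y (lift₁ (r̄ a)) (r a)) ⟩
          r a T.* m                                       ∎
          where
          open SetoidReasoning T.setoid
          eq : π⁻¹ T.* q a T.* π T.≈ q a
          eq = begin
            π⁻¹ T.* q a T.* π   ≈⟨ T.*-comm _ π ⟩
            π T.* (π⁻¹ T.* q a) ≈⟨ T.*-assoc π π⁻¹ (q a) ⟨
            π T.* π⁻¹ T.* q a   ≈⟨ T.*-congʳ π*π⁻¹≈1 ⟩
            T.1# T.* q a        ≈⟨ T.*-identityˡ (q a) ⟩
            q a                 ∎

      module _ {U : Pred T.Carrier ℓ} (U-sub : IsSubmodule NK U)
               (slice : ∀ m → τ₁.Open (λ c → U (lift₁ c T.* m))) where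
        open IsSubmodule U-sub

        -- r = ∑ᵢ πⁱ (lift₁ ∘ r̄ᵢ) with each r̄ᵢ continuous, and πʲ m 𝒪 ⊆ U cuts the sum off at i < j.
        orbit-open : ∀ j {r} → IntegralMap r → ∀ m → (∀ {y} → v≥ (+ j) y → U (y T.* m)) →
                     τA.Open (λ a → U (r a T.* m))
        orbit-open zero    r-map m p = open-cong A.topology (λ {a} _ → p (integral a)) (λ _ → tt) τA.Open-⊤
          where open IntegralMap r-map
        orbit-open (suc j) {r} r-map m p = LinearTopology.submodule-open k NA A.topology (IsSTRing.isLinear A-ST)
          (LinearMap.preimage r*m-linear U-sub)
          (τA.Open-∩ (r̄-continuous _ (slice m)) (orbit-open j next (π T.* m) λ {y} q →
            resp (T.*-assoc y π m) (p (≡.subst (λ i → v≥ (+ i) (y T.* π)) (ℕ.+-comm j 1)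
              (v≥-* q v≥1-π)))))
          (resp (T.sym (T.trans (T.*-congʳ (lift₁r̄0 r-map)) (T.zeroˡ m))) has0 ,
           resp (T.sym (T.trans (T.*-congʳ (LinearMap.zer (IntegralMap.linear next)))
             (T.zeroˡ (π T.* m)))) has0)
          (λ {a} (u , u′) → resp (expand a m) (has+ u u′))
          where
          open IntegralMap r-map
          lift₁r̄0 : ∀ {r} (r-map : IntegralMap r) → lift₁ (IntegralMap.r̄ r-map A.0#) T.≈ T.0#
          lift₁r̄0 r-map = T.trans (lift₁-cong {r̄₀} {𝒪.0#}
              (RT.∼-from-≈ {r̄₀} {𝒪.0#} (LinearMap.zer (IntegralMap.linear r-map)))) lift₁.0#-homo
            where r̄₀ = IntegralMap.r̄ r-map A.0#
          r*m-linear : LinearMap NA NK (λ a → r a T.* m)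
          r*m-linear = record
            { cong = λ e → T.*-congʳ (LinearMap.cong linear e)
            ; add = λ a b → T.trans (T.*-congʳ (LinearMap.add linear a b)) (T.distribʳ m (r a) (r b))
            ; scal = λ c a → T.trans (T.*-congʳ (LinearMap.scal linear c a)) (T.*-assoc (T.ι c) (r a) m)
            }

    openCriterion : OpenCriterion
    openCriterion = record
      { open⇒ball = λ {U} U-sub U-open →
          let module U = IsSubmodule U-sub
              (N , N∈) = open⇒vanishing (LinearMap.preimage f-linear U-sub) (f-continuous U U-open) S.1#
              (N′ , g∈) = vanishing-onto N in
          N′ , λ p → let (g , g-vanishes , fg≈x) = g∈ p in
            U.resp (T.trans (⟦⟧-cong (S.*-identityʳ (embed g))) fg≈x) (N∈ g-vanishes)
      ; open⇒slice = λ {U} U-sub U-open m →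
          let module U = IsSubmodule U-sub in
          lift₁-continuous (λ x → U (x T.* m)) (open-cong T.topology
            (λ {x} → U.resp (T.*-comm m x)) (λ {x} → U.resp (T.*-comm x m))
            (IsSTRing.*-continuous K-ST m U U-open))
      ; ball∧slice⇒open = λ {U} U-sub (N , ball) slice →
          let module U = IsSubmodule U-sub in
          open-cong T.topology (λ (x , u , e) → U.resp e u)
            (λ {y} u → let (x , fx≈y) = surjective y in
              x , U.resp (T.sym (fx≈y (S.refl {x}))) u , fx≈y (S.refl {x}))
            (f-open (U ∘ f) (vanishing∧const⇒open (LinearMap.preimage f-linear U-sub)
              (λ m → let (N′ , p) = absorb em (f m) N in
                N′ , λ {g} g-vanishes → U.resp (T.sym (*-homo (embed g) m))
                  (ball (p (v≥-vanishing N′ g-vanishes))))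
              -- `j` digits are expanded: what remains is an integral multiple of `πʲ f(m)`, which
              -- already lies in the ball.
              (λ m → let (j , p) = absorb em (f m) N in
                open-cong A.topology (λ {a} → U.resp (T.sym (*-homo (embed (const a)) m)))
                  (λ {a} → U.resp (*-homo (embed (const a)) m))
                  (orbit-open U-sub slice j
                    (record { integral = λ a → into (const a) ; linear = s-linear ; continuous =
                      s-continuous })
                    (f m) (λ q → ball (p q))))))
      }

module ParametrizationOf (em : ExcludedMiddle ℓ) {k : Field ℓ} {n : ℕ}
  (T : LocalFieldData k (suc n)) (tlf : IsTLF T) where
  open IsTLF tlf
  open IsParametrization (proj₂ parametrization)

  A-isSTRing : IsSTRing k (iteratedLaurent n (coefficientField T))
  A-isSTRing = iteratedLaurent-isSTRing n (coefficientField T)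
    (discrete-isSTRing (coefficientField T) (λ V V-resp → lift V-resp))

  open Parametrization em T isSTRing {A = iteratedLaurent n (coefficientField T)} {S = standardField T}
    A-isSTRing (laurent-isLaurent (iteratedLaurent n (coefficientField T)) A-isSTRing)
    (proj₁ parametrization) isRingIso over-k continuous open-map
    (proj₁ respectsValuations) (proj₁ (proj₂ respectsValuations)) public

  -- `residue T` has by definition the same last residue field as `T`, hence the same coefficients,
  -- and its standard field is the coefficient ring `A` of the Laurent series. So `f̄` is a
  -- parametrization of it.
  residue-isTLF : IsTLF (residue T)
  residue-isTLF = record
    { finite = finite
    ; isSTRing = ResidueTopology.residue-isSTRing T isSTRing
    ; parametrization = f̄ , record
      { isRingIso = f̄-iso
      ; over-k = f̄-over-k
      ; continuous = f̄-continuous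
      ; open-map = f̄-open
      ; respectsValuations = proj₂ (proj₂ respectsValuations)
      }
    }

-- Finitely generated modules and lattices

module _ {R : Ring ℓ ℓ} (M : Mod R) where
  private module R = Ring R
  open LeftModule M
  open ModuleLemmas M

  -- Linear combinations by recursion on the list of generators, which suits inductions better than
  -- `combination`.
  Span : List Carrierᴹ → Pred Carrierᴹ ℓ
  Span []       m = m ≈ᴹ 0ᴹ
  Span (g ∷ gs) m = ∃[ a ] ∃[ m′ ] (Span gs m′ × m ≈ᴹ (a *ₗ g) +ᴹ m′)

  Span-isSubmodule : ∀ gs → IsSubmodule M (Span gs)
  Span-isSubmodule []       = 0-isSubmodule
  Span-isSubmodule (g ∷ gs) = record
    { resp = λ x≈y (a , m , p , e) → a , m , p , ≈ᴹ-trans (≈ᴹ-sym x≈y) e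
    ; has0 = R.0# , 0ᴹ , has0 , ≈ᴹ-sym (≈ᴹ-trans (+ᴹ-congʳ (*ₗ-zeroˡ g)) (+ᴹ-identityˡ 0ᴹ))
    ; has+ = λ (a , m , p , e) (b , m′ , p′ , e′) → a R.+ b , m +ᴹ m′ , has+ p p′ ,
        ≈ᴹ-trans (+ᴹ-cong e e′) (≈ᴹ-trans (interchange (a *ₗ g) m (b *ₗ g) m′)
          (+ᴹ-congʳ (≈ᴹ-sym (*ₗ-distribʳ g a b))))
    ; has* = λ c (a , m , p , e) → c R.* a , c *ₗ m , has* c p ,
        ≈ᴹ-trans (*ₗ-congˡ e) (≈ᴹ-trans (*ₗ-distribˡ c (a *ₗ g) m) (+ᴹ-congʳ (≈ᴹ-sym (*ₗ-assoc c a g))))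
    }
    where open IsSubmodule (Span-isSubmodule gs)

  Span-tail : ∀ {g gs m} → Span gs m → Span (g ∷ gs) m
  Span-tail {g} {m = m} p = R.0# , m , p , ≈ᴹ-sym (≈ᴹ-trans (+ᴹ-congʳ (*ₗ-zeroˡ g)) (+ᴹ-identityˡ m))

  Span-head : ∀ g gs → Span (g ∷ gs) g
  Span-head g gs = R.1# , 0ᴹ , IsSubmodule.has0 (Span-isSubmodule gs) ,
    ≈ᴹ-sym (≈ᴹ-trans (+ᴹ-identityʳ (R.1# *ₗ g)) (*ₗ-identityˡ g))

  Span-generators : ∀ gs → All (Span gs) gs
  Span-generators []       = []
  Span-generators (g ∷ gs) = Span-head g gs ∷ All.map (λ {m} → Span-tail {g} {gs} {m})
      (Span-generators gs)

  Span-⊆ : ∀ {L} → IsSubmodule M L → ∀ {gs} → All L gs → Span gs ⊆ L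
  Span-⊆ L-sub {[]}     []       m≈0             = resp (≈ᴹ-sym m≈0) has0
    where open IsSubmodule L-sub
  Span-⊆ L-sub {g ∷ gs} (p ∷ ps) (a , m′ , q , e) = resp (≈ᴹ-sym e) (has+ (has* a p) (Span-⊆ L-sub ps q))
    where open IsSubmodule L-sub

  Span-combination : ∀ {r} (a : Fin r → R.Carrier) (g : Fin r → Carrierᴹ) →
                     Span (List.tabulate g) (combination M a g)
  Span-combination {zero}  a g = ≈ᴹ-refl
  Span-combination {suc r} a g =
    a fzero , combination M (a ∘ fsuc) (g ∘ fsuc) , Span-combination (a ∘ fsuc) (g ∘ fsuc) , ≈ᴹ-refl

  combination-Span : ∀ gs {m} → Span gs m → ∃[ a ] (m ≈ᴹ combination M a (List.lookup gs))
  combination-Span []       m≈0 = (λ ()) , m≈0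
  combination-Span (g ∷ gs) (a , m′ , p , e) =
    let (b , e′) = combination-Span gs p in
    (λ { fzero → a ; (fsuc i) → b i }) , ≈ᴹ-trans e (+ᴹ-congˡ e′)

  finitelyGenerated⇒Span : IsFinitelyGenerated M → ∃[ gs ] (∀ m → Span gs m)
  finitelyGenerated⇒Span (r , g , gen) = List.tabulate g , λ m →
    let (a , e) = gen m in
    IsSubmodule.resp (Span-isSubmodule (List.tabulate g)) (≈ᴹ-sym e) (Span-combination a g)

  Span⇒finitelyGenerated : ∃[ gs ] (∀ m → Span gs m) → IsFinitelyGenerated M
  Span⇒finitelyGenerated (gs , gen) = List.length gs , List.lookup gs , λ m → combination-Span gs (gen m)

-- Lattices and expansions along a uniformizer

module UniformizerPowers {K : Field ℓ} (V : DiscreteValuation K) where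
  open Field K
  open DiscreteValuation V
  open ValuationLemmas V
  open ExpProperties semiring using (_^_)

  v≥-π^ : ∀ N → v≥ (+ N) (π ^ N)
  v≥-π^ zero    = v≥0-1
  v≥-π^ (suc N) = v≥-* v≥1-π (v≥-π^ N)

  π⁻¹^*π^≈1 : ∀ N → π⁻¹ ^ N * π ^ N ≈ 1#
  π⁻¹^*π^≈1 zero    = *-identityˡ 1#
  π⁻¹^*π^≈1 (suc N) = begin
    (π⁻¹ * π⁻¹ ^ N) * (π * π ^ N) ≈⟨ *-interchange π⁻¹ (π⁻¹ ^ N) π (π ^ N) ⟩
    (π⁻¹ * π) * (π⁻¹ ^ N * π ^ N) ≈⟨ *-cong π⁻¹*π≈1 (π⁻¹^*π^≈1 N) ⟩
    1# * 1#                       ≈⟨ *-identityˡ 1# ⟩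
    1#                            ∎
    where
    open SetoidReasoning setoid
    open CommutativeSemigroupProperties *-commutativeSemigroup renaming (interchange to *-interchange)

module LatticeLemmas (em : ExcludedMiddle ℓ) {k : Field ℓ} {n : ℕ} (T : LocalFieldData k (suc n)) where
  private
    module T = LocalFieldData T
  open FirstValuation T hiding (residue; surjective)
  open ValuationLemmas valuation
  open UniformizerPowers valuation
  open ExpProperties T.semiring using (_^_)

  module _ (M : Mod T.ring) where
    open LeftModule M

    -- For an `𝒪`-submodule this says `K U = M`. It also makes sense for `k`-submodules, where it is
    -- the half of the openness criterion that concerns balls.
    Absorbing : Pred (Pred Carrierᴹ ℓ) ℓ
    Absorbing U = ∀ m → ∃[ N ] (∀ {a} → v≥ (+ N) a → U (a *ₗ m))

    common-bound : ∀ {U} → Absorbing U → ∀ ms → ∃[ N ] All (λ m → ∀ {a} → v≥ (+ N) a → U (a *ₗ m)) ms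
    common-bound         U-abs []       = 0 , []
    common-bound {U = U} U-abs (m ∷ ms) =
      let (N , p) = U-abs m
          (N′ , ps) = common-bound {U} U-abs ms in
      N ℕ.⊔ N′ , (λ q → p (v≥-mono (ℤ.+≤+ (ℕ.m≤m⊔n N N′)) q)) ∷
        All.map (λ p′ {a} q → p′ {a} (v≥-mono (ℤ.+≤+ (ℕ.m≤n⊔m N N′)) q)) ps

    combination-absorbed : ∀ {L} → IsSubmodule (over𝒪 T M) L →
      ∀ {r} (c : Fin r → T.Carrier) (l : Fin r → Carrierᴹ) → (∀ i → L (l i)) →
      ∃[ N ] (∀ {a} → v≥ (+ N) a → L (a *ₗ combination M c l))
    combination-absorbed L-sub {zero} c l l∈L = 0 , λ {a} _ → resp (≈ᴹ-sym (*ₗ-zeroʳ a)) has0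
      where open IsSubmodule L-sub
    combination-absorbed L-sub {suc r} c l l∈L =
      let (N , p) = absorb em (c fzero) 0
          (N′ , p′) = combination-absorbed L-sub (c ∘ fsuc) (l ∘ fsuc) (l∈L ∘ fsuc) in
      N ℕ.⊔ N′ , λ {a} q → resp
        (≈ᴹ-trans (+ᴹ-congʳ (*ₗ-assoc a (c fzero) (l fzero)))
          (≈ᴹ-sym (*ₗ-distribˡ a (c fzero *ₗ l fzero) (combination M (c ∘ fsuc) (l ∘ fsuc)))))
        (has+ (has* (a T.* c fzero , p (v≥-mono (ℤ.+≤+ (ℕ.m≤m⊔n N N′)) q)) (l∈L fzero))
              (p′ (v≥-mono (ℤ.+≤+ (ℕ.m≤n⊔m N N′)) q)))
      where open IsSubmodule L-sub

    lattice-absorbing : (L : Lattice T M) → Absorbing (Lattice.member L)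
    lattice-absorbing L m =
      let (_ , c , l , l∈L , e) = spans m
          (N , p) = combination-absorbed isSubmodule c l l∈L in
      N , λ q → resp (*ₗ-congˡ (≈ᴹ-sym e)) (p q)
      where open Lattice L hiding (L)

    lattice-generators : (L : Lattice T M) → ∃[ gs ] (All (Lattice.member L) gs ×
                         (∀ {m} → Lattice.member L m → Span (over𝒪 T M) gs m))
    lattice-generators L =
      let (r , g , gen) = finite in
      List.tabulate (proj₁ ∘ g) , tabulate⁺ (proj₂ ∘ g) , λ {m} p →
        let (a , e) = gen (m , p) in
        IsSubmodule.resp (Span-isSubmodule (over𝒪 T M) (List.tabulate (proj₁ ∘ g))) (≈ᴹ-sym e) (span a g)
      where
      open Lattice L hiding (L)
      span : ∀ {r} (a : Fin r → 𝒪.Carrier) (g : Fin r → Σ Carrierᴹ member) →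
             Span (over𝒪 T M) (List.tabulate (proj₁ ∘ g))
               (proj₁ (combination (submodule (Lattice.L L)) a g))
      span {zero}  a g = ≈ᴹ-refl
      span {suc r} a g = a fzero , proj₁ (combination (submodule (Lattice.L L)) (a ∘ fsuc) (g ∘ fsuc)) ,
        span (a ∘ fsuc) (g ∘ fsuc) , ≈ᴹ-refl

    spanLattice : ∀ gs → Absorbing (Span (over𝒪 T M) gs) → Lattice T M
    spanLattice gs abs = record
      { L = record { member = Span (over𝒪 T M) gs ; isSubmodule = Span-isSubmodule (over𝒪 T M) gs }
      ; finite = List.length gs , generator , λ (m , p) → coefficients gs
          (Span-generators (over𝒪 T M) gs) p
      ; spans = λ m →
          let (N , p) = abs m in
          1 , (λ _ → π⁻¹ ^ N) , (λ _ → π ^ N *ₗ m) , (λ _ → p (v≥-π^ N)) ,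
          ≈ᴹ-sym (≈ᴹ-trans (+ᴹ-identityʳ _) (≈ᴹ-trans (≈ᴹ-sym (*ₗ-assoc (π⁻¹ ^ N) (π ^ N) m))
            (≈ᴹ-trans (*ₗ-congʳ (π⁻¹^*π^≈1 N)) (*ₗ-identityˡ m))))
      }
      where
      L : Submodule (over𝒪 T M)
      L = record { member = Span (over𝒪 T M) gs ; isSubmodule = Span-isSubmodule (over𝒪 T M) gs }
      pick : ∀ hs → All (Span (over𝒪 T M) gs) hs → Fin (List.length hs) → Σ Carrierᴹ
          (Span (over𝒪 T M) gs)
      pick (h ∷ hs) (p ∷ ps) fzero    = h , p
      pick (h ∷ hs) (p ∷ ps) (fsuc i) = pick hs ps i
      generator : Fin (List.length gs) → Σ Carrierᴹ (Span (over𝒪 T M) gs)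
      generator = pick gs (Span-generators (over𝒪 T M) gs)
      coefficients : ∀ hs (ps : All (Span (over𝒪 T M) gs) hs) {m} → Span (over𝒪 T M) hs m →
                     ∃[ a ] (m ≈ᴹ proj₁ (combination (submodule L) a (pick hs ps)))
      coefficients []       []       m≈0              = (λ ()) , m≈0
      coefficients (h ∷ hs) (p ∷ ps) (a , m′ , q , e) =
        let (b , e′) = coefficients hs ps q in
        (λ { fzero → a ; (fsuc i) → b i }) , ≈ᴹ-trans e (+ᴹ-congˡ e′)

    Span-absorbing : ∀ gs → (∀ m → Span M gs m) → Absorbing (Span (over𝒪 T M) gs)
    Span-absorbing gs gen m = go gs (gen m)
      where
      go : ∀ hs {m} → Span M hs m → ∃[ N ] (∀ {a} → v≥ (+ N) a → Span (over𝒪 T M) hs (a *ₗ m))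
      go []       m≈0 = 0 , λ {a} _ → ≈ᴹ-trans (*ₗ-congˡ m≈0) (*ₗ-zeroʳ a)
      go (h ∷ hs) (c , m′ , q , e) =
        let (N , p) = absorb em c 0
            (N′ , p′) = go hs q in
        N ℕ.⊔ N′ , λ {a} va →
          (a T.* c , p (v≥-mono (ℤ.+≤+ (ℕ.m≤m⊔n N N′)) va)) , a *ₗ m′ , p′
            (v≥-mono (ℤ.+≤+ (ℕ.m≤n⊔m N N′)) va) ,
          ≈ᴹ-trans (*ₗ-congˡ e) (≈ᴹ-trans (*ₗ-distribˡ a (c *ₗ h) m′)
            (+ᴹ-congʳ (≈ᴹ-sym (*ₗ-assoc a c h))))

    Absorbing-⊆ : ∀ U V → U ⊆ V → Absorbing U → Absorbing V
    Absorbing-⊆ U V U⊆V U-abs m = let (N , p) = U-abs m in N , λ q → U⊆V (p q)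

    extendLattice : (L : Lattice T M) → ∀ x → ∃[ L′ ]
        (Lattice.member L ⊆ Lattice.member {M = M} L′ × Lattice.member L′ x)
    extendLattice L x =
      let (gs , gs∈L , gen) = lattice-generators L
          L⊆ : Lattice.member L ⊆ Span (over𝒪 T M) (x ∷ gs)
          L⊆ p = Span-⊆ (over𝒪 T M) (Span-isSubmodule (over𝒪 T M) (x ∷ gs))
            (All.tail (Span-generators (over𝒪 T M) (x ∷ gs))) (gen p) in
      spanLattice (x ∷ gs) (Absorbing-⊆ (Lattice.member L) (Span (over𝒪 T M) (x ∷ gs)) L⊆
        (lattice-absorbing L)) ,
      L⊆ , Span-head (over𝒪 T M) x gs

    scaled-absorbing : ∀ {L} → IsSubmodule (over𝒪 T M) L → Absorbing L → ∀ N →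
                       Absorbing (λ m → ∃[ x ] (L x × m ≈ᴹ π ^ N *ₗ x))
    scaled-absorbing {L} L-sub L-abs N m =
      let (N′ , p) = L-abs (π⁻¹ ^ N *ₗ m) in
      N′ , λ {a} va → a *ₗ (π⁻¹ ^ N *ₗ m) , p va , (begin
        a *ₗ m                              ≈⟨ *ₗ-identityˡ (a *ₗ m) ⟨
        T.1# *ₗ (a *ₗ m)                    ≈⟨ *ₗ-congʳ (π⁻¹^*π^≈1 N) ⟨
        (π⁻¹ ^ N T.* π ^ N) *ₗ (a *ₗ m)     ≈⟨ *ₗ-congʳ (T.*-comm (π⁻¹ ^ N) (π ^ N)) ⟩
        (π ^ N T.* π⁻¹ ^ N) *ₗ (a *ₗ m)     ≈⟨ *ₗ-assoc (π ^ N) (π⁻¹ ^ N) (a *ₗ m) ⟩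
        π ^ N *ₗ (π⁻¹ ^ N *ₗ (a *ₗ m))      ≈⟨ *ₗ-congˡ (*ₗ-assoc (π⁻¹ ^ N) a m) ⟨
        π ^ N *ₗ ((π⁻¹ ^ N T.* a) *ₗ m)     ≈⟨ *ₗ-congˡ (*ₗ-congʳ (T.*-comm (π⁻¹ ^ N) a)) ⟩
        π ^ N *ₗ ((a T.* π⁻¹ ^ N) *ₗ m)     ≈⟨ *ₗ-congˡ (*ₗ-assoc a (π⁻¹ ^ N) m) ⟩
        π ^ N *ₗ (a *ₗ (π⁻¹ ^ N *ₗ m))      ∎)
      where open SetoidReasoning ≈ᴹ-setoid

    -- Stated for any restriction of scalars, because it is applied over `𝒪` and, through `lift₁`,
    -- over `k₁`.
    Span-scaled : ∀ {R} {h : Ring.Carrier R → T.Carrier} (h-hom : IsRingHom R T.ring h) c gs {x} →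
                  Span (restrict R T.ring h-hom M) gs x →
                  Span (restrict R T.ring h-hom M) (List.map (c *ₗ_) gs) (c *ₗ x)
    Span-scaled         h-hom c []       x≈0              = ≈ᴹ-trans (*ₗ-congˡ x≈0) (*ₗ-zeroʳ c)
    Span-scaled {h = h} h-hom c (g ∷ gs) (a , m′ , p , e) = a , c *ₗ m′ , Span-scaled h-hom c gs p ,
      ≈ᴹ-trans (*ₗ-congˡ e) (≈ᴹ-trans (*ₗ-distribˡ c (h a *ₗ g) m′) (+ᴹ-congʳ
        (≈ᴹ-trans (≈ᴹ-sym (*ₗ-assoc c (h a) g))
          (≈ᴹ-trans (*ₗ-congʳ (T.*-comm c (h a))) (*ₗ-assoc (h a) c g)))))

    Span-scaled⁻ : ∀ c gs {x} → Span (over𝒪 T M) (List.map (c *ₗ_) gs) x →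
                   ∃[ y ] (Span (over𝒪 T M) gs y × x ≈ᴹ c *ₗ y)
    Span-scaled⁻ c []       x≈0              = 0ᴹ , ≈ᴹ-refl , ≈ᴹ-trans x≈0 (≈ᴹ-sym (*ₗ-zeroʳ c))
    Span-scaled⁻ c (g ∷ gs) (a , m′ , p , e) =
      let (y , q , e′) = Span-scaled⁻ c gs p in
      (proj₁ a *ₗ g) +ᴹ y , (a , y , q , ≈ᴹ-refl) ,
      ≈ᴹ-trans e (≈ᴹ-trans (+ᴹ-cong (≈ᴹ-trans (≈ᴹ-sym (*ₗ-assoc (proj₁ a) c g))
        (≈ᴹ-trans (*ₗ-congʳ (T.*-comm (proj₁ a) c)) (*ₗ-assoc c (proj₁ a) g))) e′)
        (≈ᴹ-sym (*ₗ-distribˡ c (proj₁ a *ₗ g) y)))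

    scaleLattice : ∀ N (L : Lattice T M) → ∃[ L′ ] (∀ {m} → Lattice.member {M = M} L′ m →
                   ∃[ x ] (Lattice.member L x × m ≈ᴹ π ^ N *ₗ x))
    scaleLattice N L =
      let (gs , gs∈L , gen) = lattice-generators L in
      spanLattice (List.map (π ^ N *ₗ_) gs)
        (Absorbing-⊆ (λ m → ∃[ x ] (Lattice.member L x × m ≈ᴹ π ^ N *ₗ x))
          (Span (over𝒪 T M) (List.map (π ^ N *ₗ_) gs))
          (λ (x , p , e) → IsSubmodule.resp
            (Span-isSubmodule (over𝒪 T M) (List.map (π ^ N *ₗ_) gs)) (≈ᴹ-sym e)
            (Span-scaled 𝒪-incl-hom (π ^ N) gs (gen p)))
          (scaled-absorbing (Lattice.isSubmodule L) (lattice-absorbing L) N)) ,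
      λ p → let (y , q , e) = Span-scaled⁻ (π ^ N) gs p in
        y , Span-⊆ (over𝒪 T M) (Lattice.isSubmodule L) gs∈L q , e

module LiftingModules (em : ExcludedMiddle ℓ) {k : Field ℓ} {n : ℕ}
  (T : LocalFieldData k (suc n)) (σ₁ : Lifting T) where
  private
    module T = LocalFieldData T
  open FirstValuation T hiding (residue; surjective)
  open ValuationLemmas valuation
  open UniformizerPowers valuation
  open ExpProperties T.semiring using (_^_)
  open LiftingLemmas T σ₁
  open LatticeLemmas em T
  open Lifting σ₁ using (rest)

  -- The lifting splits the residue map, so `a - σ₁(a)` lies in `𝔪` and can be divided by `π`.
  𝒪-expand : ∀ a → ∃[ a′ ] (proj₁ a T.≈ lift₁ a T.+ π T.* proj₁ {B = v≥ (+ 0)} a′)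
  𝒪-expand a = (π⁻¹ T.* q , v≥-π⁻¹* (lift₁-splits a)) , (begin
    proj₁ a                        ≈⟨ x+[y-x]≈y (lift₁ a) (proj₁ a) ⟨
    lift₁ a T.+ q                  ≈⟨ T.+-congˡ (T.*-identityˡ q) ⟨
    lift₁ a T.+ T.1# T.* q         ≈⟨ T.+-congˡ (T.*-congʳ π*π⁻¹≈1) ⟨
    lift₁ a T.+ π T.* π⁻¹ T.* q    ≈⟨ T.+-congˡ (T.*-assoc π π⁻¹ q) ⟩
    lift₁ a T.+ π T.* (π⁻¹ T.* q)  ∎)
    where
    open SetoidReasoning T.setoid
    open GroupLemmas T.+-abelianGroup
    q = proj₁ a T.- lift₁ a

  module _ (M : Mod T.ring) where
    open LeftModule M
    private module ML = ModuleLemmas M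

    overk₁ : Mod k₁.ring
    overk₁ = restrict k₁.ring T.ring lift₁-hom M

    private
      over𝒪M = over𝒪 T M

    𝒪⇒k₁-isSubmodule : ∀ {L} → IsSubmodule over𝒪M L → IsSubmodule overk₁ L
    𝒪⇒k₁-isSubmodule L-sub = record
      { resp = resp ; has0 = has0 ; has+ = has+ ; has* = λ c p → has* (lift₁ c , lift₁-integral c) p }
      where open IsSubmodule L-sub

    Span-expand : ∀ gs {x} → Span over𝒪M gs x →
      ∃[ y ] ∃[ x′ ] (Span overk₁ gs y × Span over𝒪M gs x′ × x ≈ᴹ y +ᴹ (π *ₗ x′))
    Span-expand []       x≈0              = 0ᴹ , 0ᴹ , ≈ᴹ-refl , ≈ᴹ-refl ,
      ≈ᴹ-trans x≈0 (≈ᴹ-sym (≈ᴹ-trans (+ᴹ-identityˡ (π *ₗ 0ᴹ)) (*ₗ-zeroʳ π)))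
    Span-expand (g ∷ gs) (a , m , p , e) =
      let (a′ , a≈) = 𝒪-expand a
          (y , x′ , q , q′ , e′) = Span-expand gs p in
      (lift₁ a *ₗ g) +ᴹ y , (proj₁ a′ *ₗ g) +ᴹ x′ ,
      (a , y , q , ≈ᴹ-refl) , (a′ , x′ , q′ , ≈ᴹ-refl) ,
      ≈ᴹ-trans e (≈ᴹ-trans (+ᴹ-cong
          (≈ᴹ-trans (*ₗ-congʳ a≈) (≈ᴹ-trans (*ₗ-distribʳ g (lift₁ a) (π T.* proj₁ a′))
            (+ᴹ-congˡ (*ₗ-assoc π (proj₁ a′) g))))
          e′)
        (≈ᴹ-trans (ML.interchange (lift₁ a *ₗ g) (π *ₗ (proj₁ a′ *ₗ g)) y (π *ₗ x′))
          (+ᴹ-congˡ (≈ᴹ-sym (*ₗ-distribˡ π (proj₁ a′ *ₗ g) x′)))))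

    -- The vectors `πⁱ g` with `i < N`. Over `k₁` they span the `𝒪`-span of `gs` modulo `πᴺ`.
    layers : ℕ → List Carrierᴹ → List Carrierᴹ
    layers zero    gs = []
    layers (suc N) gs = gs ++ List.map (π *ₗ_) (layers N gs)

    layers-⊆ : ∀ {L} → IsSubmodule over𝒪M L → ∀ N {gs} → All L gs → All L (layers N gs)
    layers-⊆ L-sub zero    ps = []
    layers-⊆ L-sub (suc N) ps =
      ++⁺ ps (map⁺ (All.map (IsSubmodule.has* L-sub (π , v≥0-π)) (layers-⊆ L-sub N ps)))

    layers-span : ∀ N gs {x} → Span over𝒪M gs x →
      ∃[ y ] ∃[ x′ ] (Span overk₁ (layers N gs) y × Span over𝒪M gs x′ × x ≈ᴹ y +ᴹ (π ^ N *ₗ x′))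
    layers-span zero    gs {x} p = 0ᴹ , x , ≈ᴹ-refl , p ,
      ≈ᴹ-sym (≈ᴹ-trans (+ᴹ-identityˡ _) (*ₗ-identityˡ x))
    layers-span (suc N) gs {x} p =
      let (y₀ , x₀ , q , p₀ , e) = Span-expand gs p
          (y₁ , x₁ , q₁ , p₁ , e₁) = layers-span N gs p₀ in
      y₀ +ᴹ (π *ₗ y₁) , x₁ ,
      IsSubmodule.has+ sub
        (Span-⊆ overk₁ sub (++⁻ˡ gs generators) q)
        (Span-⊆ overk₁ sub (++⁻ʳ gs generators) (Span-scaled M lift₁-hom π (layers N gs) q₁)) ,
      p₁ ,
      (begin
        x                                              ≈⟨ e ⟩
        y₀ +ᴹ (π *ₗ x₀)                                ≈⟨ +ᴹ-congˡ (*ₗ-congˡ e₁) ⟩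
        y₀ +ᴹ (π *ₗ (y₁ +ᴹ (π ^ N *ₗ x₁)))             ≈⟨ +ᴹ-congˡ (*ₗ-distribˡ π y₁ (π ^ N *ₗ x₁)) ⟩
        y₀ +ᴹ ((π *ₗ y₁) +ᴹ (π *ₗ (π ^ N *ₗ x₁)))      ≈⟨ +ᴹ-assoc _ _ _ ⟨
        (y₀ +ᴹ (π *ₗ y₁)) +ᴹ (π *ₗ (π ^ N *ₗ x₁))      ≈⟨ +ᴹ-congˡ (*ₗ-assoc π (π ^ N) x₁) ⟨
        (y₀ +ᴹ (π *ₗ y₁)) +ᴹ (π ^ suc N *ₗ x₁)         ∎)
      where
      open SetoidReasoning ≈ᴹ-setoid
      sub = Span-isSubmodule overk₁ (layers (suc N) gs)
      generators = Span-generators overk₁ (layers (suc N) gs)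

    scaled-isSubmodule : ∀ (L : Lattice T M) N → IsSubmodule over𝒪M (λ x → Lattice.member L (π ^ N *ₗ x))
    scaled-isSubmodule L N = record
      { resp = λ e → L.resp (*ₗ-congˡ e)
      ; has0 = L.resp (≈ᴹ-sym (*ₗ-zeroʳ (π ^ N))) L.has0
      ; has+ = λ p q → L.resp (≈ᴹ-sym (*ₗ-distribˡ (π ^ N) _ _)) (L.has+ p q)
      ; has* = λ a {x} p → L.resp (≈ᴹ-trans (≈ᴹ-sym (*ₗ-assoc (proj₁ a) (π ^ N) x))
          (≈ᴹ-trans (*ₗ-congʳ (T.*-comm (proj₁ a) (π ^ N))) (*ₗ-assoc (π ^ N) (proj₁ a) x))) (L.has* a p)
      }
      where module L = Lattice L

    module _ (L L′ : Lattice T M) where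
      private
        module L = Lattice L
        module L′ = Lattice L′
        Q = rest (L.L / L′.L)
        module Q = LeftModule Q

      withMembership : ∀ {gs} → All L.member gs → List Q.Carrierᴹ
      withMembership {[]}     []       = []
      withMembership {g ∷ gs} (p ∷ ps) = (g , p) ∷ withMembership ps

      -- Elements of `Q` carry their membership in `L`. The generators are therefore subtracted from
      -- `x` one at a time: the remainder `x - σ₁(a) g` is in `L`, whereas nothing is known about
      -- the partial sum `m`.
      quotient-span : ∀ {gs} (ps : All L.member gs) {x} (p : L.member x) {y} →
        Span overk₁ gs y → L′.member (x +ᴹ -ᴹ y) → Span Q (withMembership ps) (x , p)
      quotient-span {[]}     []       {x} p {y} y≈0 q = L′.resp (+ᴹ-congˡ (-ᴹ‿cong y≈0)) q
      quotient-span {g ∷ gs} (p₀ ∷ ps) {x} p {y} (a , m , s , e) q =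
        a , (x +ᴹ -ᴹ (lift₁ a *ₗ g) , r) ,
        quotient-span ps r s (L′.resp (≈ᴹ-trans (+ᴹ-congˡ (-ᴹ‿cong e)) (≈ᴹ-trans
          (+ᴹ-congˡ (≈ᴹ-sym (ML.⁻¹-∙-comm (lift₁ a *ₗ g) m))) (≈ᴹ-sym (+ᴹ-assoc x _ _)))) q) ,
        L′.resp (≈ᴹ-sym (≈ᴹ-trans (+ᴹ-congˡ (-ᴹ‿cong (ML.x+[y-x]≈y (lift₁ a *ₗ g) x)))
          (-ᴹ‿inverseʳ x))) L′.has0
        where
        r : L.member (x +ᴹ -ᴹ (lift₁ a *ₗ g))
        r = L.has+ p (L.has- (L.has* (lift₁ a , lift₁-integral a) p₀))

      -- Some `πᴺ` sends all generators of `L` into `L′`, so `N` layers of generators suffice.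
      quotient-finitelyGenerated : IsFinitelyGenerated Q
      quotient-finitelyGenerated = Span⇒finitelyGenerated Q (
        let (gs , gs∈L , gen) = lattice-generators M L
            (N , bound) = common-bound M {L′.member} (lattice-absorbing M L′) gs
            π^N∈L′ : ∀ {x} → Span over𝒪M gs x → L′.member (π ^ N *ₗ x)
            π^N∈L′ = Span-⊆ over𝒪M (scaled-isSubmodule L′ N) (All.map (λ p → p (v≥-π^ N)) bound) in
        withMembership (layers-⊆ L.isSubmodule N gs∈L) , λ (x , p) →
          let (y , x′ , q , q′ , e) = layers-span N gs (gen p) in
          quotient-span (layers-⊆ L.isSubmodule N gs∈L) p q
            (L′.resp (≈ᴹ-sym (≈ᴹ-trans (+ᴹ-congʳ e) (ML.[x+y]-x≈y y (π ^ N *ₗ x′)))) (π^N∈L′ q′)))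

-- Beilinson–Tate operators are continuous

-- What the inductions on `n` keep of the topology once the parametrizations are forgotten: the
-- openness criterion on each floor of the tower, and a discrete field finite over `k` at the
-- bottom.
Controlled : {k : Field ℓ} {n : ℕ} (T : LocalFieldData k n) → SystemOfLiftings T → Set (lsuc ℓ)
Controlled {n = zero} T _ =
  IsFinitelyGenerated (T.overBase (regular T.ring)) ×
    (∀ V → V Respects T._≈_ → Topology.Open T.topology V)
  where module T = LocalFieldData T
Controlled {k = k} {n = suc n} T (σ₁ , σ) =
  IsSTRing k (LocalFieldData.topRing T) × LiftingLemmas.OpenCriterion T σ₁ × Controlled (residue T) σ

controlled-isSTRing : {k : Field ℓ} {n : ℕ} (T : LocalFieldData k n) (σ : SystemOfLiftings T) →
                      Controlled T σ → IsSTRing k (LocalFieldData.topRing T)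
controlled-isSTRing {n = zero}  T _ (_ , all-open) = discrete-isSTRing (LocalFieldData.topRing T) all-open
controlled-isSTRing {n = suc n} T _ (K-ST , _)     = K-ST

controlled : ExcludedMiddle ℓ → {k : Field ℓ} {n : ℕ} (T : LocalFieldData k n) → IsTLF T →
             (σ : SystemOfLiftings T) → Controlled T σ
controlled em {n = zero} T tlf _ = finite , λ V V-resp →
  open-cong T.topology (λ (x , v , e) → V-resp e v)
    (λ {y} v → let (x , fx≈y) = surjective y in x , V-resp (T.sym (fx≈y T.refl)) v , fx≈y T.refl)
    (open-map (V ∘ proj₁ parametrization) (lift λ e → V-resp (⟦⟧-cong e)))
  where
  module T = LocalFieldData T
  open IsTLF tlf
  open IsParametrization (proj₂ parametrization)
  open RingMorphisms.IsRingIsomorphism isRingIso using (surjective; ⟦⟧-cong)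
controlled em {n = suc n} T tlf (σ₁ , σ) =
  IsTLF.isSTRing tlf , openCriterion σ₁ , controlled em (residue T) residue-isTLF σ
  where open ParametrizationOf em T tlf

Fine : {k : Field ℓ} {n : ℕ} (T : LocalFieldData k n) (M : Mod (LocalFieldData.ring T)) →
       Pred (Pred (LeftModule.Carrierᴹ M) ℓ) (lsuc ℓ)
Fine T = FineSubmodule (LocalFieldData.topRing T)

-- Modules are given no topology here. For a linear map, pulling fine submodules back to fine
-- submodules expresses continuity for the fine topologies.
FineContinuous : {k : Field ℓ} {n : ℕ} (T : LocalFieldData k n) (M N : Mod (LocalFieldData.ring T)) →
                 Pred (LeftModule.Carrierᴹ M → LeftModule.Carrierᴹ N) (lsuc ℓ)
FineContinuous T M N φ = ∀ U → Fine T N U → Fine T M (U ∘ φ)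

module _ {k : Field ℓ} {n : ℕ} (T : LocalFieldData k n) where
  private module T = LocalFieldData T

  orbit-linear : (M : Mod T.ring) → ∀ m → LinearMap (T.overBase (regular T.ring)) (T.overBase M)
                                           (λ a → LeftModule._*ₗ_ M a m)
  orbit-linear M m = record
    { cong = *ₗ-congʳ ; add = λ a b → *ₗ-distribʳ m a b ; scal = λ c a → *ₗ-assoc (T.ι c) a m }
    where open LeftModule M

module FineCriterion {k : Field ℓ} {n : ℕ} (T : LocalFieldData k (suc n)) (σ₁ : Lifting T)
                     (crit : LiftingLemmas.OpenCriterion T σ₁) (M : Mod (LocalFieldData.ring T)) where
  private
    module T = LocalFieldData T
    module T₁ = LocalFieldData (residue T)
    module τ₁ = Topology T₁.topology
  open LeftModule M
  open FirstValuation T hiding (residue; surjective)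
  open LiftingLemmas T σ₁
  open OpenCriterion crit

  module _ {U : Pred Carrierᴹ ℓ} where
    fine⇒ball : Fine T M U → ∀ m → ∃[ N ] (∀ {a} → v≥ (+ N) a → U (a *ₗ m))
    fine⇒ball (U-sub , orb) m = open⇒ball (LinearMap.preimage (orbit-linear T M m) U-sub) (orb m)

    fine⇒slice : Fine T M U → ∀ m → τ₁.Open (λ c → U (lift₁ c *ₗ m))
    fine⇒slice (U-sub , orb) m = open-cong T₁.topology
      (λ {c} → U.resp (*ₗ-congʳ (T.*-identityʳ (lift₁ c))))
      (λ {c} → U.resp (*ₗ-congʳ (T.sym (T.*-identityʳ (lift₁ c)))))
      (open⇒slice (LinearMap.preimage (orbit-linear T M m) U-sub) (orb m) T.1#)
      where module U = IsSubmodule U-sub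

    -- The criterion for `K` is applied to the orbit condition `a m ∈ U`; its slice at `b` is the
    -- slice of `U` at `b m`.
    ball∧slice⇒fine : IsSubmodule (T.overBase M) U → (∀ m → ∃[ N ] (∀ {a} → v≥ (+ N) a → U (a *ₗ m))) →
                      (∀ m → τ₁.Open (λ c → U (lift₁ c *ₗ m))) → Fine T M U
    ball∧slice⇒fine U-sub ball slice = U-sub , λ m →
      ball∧slice⇒open (LinearMap.preimage (orbit-linear T M m) U-sub) (ball m) λ b →
        open-cong T₁.topology (λ {c} → U.resp (≈ᴹ-sym (*ₗ-assoc (lift₁ c) b m)))
          (λ {c} → U.resp (*ₗ-assoc (lift₁ c) b m)) (slice (b *ₗ m))
      where module U = IsSubmodule U-sub

BT⇒linear : {k : Field ℓ} {n : ℕ} (T : LocalFieldData k n) (σ : SystemOfLiftings T)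
            (M N : Mod (LocalFieldData.ring T)) {φ : LeftModule.Carrierᴹ M → LeftModule.Carrierᴹ N} →
            BT T σ M N φ → LinearMap (LocalFieldData.overBase T M) (LocalFieldData.overBase T N) φ
BT⇒linear {n = zero}  T σ M N (lift φ-lin)     = toLinearMap _ _ φ-lin
BT⇒linear {n = suc n} T σ M N (lift φ-lin , _) = toLinearMap _ _ φ-lin

module _ (em : ExcludedMiddle ℓ) {k : Field ℓ} where
  BT⇒fineContinuous : ∀ {n} (T : LocalFieldData k n) (σ : SystemOfLiftings T) → Controlled T σ →
    (M N : Mod (LocalFieldData.ring T)) → IsFinitelyGenerated M → IsFinitelyGenerated N →
    ∀ {φ} → BT T σ M N φ → FineContinuous T M N φ
  BT⇒fineContinuous {zero} T σ (_ , all-open) M N M-fg N-fg φ-BT U U-fine =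
    LinearMap.preimage φ-lin (proj₁ U-fine) ,
    λ m → all-open _ (IsSubmodule.resp (LinearMap.preimage (orbit-linear T M m) (LinearMap.preimage φ-lin (proj₁ U-fine))))
    where φ-lin = BT⇒linear T σ M N φ-BT
  BT⇒fineContinuous {suc n} T (σ₁ , σ)
    (K-ST , crit , ctrl) M N M-fg N-fg {φ} φ-BT@(_ , refine , induced-BT) U U-fine =
    FM.ball∧slice⇒fine {U ∘ φ} (LinearMap.preimage φ-lin U-sub)
      -- Balls: `L₁′` absorbs `m`, and `φ(L₁′) ⊆ L₂ ⊆ U`.
      (λ m →
        let (L₁ , m∈L₁) = containing m
            (L₁′ , L₂′ , r) = refine L₁ L₂
            (J , p) = lattice-absorbing M L₁′ m in
        J , λ q → L₂⊆U (Refines.φL₁′⊆L₂ r (p q)))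
      -- Slices: as `m ∈ L₁`, the condition `φ(σ₁(c) m) ∈ U` on `c` is an orbit condition at the
      -- class of `m` for the induced map, which the induction settles one dimension lower.
      (λ m →
        let (L₁ , m∈L₁) = containing m
            (L₁′ , L₂′ , r) = refine L₁ L₂ in
        proj₂ (BT⇒fineContinuous (residue T) σ ctrl
          (rest (Lattice.L L₁ / Lattice.L L₁′)) (rest (Lattice.L L₂′ / Lattice.L L₂))
          (quotient-finitelyGenerated M L₁ L₁′) (quotient-finitelyGenerated N L₂′ L₂)
          (induced-BT r) (U ∘ proj₁) (quotient-fine L₂′)) (m , m∈L₁))
    where
    module T = LocalFieldData T
    module N = LeftModule N
    module NL = ModuleLemmas N
    module U = IsSubmodule (proj₁ U-fine)
    open FirstValuation T hiding (residue; surjective)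
    open UniformizerPowers valuation
    open ValuationLemmas valuation
    open ExpProperties T.semiring using (_^_)
    open LiftingLemmas T σ₁
    open LatticeLemmas em T
    open LiftingModules em T σ₁
    open Lifting σ₁ using (rest; over-k)
    module FM = FineCriterion T σ₁ crit M
    module FN = FineCriterion T σ₁ crit N
    U-sub = proj₁ U-fine
    φ-lin = BT⇒linear T (σ₁ , σ) M N φ-BT

    containing : ∀ m → Σ[ L ∈ Lattice T M ] Lattice.member L m
    containing m =
      let (gs , gen) = finitelyGenerated⇒Span M M-fg
          all = λ x → Span-⊆ M (Span-isSubmodule M (m ∷ gs))
              (++⁻ʳ (m ∷ []) (Span-generators M (m ∷ gs))) (gen x) in
      spanLattice M (m ∷ gs) (Span-absorbing M (m ∷ gs) all) , Span-head (over𝒪 T M) m gs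

    inside : Σ[ L ∈ Lattice T N ] (Lattice.member L ⊆ U)
    inside =
      let (gs , gen) = finitelyGenerated⇒Span N N-fg
          L₀ = spanLattice N gs (Span-absorbing N gs gen)
          -- One `J` serves all generators of `L₀`. Although `U` is only a `k`-submodule it contains
          -- `πᴶ L₀`, because each summand `πᴶ a g` has its coefficient in the ball.
          (J , bound) = common-bound N {U} (FN.fine⇒ball {U} U-fine) gs
          (L , L⊆) = scaleLattice N J L₀ in
      L , λ p → let (x , x∈L₀ , e) = L⊆ p in U.resp (N.≈ᴹ-sym e) (scaled⊆U J bound x∈L₀)
      where
      scaled⊆U : ∀ J {gs} → All (λ g → ∀ {a} → v≥ (+ J) a → U (a N.*ₗ g)) gs →
                 ∀ {x} → Span (over𝒪 T N) gs x → U (π ^ J N.*ₗ x)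
      scaled⊆U J {[]}     []       x≈0 = U.resp
          (N.≈ᴹ-sym (N.≈ᴹ-trans (N.*ₗ-congˡ x≈0) (N.*ₗ-zeroʳ (π ^ J)))) U.has0
      scaled⊆U J {g ∷ gs} (p ∷ ps) (a , x′ , q , e) = U.resp
        (N.≈ᴹ-sym (N.≈ᴹ-trans (N.*ₗ-congˡ e) (N.≈ᴹ-trans (N.*ₗ-distribˡ (π ^ J) (proj₁ a N.*ₗ g) x′)
          (N.+ᴹ-congʳ (N.≈ᴹ-sym (N.*ₗ-assoc (π ^ J) (proj₁ a) g))))))
        (U.has+ (p (≡.subst (λ i → v≥ i (π ^ J T.* proj₁ a)) (ℤ.+-identityʳ (+ J))
          (v≥-* (v≥-π^ J) (proj₂ a))))
          (scaled⊆U J ps q))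

    L₂ = proj₁ inside
    L₂⊆U = proj₂ inside

    -- Membership in `U` is compatible with congruence modulo `L₂` because `L₂ ⊆ U`, and its orbit
    -- conditions are slices of `U`.
    quotient-fine : ∀ (L₂′ : Lattice T N) → Fine (residue T) (rest (Lattice.L L₂′ / Lattice.L L₂))
        (U ∘ proj₁)
    quotient-fine L₂′ = record
      { resp = λ {x} {y} x∼y u → U.resp
          (N.≈ᴹ-trans (N.+ᴹ-congˡ (NL.⁻¹-anti-homo‿- (proj₁ x) (proj₁ y)))
            (NL.x+[y-x]≈y (proj₁ x) (proj₁ y)))
          (U.has+ u (U.has- (L₂⊆U x∼y)))
      ; has0 = U.has0
      ; has+ = U.has+
      ; has* = λ c {x} u → U.resp (N.*ₗ-congʳ (T.sym (over-k c))) (U.has* c u)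
      } , λ x → FN.fine⇒slice {U} U-fine (proj₁ x)

-- Extending open submodules from a k₁-subspace

regularBase : {k : Field ℓ} {n : ℕ} (T : LocalFieldData k n) → Mod (Field.ring k)
regularBase T = LocalFieldData.overBase T (regular (LocalFieldData.ring T))

module _ {k : Field ℓ} {n : ℕ} (T : LocalFieldData k n) (K-ST : IsSTRing k (LocalFieldData.topRing T)) where
  private
    module T = LocalFieldData T
    module τ = Topology T.topology

  regular-submodule-open : ∀ {U V} → IsSubmodule (regularBase T) V → τ.Open U → U T.0# → U ⊆ V → τ.Open V
  regular-submodule-open {U} {V} =
    LinearTopology.submodule-open k (regularBase T) T.topology (IsSTRing.isLinear K-ST) {U} {V}

  regular-*-continuous : ∀ a → Continuous T.topology T.topology (a T.*_)
  regular-*-continuous = IsSTRing.*-continuous K-ST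

module Extension (em : ExcludedMiddle ℓ) {k : Field ℓ} {n : ℕ} (T : LocalFieldData k (suc n)) (σ₁ : Lifting T)
                 (crit : LiftingLemmas.OpenCriterion T σ₁)
                 (k₁-ST : IsSTRing k (LocalFieldData.topRing (residue T)))
                 (M : Mod (LocalFieldData.ring T)) where
  private
    module T = LocalFieldData T
    module T₁ = LocalFieldData (residue T)
    module τ₁ = Topology T₁.topology
    Mk = T.overBase M
  open LeftModule M
  open ModuleLemmas M
  open FirstValuation T hiding (residue; surjective)
  open ValuationLemmas valuation
  open UniformizerPowers valuation
  open ExpProperties T.semiring using (_^_)
  open LiftingLemmas T σ₁
  open LatticeLemmas em T
  open LiftingModules em T σ₁
  open Lifting σ₁ using (over-k)
  private
    module lift₁ = RingMorphisms.IsRingHomomorphism lift₁-hom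
    M₁ = overk₁ M
    module M₁ = LeftModule M₁

    ι≈ : ∀ c x → T.ι c *ₗ x ≈ᴹ lift₁ (T₁.ι c) *ₗ x
    ι≈ c x = *ₗ-congʳ (T.sym (over-k c))

    orbit₁ : ∀ m → LinearMap (regularBase (residue T)) Mk (λ c → lift₁ c *ₗ m)
    orbit₁ m = record
      { cong = λ {c} {d} e → *ₗ-congʳ (lift₁-cong {c} {d} e)
      ; add = λ c d → M₁.*ₗ-distribʳ m c d
      ; scal = λ c d → ≈ᴹ-trans (M₁.*ₗ-assoc (T₁.ι c) d m) (≈ᴹ-sym (ι≈ c (lift₁ d *ₗ m)))
      }

    orbit-open : ∀ {U V} → IsSubmodule Mk U → ∀ m → τ₁.Open V → V 𝒪.0# →
                 (∀ {c} → V c → U (lift₁ c *ₗ m)) → τ₁.Open (λ c → U (lift₁ c *ₗ m))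
    orbit-open {U} {V} U-sub m = regular-submodule-open (residue T) k₁-ST
      {V} {λ c → U (lift₁ c *ₗ m)} (LinearMap.preimage (orbit₁ m) U-sub)

  k₁⇒k-isSubmodule : ∀ {W} → IsSubmodule M₁ W → IsSubmodule Mk W
  k₁⇒k-isSubmodule W-sub = record
    { resp = resp ; has0 = has0 ; has+ = has+ ; has* = λ c {x} p → resp (≈ᴹ-sym (ι≈ c x))
        (has* (T₁.ι c) p) }
    where open IsSubmodule W-sub

  multiple∈⇒0 : ∀ {W g} → IsSubmodule M₁ W → ¬ W g → ∀ {d} → W (lift₁ d *ₗ g) → d k₁.≈ 𝒪.0#
  multiple∈⇒0 {W} {g} W-sub g∉W {d} p with em {d k₁.≈ 𝒪.0#}
  ... | yes d≈0 = d≈0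
  ... | no  d≉0 =
    let (e , de≈1) = k₁.inverse d d≉0 in
    ⊥-elim (g∉W (resp
      (≈ᴹ-trans (≈ᴹ-sym (M₁.*ₗ-assoc e d g)) (≈ᴹ-trans (*ₗ-congʳ (lift₁-cong {e 𝒪.* d} {𝒪.1#}
        (k₁.trans {e 𝒪.* d} {d 𝒪.* e} {𝒪.1#} (k₁.*-comm e d) de≈1))) (M₁.*ₗ-identityˡ g)))
      (has* e p)))
    where open IsSubmodule W-sub

  private
    ⊤-isSubmodule-k₁ : IsSubmodule (regularBase (residue T)) (λ _ → ⊤)
    ⊤-isSubmodule-k₁ = ⊤-isSubmodule {M = regularBase (residue T)}

  -- The sum `O g + U`, with `O ⊆ k₁` acting through `σ₁`.
  Line+ : (k₁.Carrier → Set ℓ) → Carrierᴹ → Pred Carrierᴹ ℓ → Pred Carrierᴹ ℓ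
  Line+ O g U x = ∃[ c ] ∃[ u ] (O c × U u × x ≈ᴹ (lift₁ c *ₗ g) +ᴹ u)

  module _ {O : k₁.Carrier → Set ℓ} {g : Carrierᴹ} {U : Pred Carrierᴹ ℓ} where
    private
      line-0 : ∀ {u} → u ≈ᴹ (lift₁ 𝒪.0# *ₗ g) +ᴹ u
      line-0 {u} = ≈ᴹ-sym (≈ᴹ-trans (+ᴹ-congʳ (M₁.*ₗ-zeroˡ g)) (+ᴹ-identityˡ u))

      line-+ : ∀ {x y c d u v} → x ≈ᴹ (lift₁ c *ₗ g) +ᴹ u → y ≈ᴹ (lift₁ d *ₗ g) +ᴹ v →
               x +ᴹ y ≈ᴹ (lift₁ (c 𝒪.+ d) *ₗ g) +ᴹ (u +ᴹ v)
      line-+ {c = c} {d} {u} {v} e e′ = ≈ᴹ-trans (+ᴹ-cong e e′) (≈ᴹ-trans (interchange _ u _ v)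
        (+ᴹ-congʳ (≈ᴹ-sym (M₁.*ₗ-distribʳ g c d))))

      line-* : ∀ a {x c u} → x ≈ᴹ (lift₁ c *ₗ g) +ᴹ u →
               lift₁ a *ₗ x ≈ᴹ (lift₁ (a 𝒪.* c) *ₗ g) +ᴹ (lift₁ a *ₗ u)
      line-* a {c = c} {u} e = ≈ᴹ-trans (*ₗ-congˡ e) (≈ᴹ-trans (*ₗ-distribˡ (lift₁ a) _ u)
        (+ᴹ-congʳ (≈ᴹ-sym (M₁.*ₗ-assoc a c g))))

    Line+-isSubmodule : IsSubmodule (regularBase (residue T)) O → IsSubmodule Mk U →
        IsSubmodule Mk (Line+ O g U)
    Line+-isSubmodule O-sub U-sub = record
      { resp = λ x≈y (c , u , o , p , e) → c , u , o , p , ≈ᴹ-trans (≈ᴹ-sym x≈y) e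
      ; has0 = 𝒪.0# , 0ᴹ , O.has0 , U.has0 , line-0
      ; has+ = λ {x} {y} (c , u , o , p , e) (d , v , o′ , p′ , e′) →
          c 𝒪.+ d , u +ᴹ v , O.has+ o o′ , U.has+ p p′ , line-+ {c = c} {d} e e′
      ; has* = λ a {x} (c , u , o , p , e) → T₁.ι a 𝒪.* c , lift₁ (T₁.ι a) *ₗ u , O.has* a o ,
          U.resp (ι≈ a u) (U.has* a p) , ≈ᴹ-trans (ι≈ a x) (line-* (T₁.ι a) {c = c} e)
      }
      where
      module O = IsSubmodule O-sub
      module U = IsSubmodule U-sub

    Line+-⊇ : IsSubmodule (regularBase (residue T)) O → U ⊆ Line+ O g U
    Line+-⊇ O-sub {u} p = 𝒪.0# , u , IsSubmodule.has0 O-sub , p , line-0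

    -- The condition on `a` holds whenever `c a ∈ O` and `σ₁(a) u ∈ U`, and both of these are open.
    Line+-slice : IsSubmodule (regularBase (residue T)) O → τ₁.Open O → IsSubmodule Mk U →
      ∀ {x c u} → x ≈ᴹ (lift₁ c *ₗ g) +ᴹ u → τ₁.Open (λ a → U (lift₁ a *ₗ u)) →
      τ₁.Open (λ a → Line+ O g U (lift₁ a *ₗ x))
    Line+-slice O-sub O-open U-sub {x} {c} {u} e u-open =
      orbit-open (Line+-isSubmodule O-sub U-sub) x
        (τ₁.Open-∩ (regular-*-continuous (residue T) k₁-ST c O O-open) u-open)
        (IsSubmodule.resp O-sub {𝒪.0#} {c 𝒪.* 𝒪.0#} (k₁.sym {c 𝒪.* 𝒪.0#} {𝒪.0#} (k₁.zeroʳ c))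
          (IsSubmodule.has0 O-sub) ,
         IsSubmodule.resp U-sub (≈ᴹ-sym (M₁.*ₗ-zeroˡ u)) (IsSubmodule.has0 U-sub))
        (λ {a} (o , p) → a 𝒪.* c , lift₁ a *ₗ u ,
          IsSubmodule.resp O-sub {c 𝒪.* a} {a 𝒪.* c} (k₁.*-comm c a) o , p , line-* a {c = c} e)

  Line+-k₁-isSubmodule : ∀ {g W} → IsSubmodule M₁ W → IsSubmodule M₁ (Line+ (λ _ → ⊤) g W)
  Line+-k₁-isSubmodule {g} {W} W-sub = record
    { resp = L.resp ; has0 = L.has0 ; has+ = L.has+
    ; has* = λ a (c , u , _ , p , e) → a 𝒪.* c , lift₁ a *ₗ u , tt , has* a p ,
        ≈ᴹ-trans (*ₗ-congˡ e) (≈ᴹ-trans (*ₗ-distribˡ (lift₁ a) _ u)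
          (+ᴹ-congʳ (≈ᴹ-sym (M₁.*ₗ-assoc a c g))))
    }
    where
    open IsSubmodule W-sub
    module L = IsSubmodule (Line+-isSubmodule {g = g} ⊤-isSubmodule-k₁ (k₁⇒k-isSubmodule W-sub))

  -- A `k₁`-subspace `W` with a `k`-submodule `U` that is open for the fine `k₁`-topology of `W`. In
  -- the order `⊑` the field `U∩W⊆` keeps the trace on the smaller subspace unchanged.
  record Stage : Set (lsuc ℓ) where
    field
      W U   : Pred Carrierᴹ ℓ
      W-sub : IsSubmodule M₁ W
      U-sub : IsSubmodule Mk U
      U⊆W   : U ⊆ W
      slice : ∀ {w} → W w → τ₁.Open (λ c → U (lift₁ c *ₗ w))

  record _⊑_ (s s′ : Stage) : Set ℓ where
    private
      module s = Stage s
      module s′ = Stage s′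
    field
      W⊆   : s.W ⊆ s′.W
      U⊆   : s.U ⊆ s′.U
      U∩W⊆ : ∀ {x} → s.W x → s′.U x → s.U x
  open _⊑_

  ⊑-refl : ∀ {s} → s ⊑ s
  ⊑-refl = record { W⊆ = id ; U⊆ = id ; U∩W⊆ = λ _ → id }

  ⊑-trans : ∀ {s s′ s″} → s ⊑ s′ → s′ ⊑ s″ → s ⊑ s″
  ⊑-trans p q = record
    { W⊆ = W⊆ q ∘ W⊆ p ; U⊆ = U⊆ q ∘ U⊆ p ; U∩W⊆ = λ w u → U∩W⊆ p w (U∩W⊆ q (W⊆ p w) u) }

  adjoin : ∀ s g → ∃[ s′ ] (s ⊑ s′ × Stage.W s′ g)
  adjoin s g with em {Stage.W s g}
  ... | yes g∈W = s , ⊑-refl , g∈W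
  ... | no  g∉W =
    record
      { W = Line+ (λ _ → ⊤) g W
      ; U = Line+ (λ _ → ⊤) g U
      ; W-sub = Line+-k₁-isSubmodule W-sub
      ; U-sub = Line+-isSubmodule ⊤-isSubmodule-k₁ U-sub
      ; U⊆W = λ (c , u , _ , p , e) → c , u , tt , U⊆W p , e
      ; slice = λ (c , u , _ , u∈W , e) → Line+-slice ⊤-isSubmodule-k₁ τ₁.Open-⊤ U-sub {c = c} e (slice u∈W)
      } ,
    record
      { W⊆ = Line+-⊇ ⊤-isSubmodule-k₁
      ; U⊆ = Line+-⊇ ⊤-isSubmodule-k₁
      -- `x - u = σ₁(c) g` lies in the subspace `W`, which does not contain `g`; hence `c = 0` and
      -- `x = u`.
      ; U∩W⊆ = λ { {x} x∈W (c , u , _ , u∈U , e) → IsSubmodule.resp U-sub (≈ᴹ-sym (≈ᴹ-trans e (≈ᴹ-trans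
          (+ᴹ-congʳ (≈ᴹ-trans (*ₗ-congʳ (lift₁-cong {c} {𝒪.0#} (multiple∈⇒0 W-sub g∉W {c}
            (W.resp (≈ᴹ-trans (+ᴹ-congʳ (≈ᴹ-trans e (+ᴹ-comm _ u))) ([x+y]-x≈y u _))
              (W.has+ x∈W (W.has- (U⊆W u∈U)))))))
            (M₁.*ₗ-zeroˡ g)))
          (+ᴹ-identityˡ u)))) u∈U }
      } ,
    (𝒪.1# , 0ᴹ , tt , W.has0 , ≈ᴹ-sym (≈ᴹ-trans (+ᴹ-identityʳ _) (M₁.*ₗ-identityˡ g)))
    where
    open Stage s
    module W = IsSubmodule W-sub

  adjoinAll : ∀ s gs → ∃[ s′ ] (s ⊑ s′ × All (Stage.W s′) gs)
  adjoinAll s []       = s , ⊑-refl , []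
  adjoinAll s (g ∷ gs) =
    let (s′ , s⊑s′ , gs∈) = adjoinAll s gs
        (s″ , s′⊑s″ , g∈) = adjoin s′ g in
    s″ , ⊑-trans s⊑s′ s′⊑s″ , g∈ ∷ All.map (W⊆ s′⊑s″) gs∈

  module _ (s : Stage) (L : Lattice T M) (L⊆W : Lattice.member L ⊆ Stage.W s)
           (U-abs : Absorbing M (Stage.U s)) where
    private
      gs = proj₁ (lattice-generators M L)
      gen = proj₂ (proj₂ (lattice-generators M L))

      stage : ℕ → Stage
      stage zero    = s
      stage (suc i) = proj₁ (adjoinAll (stage i) (List.map (π⁻¹ ^ suc i *ₗ_) gs))

      stage-mono : ∀ d i → stage i ⊑ stage (d ℕ.+ i)
      stage-mono zero    i = ⊑-refl
      stage-mono (suc d) i = ⊑-trans (stage-mono d i)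
          (proj₁ (proj₂ (adjoinAll (stage (d ℕ.+ i)) (List.map (π⁻¹ ^ suc (d ℕ.+ i) *ₗ_) gs))))

      stage-mono′ : ∀ i d → stage i ⊑ stage (i ℕ.+ d)
      stage-mono′ i d = ≡.subst (λ j → stage i ⊑ stage j) (ℕ.+-comm d i) (stage-mono d i)

      W U : ℕ → Pred Carrierᴹ ℓ
      W i = Stage.W (stage i)
      U i = Stage.U (stage i)

      -- Write `x = y + π x′` with `y` in the `k₁`-span of the generators. Then `π⁻ⁱ⁻¹ y` is caught
      -- by the vectors adjoined at this stage and `π⁻ⁱ x′` by the previous one.
      π⁻ⁱL⊆W : ∀ i {x} → Span (over𝒪 T M) gs x → W i (π⁻¹ ^ i *ₗ x)
      π⁻ⁱL⊆W zero    {x} p = IsSubmodule.resp (Stage.W-sub s) (≈ᴹ-sym (*ₗ-identityˡ x))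
        (L⊆W (Span-⊆ (over𝒪 T M) (Lattice.isSubmodule L) (proj₁ (proj₂ (lattice-generators M L))) p))
      π⁻ⁱL⊆W (suc i) {x} p =
        let (y , x′ , q , p′ , e) = Span-expand M gs p in
        resp (≈ᴹ-sym (≈ᴹ-trans (*ₗ-congˡ e)
          (≈ᴹ-trans (*ₗ-distribˡ (π⁻¹ ^ suc i) y (π *ₗ x′)) (+ᴹ-congˡ (π⁻¹^suc*π i x′)))))
          (has+ (Span-⊆ M₁ W-sub (proj₂ (proj₂ (adjoinAll (stage i) (List.map (π⁻¹ ^ suc i *ₗ_) gs))))
                  (Span-scaled M lift₁-hom (π⁻¹ ^ suc i) gs q))
                (W⊆ (stage-mono 1 i) (π⁻ⁱL⊆W i p′)))
        where
        open Stage (stage (suc i)) using (W-sub)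
        open IsSubmodule W-sub
        π⁻¹^suc*π : ∀ i x → π⁻¹ ^ suc i *ₗ (π *ₗ x) ≈ᴹ π⁻¹ ^ i *ₗ x
        π⁻¹^suc*π i x = ≈ᴹ-trans (≈ᴹ-sym (*ₗ-assoc (π⁻¹ ^ suc i) π x)) (*ₗ-congʳ (T.trans
          (T.*-congʳ (T.*-comm π⁻¹ (π⁻¹ ^ i))) (T.trans (T.*-assoc (π⁻¹ ^ i) π⁻¹ π)
          (T.trans (T.*-congˡ π⁻¹*π≈1) (T.*-identityʳ (π⁻¹ ^ i))))))

      exhaustive : ∀ m → ∃[ i ] W i m
      exhaustive m =
        let (N , p) = lattice-absorbing M L m in
        N , IsSubmodule.resp (Stage.W-sub (stage N))
          (≈ᴹ-trans (≈ᴹ-sym (*ₗ-assoc (π⁻¹ ^ N) (π ^ N) m))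
            (≈ᴹ-trans (*ₗ-congʳ (π⁻¹^*π^≈1 N)) (*ₗ-identityˡ m)))
          (π⁻ⁱL⊆W N (gen (p (v≥-π^ N))))

      U∞ : Pred Carrierᴹ ℓ
      U∞ x = ∃[ i ] U i x

      U∞-sub : IsSubmodule Mk U∞
      U∞-sub = record
        { resp = λ e (i , p) → i , IsSubmodule.resp (Stage.U-sub (stage i)) e p
        ; has0 = 0 , IsSubmodule.has0 (Stage.U-sub s)
        ; has+ = λ (i , p) (j , q) → i ℕ.+ j , IsSubmodule.has+ (Stage.U-sub (stage (i ℕ.+ j)))
            (U⊆ (stage-mono′ i j) p) (U⊆ (stage-mono i j) q)
        ; has* = λ c (i , p) → i , IsSubmodule.has* (Stage.U-sub (stage i)) c p
        }

    -- The union of the stages works: its balls come from the initial `U`, which is absorbing, and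
    -- its slice at `m` from a stage whose `W` contains `m`.
    extension : ∃[ V ] (Fine T M V × Stage.U s ⊆ V × (∀ {x} → Stage.W s x → V x → Stage.U s x))
    extension = U∞ ,
      FineCriterion.ball∧slice⇒fine T σ₁ crit M {U∞} U∞-sub
        (λ m → let (N , p) = U-abs m in N , λ q → 0 , p q)
        (λ m → let (i , p) = exhaustive m in
          orbit-open U∞-sub m (Stage.slice (stage i) p)
            (IsSubmodule.resp (Stage.U-sub (stage i)) (≈ᴹ-sym (M₁.*ₗ-zeroˡ m))
              (IsSubmodule.has0 (Stage.U-sub (stage i))))
            (λ u → i , u)) ,
      (λ u → 0 , u) ,
      λ { {x} w (i , u) → U∩W⊆ (≡.subst (λ j → s ⊑ stage j) (ℕ.+-identityʳ i) (stage-mono i 0)) w u }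

  -- Extend `O x + L` from the subspace `k₁ x + L`. If `x` were in the extension, then
  -- `x = σ₁(c) x + l` with `c ∈ O` and `l ∈ L`, so `σ₁(1 - c) x ∈ L`. As `x ∉ L`, this forces
  -- `c = 1`, contrary to `1 ∉ O`.
  lattice-closed : ∃[ O ] (IsSubmodule (regularBase (residue T)) O × τ₁.Open O × ¬ O 𝒪.1#) →
    ∀ (L : Lattice T M) {x} → ¬ Lattice.member L x →
    ∃[ U ] (Fine T M U × Lattice.member L ⊆ U × ¬ U x)
  lattice-closed (O , O-sub , O-open , 1∉O) L {x} x∉L =
    let (V , V-fine , U⊆V , V∩W⊆U) = extension s L (Line+-⊇ ⊤-isSubmodule-k₁)
          (Absorbing-⊆ M L.member (Line+ O x L.member) (Line+-⊇ O-sub) (lattice-absorbing M L)) in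
    V , V-fine , (λ p → U⊆V (Line+-⊇ O-sub p)) , λ v →
      let (c , l , c∈O , l∈L , e) = V∩W⊆U
            (𝒪.1# , 0ᴹ , tt , L.has0 , ≈ᴹ-sym (≈ᴹ-trans (+ᴹ-identityʳ _) (M₁.*ₗ-identityˡ x))) v
          d = 𝒪.1# 𝒪.- c in
      1∉O (IsSubmodule.resp O-sub {c} {𝒪.1#} (k₁.sym {𝒪.1#} {c} (d≈0⇒ c
        (multiple∈⇒0 L-sub x∉L {d} (L.resp (≈ᴹ-sym (dx≈l c l e)) l∈L)))) c∈O)
    where
    module L = Lattice L
    L-sub = 𝒪⇒k₁-isSubmodule M L.isSubmodule
    s : Stage
    s = record
      { W = Line+ (λ _ → ⊤) x L.member
      ; U = Line+ O x L.member
      ; W-sub = Line+-k₁-isSubmodule L-sub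
      ; U-sub = Line+-isSubmodule O-sub (k₁⇒k-isSubmodule L-sub)
      ; U⊆W = λ (c , u , _ , p , e) → c , u , tt , p , e
      ; slice = λ (c , u , _ , p , e) → Line+-slice O-sub O-open (k₁⇒k-isSubmodule L-sub) {c = c} e
          (open-cong T₁.topology (λ {a} _ → L.has* (lift₁ a , lift₁-integral a) p) (λ _ → tt) τ₁.Open-⊤)
      }
    dx≈l : ∀ c l → x ≈ᴹ (lift₁ c *ₗ x) +ᴹ l → lift₁ (𝒪.1# 𝒪.- c) *ₗ x ≈ᴹ l
    dx≈l c l e = ≈ᴹ-trans (*ₗ-congʳ (lift₁.+-homo 𝒪.1# (𝒪.- c))) (≈ᴹ-trans (*ₗ-distribʳ x _ _)
      (≈ᴹ-trans (+ᴹ-cong (≈ᴹ-trans (M₁.*ₗ-identityˡ x) e)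
        (≈ᴹ-trans (*ₗ-congʳ (lift₁.-‿homo c)) (neg-*ₗ (lift₁ c) x)))
        ([x+y]-x≈y (lift₁ c *ₗ x) l)))
    d≈0⇒ : ∀ c → (𝒪.1# 𝒪.- c) k₁.≈ 𝒪.0# → 𝒪.1# k₁.≈ c
    d≈0⇒ c = v≥-resp (TG.x-0≈x (T.1# T.- proj₁ c))
      where module TG = GroupLemmas T.+-abelianGroup

-- Dense subalgebras

-- The `k`-subalgebra generated by `ss`. Products are built one generator at a time, the form in
-- which a commutator with a generator can be split off.
data Generated {k : Field ℓ} {n : ℕ} (T : LocalFieldData k n) (ss : List (LocalFieldData.Carrier T)) :
               Pred (LocalFieldData.Carrier T) ℓ where
  one  : Generated T ss (LocalFieldData.1# T)
  add  : ∀ {x y} → Generated T ss x → Generated T ss y → Generated T ss (LocalFieldData._+_ T x y)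
  scal : ∀ c {x} → Generated T ss x → Generated T ss (LocalFieldData._*_ T (LocalFieldData.ι T c) x)
  mul  : ∀ {s x} → s ∈ ss → Generated T ss x → Generated T ss (LocalFieldData._*_ T s x)
  resp : ∀ {x y} → LocalFieldData._≈_ T x y → Generated T ss x → Generated T ss y

module _ {k : Field ℓ} {n : ℕ} (T : LocalFieldData k n) where
  private
    module T = LocalFieldData T
    module k = Field k
    module ι = RingMorphisms.IsRingHomomorphism T.ι-hom

  Generated-0 : ∀ {ss} → Generated T ss T.0#
  Generated-0 = resp (T.trans (T.*-congʳ ι.0#-homo) (T.zeroˡ T.1#)) (scal k.0# one)

  Dense : Pred (List T.Carrier) (lsuc ℓ)
  Dense ss = ∀ U → IsSubmodule (regularBase T) U → Topology.Open T.topology U →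
             ∀ x → ∃[ p ] (Generated T ss p × U (x T.- p))

  finite-dense : IsFinitelyGenerated (regularBase T) → ∃ Dense
  finite-dense fg =
    let (gs , gen) = finitelyGenerated⇒Span (regularBase T) fg in
    gs , λ U U-sub _ x → x , go gs (gen x) id , IsSubmodule.resp U-sub (T.sym (T.-‿inverseʳ x))
      (IsSubmodule.has0 U-sub)
    where
    go : ∀ {ss} gs {x} → Span (regularBase T) gs x → (∀ {g} → g ∈ gs → g ∈ ss) → Generated T ss x
    go []       x≈0              gs⊆ = resp (T.sym x≈0) Generated-0
    go (g ∷ gs) (c , m , p , e) gs⊆ = resp
        (T.sym (T.trans e (T.+-congʳ (T.*-congˡ (T.sym (T.*-identityʳ g))))))
      (add (scal c (mul (gs⊆ (here ≡.refl)) one)) (go gs p (gs⊆ ∘ there)))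

module DenseStep (em : ExcludedMiddle ℓ) {k : Field ℓ} {n : ℕ} (T : LocalFieldData k (suc n)) (σ₁ : Lifting T)
                 (crit : LiftingLemmas.OpenCriterion T σ₁) where
  private
    module T = LocalFieldData T
    module T₁ = LocalFieldData (residue T)
  open FirstValuation T hiding (residue; surjective)
  open ValuationLemmas valuation
  open UniformizerPowers valuation
  open ExpProperties T.semiring using (_^_)
  open LiftingLemmas T σ₁
  open OpenCriterion crit
  open LiftingModules em T σ₁ using (𝒪-expand)
  private
    module lift₁ = RingMorphisms.IsRingHomomorphism lift₁-hom
    module TG = GroupLemmas T.+-abelianGroup

    regular-T : Mod T.ring
    regular-T = regular T.ring

  -- Since `mul` multiplies by a single generator, products of generated elements are formed by
  -- accumulating the factors of `p` in front of `y`.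
  lift-generated : ∀ {ss ss′} → (∀ {s} → s ∈ ss → lift₁ s ∈ ss′) →
    ∀ {p} → Generated (residue T) ss p → ∀ {y} → Generated T ss′ y → Generated T ss′ (lift₁ p T.* y)
  lift-generated incl one {y} q = resp (T.sym (T.trans (T.*-congʳ lift₁.1#-homo) (T.*-identityˡ y))) q
  lift-generated incl (add {a} {b} p p′) {y} q =
    resp (T.sym (T.trans (T.*-congʳ (lift₁.+-homo a b)) (T.distribʳ y _ _)))
      (add (lift-generated incl p q) (lift-generated incl p′ q))
  lift-generated incl (scal c {a} p) {y} q =
    resp (T.sym (T.trans (T.*-congʳ
      (T.trans (lift₁.*-homo (T₁.ι c) a) (T.*-congʳ (Lifting.over-k σ₁ c)))) (T.*-assoc _ _ y)))
      (scal c (lift-generated incl p q))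
  lift-generated incl (mul {s} {a} s∈ p) {y} q =
    resp (T.sym (T.trans (T.*-congʳ (lift₁.*-homo s a)) (T.*-assoc _ _ y)))
      (mul (incl s∈) (lift-generated incl p q))
  lift-generated incl (resp {a} {b} a≈b p) {y} q =
    resp (T.*-congʳ (lift₁-cong {a} {b} a≈b)) (lift-generated incl p q)

  lift₁-orbit : ∀ {U} → IsSubmodule (regularBase T) U → ∀ y →
                IsSubmodule (regularBase (residue T)) (λ c → U (lift₁ c T.* y))
  lift₁-orbit {U} U-sub y = record
    { resp = λ {a} {b} e → U.resp (T.*-congʳ (lift₁-cong {a} {b} e))
    ; has0 = U.resp (T.sym (T.trans (T.*-congʳ lift₁.0#-homo) (T.zeroˡ y))) U.has0
    ; has+ = λ {a} {b} p q → U.resp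
        (T.sym (T.trans (T.*-congʳ (lift₁.+-homo a b)) (T.distribʳ y _ _))) (U.has+ p q)
    ; has* = λ c {a} p → U.resp (T.sym (T.trans
        (T.*-congʳ (T.trans (lift₁.*-homo (T₁.ι c) a) (T.*-congʳ (Lifting.over-k σ₁ c))))
          (T.*-assoc _ _ y))) (U.has* c p)
    }
    where module U = IsSubmodule U-sub

  module _ {ss₁} (ss₁-dense : Dense (residue T) ss₁)
           {ss} (π∈ss : π ∈ ss) (lift∈ss : ∀ {s} → s ∈ ss₁ → lift₁ s ∈ ss)
           {U} (U-sub : IsSubmodule (regularBase T) U) (U-open : Topology.Open T.topology U) where
    private module U = IsSubmodule U-sub

    -- Digit by digit: in `x = σ₁(x) + π x′`, density in the residue field approximates `σ₁(x) y`
    -- through the slice of `U` at `y`, and `x′` is then treated with `π y` in place of `y`. After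
    -- `j` steps the rest lies in `U`.
    approximate : ∀ j x → v≥ (+ 0) x → ∀ {y} → Generated T ss y → (∀ {z} → v≥ (+ j) z → U (z T.* y)) →
                  ∃[ p ] (Generated T ss p × U (x T.* y T.- p))
    approximate zero    x x∈𝒪 {y} q p = T.0# , Generated-0 T , U.resp (T.sym (TG.x-0≈x (x T.* y)))
        (p x∈𝒪)
    approximate (suc j) x x∈𝒪 {y} q p =
      let (x′ , x≈) = 𝒪-expand (x , x∈𝒪)
          (c , c-gen , c∈) = ss₁-dense (λ c → U (lift₁ c T.* y)) (lift₁-orbit U-sub y)
            (open⇒slice U-sub U-open y) (x , x∈𝒪)
          (r , r-gen , r∈) = approximate j (proj₁ x′) (proj₂ x′) (mul π∈ss q) λ {z} z∈ →
            U.resp (T.*-assoc z π y) (p (≡.subst (λ i → v≥ (+ i) (z T.* π)) (ℕ.+-comm j 1)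
              (v≥-* z∈ v≥1-π))) in
      lift₁ c T.* y T.+ r , add (lift-generated lift∈ss c-gen q) r-gen ,
      U.resp (eq c (proj₁ x′) r x≈) (U.has+ c∈ r∈)
      where
      open SetoidReasoning T.setoid
      eq : ∀ c x′ r → x T.≈ lift₁ (x , x∈𝒪) T.+ π T.* x′ →
           lift₁ ((x , x∈𝒪) 𝒪.- c) T.* y T.+ (x′ T.* (π T.* y) T.- r) T.≈ x T.* y T.-
             (lift₁ c T.* y T.+ r)
      eq c x′ r x≈ = begin
        lift₁ ((x , x∈𝒪) 𝒪.- c) T.* y T.+ (x′ T.* (π T.* y) T.- r)
          ≈⟨ T.+-congʳ (T.trans (T.*-congʳ (T.trans (lift₁.+-homo (x , x∈𝒪) (𝒪.- c)) (T.+-congˡ (lift₁.-‿homo c))))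
               (ML.sub-*ₗ _ _ y)) ⟩
        (lift₁ (x , x∈𝒪) T.* y T.- lift₁ c T.* y) T.+ (x′ T.* (π T.* y) T.- r)
          ≈⟨ TG.[x+u]-[y+v]≈[x-y]+[u-v] _ _ _ _ ⟨
        (lift₁ (x , x∈𝒪) T.* y T.+ x′ T.* (π T.* y)) T.- (lift₁ c T.* y T.+ r)
          ≈⟨ T.+-congʳ (T.+-congˡ (T.trans (T.sym (T.*-assoc x′ π y)) (T.*-congʳ (T.*-comm x′ π)))) ⟩
        (lift₁ (x , x∈𝒪) T.* y T.+ π T.* x′ T.* y) T.- (lift₁ c T.* y T.+ r)
          ≈⟨ T.+-congʳ (T.trans (T.*-congʳ x≈) (T.distribʳ y _ _)) ⟨
        x T.* y T.- (lift₁ c T.* y T.+ r) ∎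
        where module ML = ModuleLemmas regular-T

  integers-dense : ∃ (Dense (residue T)) → ∃[ ss ] (All (v≥ (+ 0)) ss ×
    (∀ U → IsSubmodule (regularBase T) U → Topology.Open T.topology U →
     ∀ x → v≥ (+ 0) x → ∃[ p ] (Generated T ss p × U (x T.- p))))
  integers-dense (ss₁ , ss₁-dense) =
    π ∷ List.map lift₁ ss₁ , v≥0-π ∷ map⁺ (All.universal lift₁-integral ss₁) , λ U U-sub U-open x x∈𝒪 →
      let module U = IsSubmodule U-sub
          (N , ball) = open⇒ball U-sub U-open
          (p , p-gen , p∈) = approximate ss₁-dense (here ≡.refl) (there ∘ ∈-map⁺ lift₁) U-sub U-open N x x∈𝒪 one
            (λ {z} q → U.resp (T.sym (T.*-identityʳ z)) (ball q)) in
      p , p-gen , U.resp (T.+-congʳ (T.*-identityʳ x)) p∈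

  field-dense : ∃ (Dense (residue T)) → ∃ (Dense T)
  field-dense (ss₁ , ss₁-dense) = π⁻¹ ∷ π ∷ List.map lift₁ ss₁ , λ U U-sub U-open x →
    let module U = IsSubmodule U-sub
        -- `πᴺ x` is integral and the starting element `y = π⁻ᴺ` undoes the scaling; `j` is large
        -- enough for multiples `z π⁻ᴺ` to fall into the ball.
        (N , x∈) = absorb em x 0
        (M , ball) = open⇒ball U-sub U-open
        (j , y∈) = absorb em (π⁻¹ ^ N) M
        (p , p-gen , p∈) = approximate ss₁-dense (there (here ≡.refl)) (there ∘ there ∘ ∈-map⁺ lift₁) U-sub U-open
          j (π ^ N T.* x) (x∈ (v≥-π^ N)) (powers N) (λ q → ball (y∈ q)) in
    p , p-gen , U.resp (T.+-congʳ (T.trans (T.*-comm _ _) (T.trans (T.sym (T.*-assoc _ _ x))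
      (T.trans (T.*-congʳ (π⁻¹^*π^≈1 N)) (T.*-identityˡ x))))) p∈
    where
    powers : ∀ N → Generated T (π⁻¹ ∷ π ∷ List.map lift₁ ss₁) (π⁻¹ ^ N)
    powers zero    = one
    powers (suc N) = mul (here ≡.refl) (powers N)

module _ (em : ExcludedMiddle ℓ) {k : Field ℓ} where
  dense : ∀ {n} (T : LocalFieldData k n) (σ : SystemOfLiftings T) → Controlled T σ → ∃ (Dense T)
  dense {zero}  T σ        (fg , _)          = finite-dense T fg
  dense {suc n} T (σ₁ , σ) (_ , crit , ctrl) = DenseStep.field-dense em T σ₁ crit
      (dense (residue T) σ ctrl)

  separated : ∀ {n} (T : LocalFieldData k n) (σ : SystemOfLiftings T) → Controlled T σ →
    ∃[ O ] (IsSubmodule (regularBase T) O × Topology.Open (LocalFieldData.topology T) O × ¬ O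
      (LocalFieldData.1# T))
  separated {zero} T σ (_ , all-open) =
    (λ x → x T.≈ T.0#) ,
    0-isSubmodule {M = regularBase T} ,
    all-open _ (λ x≈y x≈0 → T.trans (T.sym x≈y) x≈0) ,
    T.1≉0
    where module T = LocalFieldData T
  separated {suc n} T (σ₁ , σ) (K-ST , crit , ctrl) =
    let (U , (U-sub , orb) , _ , 1∉U) = Extension.lattice-closed em T σ₁ crit (controlled-isSTRing (residue T) σ ctrl)
          (regular T.ring) (separated (residue T) σ ctrl) 𝔪-lattice 1∉𝔪 in
    U , U-sub , open-cong T.topology (λ {a} → IsSubmodule.resp U-sub (T.*-identityʳ a))
      (λ {a} → IsSubmodule.resp U-sub (T.sym (T.*-identityʳ a))) (orb T.1#) , 1∉U
    where
    module T = LocalFieldData T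
    open FirstValuation T hiding (residue; surjective)
    open ValuationLemmas valuation
    open LatticeLemmas em T
    𝔪-lattice : Lattice T (regular T.ring)
    𝔪-lattice = spanLattice (regular T.ring) (π ∷ []) (Span-absorbing (regular T.ring) (π ∷ []) λ m →
      m T.* π⁻¹ , T.0# , T.refl , T.sym (T.trans (T.+-identityʳ _) (T.trans (T.*-assoc m π⁻¹ π)
        (T.trans (T.*-congˡ π⁻¹*π≈1) (T.*-identityʳ m)))))
    1∉𝔪 : ¬ Lattice.member 𝔪-lattice T.1#
    1∉𝔪 (a , z , z≈0 , e) = ¬v≥1-1
        (v≥-resp (T.sym (T.trans e (T.trans (T.+-congˡ z≈0) (T.+-identityʳ _)))) (v≥-* (proj₂ a) v≥1-π))

-- Differential operators are Beilinson–Tate operators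

module _ {k : Field ℓ} {n : ℕ} (T : LocalFieldData k n) (M N : Mod (LocalFieldData.ring T)) where
  private
    module T = LocalFieldData T
    module M = LeftModule M
    module N = LeftModule N

  commutator : T.Carrier → (M.Carrierᴹ → N.Carrierᴹ) → M.Carrierᴹ → N.Carrierᴹ
  commutator a φ x = (a N.*ₗ φ x) N.+ᴹ N.-ᴹ φ (a M.*ₗ x)

  -- Order below `i`, with the index shift of `DifferentialOrder<`, for maps between modules and
  -- with continuity for the fine topologies.
  FineDiff : ℕ → Pred (M.Carrierᴹ → N.Carrierᴹ) (lsuc ℓ)
  FineDiff zero    φ = Lift (lsuc ℓ) (∀ x → φ x N.≈ᴹ N.0ᴹ)
  FineDiff (suc i) φ = LinearMap (T.overBase M) (T.overBase N) φ × FineContinuous T M N φ ×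
                       (∀ a → FineDiff i (commutator a φ))

  FineDiff⇒linear : ∀ i {φ} → FineDiff i φ → LinearMap (T.overBase M) (T.overBase N) φ
  FineDiff⇒linear zero    (lift φ≈0) = record
    { cong = λ _ → N.≈ᴹ-trans (φ≈0 _) (N.≈ᴹ-sym (φ≈0 _))
    ; add = λ x y → N.≈ᴹ-trans (φ≈0 _)
        (N.≈ᴹ-sym (N.≈ᴹ-trans (N.+ᴹ-cong (φ≈0 x) (φ≈0 y)) (N.+ᴹ-identityˡ N.0ᴹ)))
    ; scal = λ c x → N.≈ᴹ-trans (φ≈0 _) (N.≈ᴹ-sym (N.≈ᴹ-trans (N.*ₗ-congˡ (φ≈0 x)) (N.*ₗ-zeroʳ (T.ι c))))
    }
  FineDiff⇒linear (suc i) (φ-lin , _) = φ-lin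

  FineDiff⇒continuous : ∀ i {φ} → FineDiff i φ → FineContinuous T M N φ
  FineDiff⇒continuous zero    {φ} (lift φ≈0) U (U-sub , _) =
    LinearMap.preimage (FineDiff⇒linear zero (lift φ≈0)) U-sub ,
    λ m → open-cong T.topology (λ _ → U.resp (N.≈ᴹ-sym (φ≈0 _)) U.has0) (λ _ → tt) (Topology.Open-⊤ T.topology)
    where module U = IsSubmodule U-sub
  FineDiff⇒continuous (suc i) (_ , φ-cont , _) = φ-cont

module Bounded (em : ExcludedMiddle ℓ) {k : Field ℓ} {n : ℕ} (T : LocalFieldData k (suc n)) (σ₁ : Lifting T)
               (σ : SystemOfLiftings (residue T)) (ctrl : Controlled T (σ₁ , σ))
               (M N : Mod (LocalFieldData.ring T)) where
  private
    module T = LocalFieldData T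
    module M = LeftModule M
    module N = LeftModule N
    module NL = ModuleLemmas N
    crit = proj₁ (proj₂ ctrl)
    ctrl₁ = proj₂ (proj₂ ctrl)
    module EN = Extension em T σ₁ crit (controlled-isSTRing (residue T) σ ctrl₁) N
  open FirstValuation T hiding (residue; surjective)
  open ValuationLemmas valuation
  open UniformizerPowers valuation
  open ExpProperties T.semiring using (_^_)
  open LatticeLemmas em T
  open LiftingModules em T σ₁

  _⊑_ : Lattice T N → Lattice T N → Set ℓ
  L ⊑ L′ = Lattice.member L ⊆ Lattice.member L′

  private
    shift : ∀ {φ} a x → a N.*ₗ φ x N.+ᴹ N.-ᴹ commutator T M N a φ x N.≈ᴹ φ (a M.*ₗ x)
    shift {φ} a x = N.≈ᴹ-trans (N.+ᴹ-congˡ (NL.⁻¹-anti-homo‿- (a N.*ₗ φ x) (φ (a M.*ₗ x))))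
        (NL.x+[y-x]≈y _ _)

  -- `φ(s p g) = s φ(p g) - [s, φ](p g)`, where the commutators with the finitely many generators
  -- `s` have lower order and `s ∈ 𝒪` preserves lattices. The lattice `L` is threaded through as an
  -- accumulator, so that bounds are combined by enlarging it and not by adding lattices.
  generated-bounded : ∀ i {φ} → FineDiff T M N i φ → ∀ {ss} → All (v≥ (+ 0)) ss → ∀ g L →
    ∃[ L′ ] (L ⊑ L′ × (∀ {p} → Generated T ss p → Lattice.member L′ (φ (p M.*ₗ g))))
  generated-bounded zero    (lift φ≈0) ss-int g L =
    L , id , λ _ → Lattice.resp L (N.≈ᴹ-sym (φ≈0 _)) (Lattice.has0 L)
  generated-bounded (suc i) {φ} (φ-lin , _ , comm) {ss} ss-int g L =
    let (L₁ , L⊑L₁ , comm∈) = all-commutators ss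
        (L₂ , L₁⊑L₂ , φg∈) = extendLattice N L₁ (φ g) in
    L₂ , L₁⊑L₂ ∘ L⊑L₁ , bound L₂ φg∈ (λ s∈ q → L₁⊑L₂ (comm∈ s∈ q))
    where
    module φ = LinearMap φ-lin
    all-commutators : ∀ rs → ∃[ L′ ] (L ⊑ L′ × (∀ {s} → s ∈ rs → ∀ {p} → Generated T ss p →
                      Lattice.member L′ (commutator T M N s φ (p M.*ₗ g))))
    all-commutators []       = L , id , λ ()
    all-commutators (s ∷ rs) =
      let (L₁ , L⊑L₁ , rs∈) = all-commutators rs
          (L₂ , L₁⊑L₂ , s∈) = generated-bounded i (comm s) ss-int g L₁ in
      L₂ , L₁⊑L₂ ∘ L⊑L₁ , λ { (here ≡.refl) q → s∈ q ; (there r∈) q → L₁⊑L₂ (rs∈ r∈ q) }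

    bound : ∀ L′ → Lattice.member L′ (φ g) →
      (∀ {s} → s ∈ ss → ∀ {p} → Generated T ss p → Lattice.member L′ (commutator T M N s φ (p M.*ₗ g))) →
      ∀ {p} → Generated T ss p → Lattice.member L′ (φ (p M.*ₗ g))
    bound L′ φg∈ comm∈ = go
      where
      module L′ = Lattice L′
      go : ∀ {p} → Generated T ss p → L′.member (φ (p M.*ₗ g))
      go one                   = L′.resp (φ.cong (M.≈ᴹ-sym (M.*ₗ-identityˡ g))) φg∈
      go (add {x} {y} p q)     = L′.resp
          (N.≈ᴹ-sym (N.≈ᴹ-trans (φ.cong (M.*ₗ-distribʳ g x y)) (φ.add _ _))) (L′.has+ (go p) (go q))
      go (scal c {x} p)        = L′.resp
          (N.≈ᴹ-sym (N.≈ᴹ-trans (φ.cong (M.*ₗ-assoc (T.ι c) x g)) (φ.scal c _)))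
        (L′.has* (T.ι c , proj₁ (T.ι-integral c)) (go p))
      go (mul {s} {x} s∈ p)    = L′.resp
          (N.≈ᴹ-trans (shift {φ} s (x M.*ₗ g)) (φ.cong (M.≈ᴹ-sym (M.*ₗ-assoc s x g))))
        (L′.has+ (L′.has* (s , All.lookup ss-int s∈) (go p)) (L′.has- (comm∈ s∈ p)))
      go (resp x≈y p)          = L′.resp (φ.cong (M.*ₗ-congʳ x≈y)) (go p)

  -- φ maps a dense part of 𝒪 g into a lattice, and lattices are closed.
  line-bounded : ∀ i {φ} → FineDiff T M N i φ → ∀ g L →
    ∃[ L′ ] (L ⊑ L′ × (∀ {a} → v≥ (+ 0) a → Lattice.member L′ (φ (a M.*ₗ g))))
  line-bounded i {φ} φ-diff g L =
    let (ss , ss-int , approx) = DenseStep.integers-dense em T σ₁ crit (dense em (residue T) σ ctrl₁)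
        (L′ , L⊑L′ , bound) = generated-bounded i φ-diff ss-int g L in
    L′ , L⊑L′ , λ {a} a∈𝒪 → closed L′ a λ U U-sub U-open →
      let (p , p-gen , a-p∈) = approx U U-sub U-open a a∈𝒪 in p , bound p-gen , a-p∈
    where
    module φ = LinearMap (FineDiff⇒linear T M N i φ-diff)
    closed : ∀ L′ a → (∀ U → IsSubmodule (regularBase T) U → Topology.Open T.topology U →
                       ∃[ p ] (Lattice.member L′ (φ (p M.*ₗ g)) × U (a T.- p))) →
                         Lattice.member L′ (φ (a M.*ₗ g))
    closed L′ a approx with em {Lattice.member L′ (φ (a M.*ₗ g))}
    ... | yes p = p
    ... | no ¬p =
      let (U , U-fine , L′⊆U , ∉U) = EN.lattice-closed (separated em (residue T) σ ctrl₁) L′ ¬p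
          module U = IsSubmodule (proj₁ U-fine)
          (φ⁻¹U-sub , orb) = FineDiff⇒continuous T M N i φ-diff U U-fine
          -- `a` is approximated modulo the open submodule of all `c` with `φ(c g) ∈ U`; then
          -- `φ(a g) = φ((a - b) g) + φ(b g)` would lie in `U`.
          (b , φbg∈ , a-b∈) = approx (λ c → U (φ (c M.*ₗ g)))
            (LinearMap.preimage (orbit-linear T M g) φ⁻¹U-sub) (orb g) in
      ⊥-elim (∉U (U.resp
        (N.≈ᴹ-trans (N.≈ᴹ-sym (φ.add _ _)) (φ.cong (M.≈ᴹ-trans (M.≈ᴹ-sym (M.*ₗ-distribʳ g (a T.- b) b))
          (M.*ₗ-congʳ (GroupLemmas.[x-y]+y≈x T.+-abelianGroup a b)))))
        (U.has+ a-b∈ (L′⊆U φbg∈))))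

  lattice-bounded : ∀ i {φ} → FineDiff T M N i φ → ∀ (L₁ : Lattice T M) L₂ →
    ∃[ L₂′ ] (L₂ ⊑ L₂′ × (∀ {x} → Lattice.member L₁ x → Lattice.member L₂′ (φ x)))
  lattice-bounded i {φ} φ-diff L₁ L₂ =
    let (gs , _ , gen) = lattice-generators M L₁
        (L₂′ , L₂⊑L₂′ , bound) = all-lines gs in
    L₂′ , L₂⊑L₂′ , λ p → on-span L₂′ bound (gen p)
    where
    module φ = LinearMap (FineDiff⇒linear T M N i φ-diff)
    BoundedOn : Lattice T N → M.Carrierᴹ → Set ℓ
    BoundedOn L g = ∀ {a} → v≥ (+ 0) a → Lattice.member L (φ (a M.*ₗ g))
    all-lines : ∀ gs → ∃[ L ] (L₂ ⊑ L × All (BoundedOn L) gs)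
    all-lines []       = L₂ , id , []
    all-lines (g ∷ gs) =
      let (L , L₂⊑L , gs∈) = all-lines gs
          (L′ , L⊑L′ , g∈) = line-bounded i φ-diff g L in
      L′ , L⊑L′ ∘ L₂⊑L , g∈ ∷ All.map (λ b {a} q → L⊑L′ (b {a} q)) gs∈
    on-span : ∀ L {gs} → All (BoundedOn L) gs → ∀ {x} → Span (over𝒪 T M) gs x → Lattice.member L (φ x)
    on-span L {[]}     []       x≈0             = Lattice.resp L
        (N.≈ᴹ-sym (N.≈ᴹ-trans (φ.cong x≈0) φ.zer)) (Lattice.has0 L)
    on-span L {g ∷ gs} (b ∷ bs) (a , m , p , e) = Lattice.resp L
        (N.≈ᴹ-sym (N.≈ᴹ-trans (φ.cong e) (φ.add _ _)))
      (Lattice.has+ L (b (proj₂ a)) (on-span L bs p))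

  scaled-into : ∀ (L L′ : Lattice T N) → ∃[ e ]
      (∀ {y} → Lattice.member L y → Lattice.member L′ (π ^ e N.*ₗ y))
  scaled-into L L′ =
    let (gs , _ , gen) = lattice-generators N L
        (e , bound) = common-bound N {Lattice.member L′} (lattice-absorbing N L′) gs in
    e , λ p → Span-⊆ (over𝒪 T N) (scaled-isSubmodule N L′ e) (All.map (λ q → q (v≥-π^ e)) bound) (gen p)

  -- φ(πᵈ⁺ᴺ x) ≡ πᵈ φ(πᴺ x) mod L₂ as soon as the commutator of π and φ maps πᴺ L₁ into L₂.
  small-source : ∀ i {φ} → FineDiff T M N i φ → ∀ (L₁ : Lattice T M) (L₂ : Lattice T N) →
    ∃[ J ] (∀ {x} → Lattice.member L₁ x → Lattice.member L₂ (φ (π ^ J M.*ₗ x)))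
  small-source zero    (lift φ≈0) L₁ L₂ =
    0 , λ _ → Lattice.resp L₂ (N.≈ᴹ-sym (φ≈0 _)) (Lattice.has0 L₂)
  small-source (suc i) {φ} φ-diff@(φ-lin , _ , comm) L₁ L₂ =
    let (J , comm∈) = small-source i (comm π) L₁ L₂
        (L₂′ , _ , φL₁⊆) = lattice-bounded (suc i) φ-diff L₁ L₂
        -- `L₂′` contains `φ(L₁)`, hence `φ(πᴶ L₁)`, and `e` further powers of `π` push it into
        -- `L₂`.
        (e , π^eL₂′⊆L₂) = scaled-into L₂′ L₂ in
    e ℕ.+ J , λ {x} p → L₂.resp (N.≈ᴹ-trans (N.+ᴹ-comm _ _) (NL.x+[y-x]≈y _ _))
      (L₂.has+ (compare J comm∈ e p) (π^eL₂′⊆L₂ (φL₁⊆ (L₁.has* (π ^ J , v≥0-π^ J) p))))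
    where
    module L₁ = Lattice L₁
    module L₂ = Lattice L₂
    module φ = LinearMap φ-lin
    v≥0-π^ : ∀ J → v≥ (+ 0) (π ^ J)
    v≥0-π^ J = v≥-mono (ℤ.+≤+ ℕ.z≤n) (v≥-π^ J)
    -- Each step multiplies the previous difference by `π` and subtracts the commutator at `πᵈ⁺ᴶ x`.
    compare : ∀ J → (∀ {x} → L₁.member x → L₂.member (commutator T M N π φ (π ^ J M.*ₗ x))) →
        ∀ d {x} → L₁.member x →
              L₂.member (φ (π ^ (d ℕ.+ J) M.*ₗ x) N.+ᴹ N.-ᴹ (π ^ d N.*ₗ φ (π ^ J M.*ₗ x)))
    compare J comm∈ zero    {x} p = L₂.resp
        (N.≈ᴹ-sym (N.≈ᴹ-trans (N.+ᴹ-congˡ (N.-ᴹ‿cong (N.*ₗ-identityˡ _))) (N.-ᴹ‿inverseʳ _))) L₂.has0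
    compare J comm∈ (suc d) {x} p = L₂.resp eq
        (L₂.has+ (L₂.has* (π , v≥0-π) (compare J comm∈ d p)) (L₂.has- (comm′ d)))
      where
      open SetoidReasoning N.≈ᴹ-setoid
      z = π ^ (d ℕ.+ J) M.*ₗ x
      w = φ (π ^ J M.*ₗ x)
      c = commutator T M N π φ z
      comm′ : ∀ d → L₂.member (commutator T M N π φ (π ^ (d ℕ.+ J) M.*ₗ x))
      comm′ d = L₂.resp (N.+ᴹ-cong (N.*ₗ-congˡ (φ.cong e)) (N.-ᴹ‿cong (φ.cong (M.*ₗ-congˡ e))))
        (comm∈ (L₁.has* (π ^ d , v≥0-π^ d) p))
        where
        e : π ^ J M.*ₗ (π ^ d M.*ₗ x) M.≈ᴹ π ^ (d ℕ.+ J) M.*ₗ x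
        e = M.≈ᴹ-trans (M.≈ᴹ-sym (M.*ₗ-assoc (π ^ J) (π ^ d) x)) (M.*ₗ-congʳ
          (T.trans (T.*-comm (π ^ J) (π ^ d)) (T.sym (ExpProperties.^-homo-* T.semiring π d J))))
      eq : (π N.*ₗ (φ z N.+ᴹ N.-ᴹ (π ^ d N.*ₗ w))) N.+ᴹ N.-ᴹ c N.≈ᴹ φ
          (π ^ (suc d ℕ.+ J) M.*ₗ x) N.+ᴹ N.-ᴹ (π ^ suc d N.*ₗ w)
      eq = begin
        (π N.*ₗ (φ z N.+ᴹ N.-ᴹ (π ^ d N.*ₗ w))) N.+ᴹ N.-ᴹ c          ≈⟨ N.+ᴹ-congʳ (NL.*ₗ-sub π (φ z) _) ⟩
        ((π N.*ₗ φ z) N.+ᴹ N.-ᴹ (π N.*ₗ (π ^ d N.*ₗ w))) N.+ᴹ N.-ᴹ c ≈⟨ N.+ᴹ-assoc _ _ _ ⟩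
        (π N.*ₗ φ z) N.+ᴹ (N.-ᴹ (π N.*ₗ (π ^ d N.*ₗ w)) N.+ᴹ N.-ᴹ c) ≈⟨ N.+ᴹ-congˡ (N.+ᴹ-comm _ _) ⟩
        (π N.*ₗ φ z) N.+ᴹ (N.-ᴹ c N.+ᴹ N.-ᴹ (π N.*ₗ (π ^ d N.*ₗ w))) ≈⟨ N.+ᴹ-assoc _ _ _ ⟨
        ((π N.*ₗ φ z) N.+ᴹ N.-ᴹ c) N.+ᴹ N.-ᴹ (π N.*ₗ (π ^ d N.*ₗ w)) ≈⟨ N.+ᴹ-cong
          (N.≈ᴹ-trans (shift {φ} π z) (φ.cong (M.≈ᴹ-sym (M.*ₗ-assoc π (π ^ (d ℕ.+ J)) x))))
          (N.-ᴹ‿cong (N.≈ᴹ-sym (N.*ₗ-assoc π (π ^ d) w))) ⟩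
        φ (π ^ (suc d ℕ.+ J) M.*ₗ x) N.+ᴹ N.-ᴹ (π ^ suc d N.*ₗ w)    ∎

  refinement : ∀ i {φ} → FineDiff T M N i φ → ∀ (L₁ : Lattice T M) (L₂ : Lattice T N) →
    ∃[ L₁′ ] ∃[ L₂′ ] Refines T φ L₁′ L₂′ L₁ L₂
  refinement i {φ} φ-diff L₁ L₂ =
    let (J , φπᴶL₁⊆L₂) = small-source i φ-diff L₁ L₂
        (L₁′ , L₁′⊆) = scaleLattice M J L₁
        (L₂′ , L₂⊑L₂′ , φL₁⊆L₂′) = lattice-bounded i φ-diff L₁ L₂ in
    L₁′ , L₂′ , record
      { L₁′⊆L₁ = λ p → let (y , q , e) = L₁′⊆ p in
          Lattice.resp L₁ (M.≈ᴹ-sym e) (Lattice.has* L₁ (π ^ J , v≥-mono (ℤ.+≤+ ℕ.z≤n) (v≥-π^ J)) q)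
      ; L₂⊆L₂′ = L₂⊑L₂′
      ; φL₁′⊆L₂ = λ p → let (y , q , e) = L₁′⊆ p in Lattice.resp L₂ (φ.cong (M.≈ᴹ-sym e)) (φπᴶL₁⊆L₂ q)
      ; φL₁⊆L₂′ = φL₁⊆L₂′
      }
    where module φ = LinearMap (FineDiff⇒linear T M N i φ-diff)

-- Operators induced on quotients of lattices

module Induced (em : ExcludedMiddle ℓ) {k : Field ℓ} {n : ℕ} (T : LocalFieldData k (suc n)) (σ₁ : Lifting T)
               (crit : LiftingLemmas.OpenCriterion T σ₁)
                 (k₁-ST : IsSTRing k (LocalFieldData.topRing (residue T)))
               (M N : Mod (LocalFieldData.ring T)) (L₁ L₁′ : Lattice T M) (L₂ L₂′ : Lattice T N)
               (L₂⊆L₂′ : Lattice.member L₂ ⊆ Lattice.member L₂′) where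
  private
    module T = LocalFieldData T
    module T₁ = LocalFieldData (residue T)
    module M = LeftModule M
    module N = LeftModule N
    module NL = ModuleLemmas N
    module L₁ = Lattice L₁
    module L₁′ = Lattice L₁′
    module L₂ = Lattice L₂
    module L₂′ = Lattice L₂′
  open FirstValuation T hiding (residue; surjective)
  open LiftingLemmas T σ₁
  open LatticeLemmas em T
  open LiftingModules em T σ₁
  open Lifting σ₁ using (rest; over-k)

  Q₁ Q₂ : Mod k₁.ring
  Q₁ = rest (L₁.L / L₁′.L)
  Q₂ = rest (L₂′.L / L₂.L)

  private
    module Q₁ = LeftModule Q₁
    module Q₂ = LeftModule Q₂
    module E = Extension em T σ₁ crit k₁-ST N

    ∼-from-≈ : ∀ {x y : Q₂.Carrierᴹ} → proj₁ x N.≈ᴹ proj₁ y → x Q₂.≈ᴹ y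
    ∼-from-≈ e = L₂.resp (N.≈ᴹ-sym (NL.x≈y⇒x∙y⁻¹≈ε e)) L₂.has0

  module _ {φ : M.Carrierᴹ → N.Carrierᴹ} {ψ : Q₁.Carrierᴹ → Q₂.Carrierᴹ}
           (ψ≈φ : ∀ x → proj₁ (ψ x) N.≈ᴹ φ (proj₁ x)) where
    induced-linear : LinearMap (T.overBase M) (T.overBase N) φ →
        (∀ {x} → L₁′.member x → L₂.member (φ x)) →
                     LinearMap (T₁.overBase Q₁) (T₁.overBase Q₂) ψ
    induced-linear φ-lin φL₁′⊆L₂ = record
      { cong = λ {x} {y} x∼y → L₂.resp (N.≈ᴹ-trans (φ.sub (proj₁ x) (proj₁ y))
          (N.≈ᴹ-sym (N.+ᴹ-cong (ψ≈φ x) (N.-ᴹ‿cong (ψ≈φ y))))) (φL₁′⊆L₂ x∼y)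
      ; add = λ x y → ∼-from-≈ {ψ (x Q₁.+ᴹ y)} {ψ x Q₂.+ᴹ ψ y} (N.≈ᴹ-trans (ψ≈φ (x Q₁.+ᴹ y))
          (N.≈ᴹ-trans (φ.add (proj₁ x) (proj₁ y)) (N.≈ᴹ-sym (N.+ᴹ-cong (ψ≈φ x) (ψ≈φ y)))))
      ; scal = λ c x → ∼-from-≈ {ψ (T₁.ι c Q₁.*ₗ x)} {T₁.ι c Q₂.*ₗ ψ x}
          (N.≈ᴹ-trans (ψ≈φ (T₁.ι c Q₁.*ₗ x))
          (N.≈ᴹ-trans (φ.cong (M.*ₗ-congʳ (over-k c))) (N.≈ᴹ-trans (φ.scal c (proj₁ x))
          (N.≈ᴹ-sym (N.≈ᴹ-trans (N.*ₗ-congˡ (ψ≈φ x)) (N.*ₗ-congʳ (over-k c)))))))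
      }
      where module φ = LinearMap φ-lin

    -- `V` is lifted to `U` with `L₂ ⊆ U ⊆ L₂′` and extended to a fine `W` in `N` with
    -- `W ∩ L₂′ = U`. The values of `ψ` lie in `L₂′`, so orbit conditions for the preimage of `V`
    -- are slices of `φ⁻¹(W)`.
    induced-continuous : FineContinuous T M N φ → LinearMap (T₁.overBase Q₁) (T₁.overBase Q₂) ψ →
                         FineContinuous (residue T) Q₁ Q₂ ψ
    induced-continuous φ-cont ψ-lin V (V-sub , V-orb) =
      let (W , W-fine , U⊆W , W∩L₂′⊆U) = E.extension s L₂′ id
            (Absorbing-⊆ N L₂.member U L₂⊆U (lattice-absorbing N L₂)) in
      LinearMap.preimage ψ-lin V-sub , λ x → open-cong T₁.topology
        (λ {c} w → let y = ψ (c Q₁.*ₗ x)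
                       (p , v) = W∩L₂′⊆U (L₂′.resp (ψ≈φ (c Q₁.*ₗ x)) (proj₂ y)) w in
          V.resp {_ , p} {y} (∼-from-≈ {_ , p} {y} (N.≈ᴹ-sym (ψ≈φ (c Q₁.*ₗ x)))) v)
        (λ {c} v → IsSubmodule.resp (proj₁ W-fine) (ψ≈φ (c Q₁.*ₗ x)) (U⊆W (proj₂ (ψ (c Q₁.*ₗ x)) , v)))
        (FineCriterion.fine⇒slice T σ₁ crit M {W ∘ φ} (φ-cont W W-fine) (proj₁ x))
      where
      module V = IsSubmodule V-sub

      U : Pred N.Carrierᴹ ℓ
      U m = Σ[ p ∈ L₂′.member m ] V (m , p)

      -- Two membership proofs for the same `m` give elements of the quotient that are equal modulo
      -- `L₂`, and `V` respects this equality.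
      irrelevant : ∀ {m} {p q : L₂′.member m} → V (m , p) → V (m , q)
      irrelevant {m} {p} {q} = V.resp {m , p} {m , q} (∼-from-≈ {m , p} {m , q} N.≈ᴹ-refl)

      L₂⊆U : L₂.member ⊆ U
      L₂⊆U {m} p = L₂⊆L₂′ p , V.resp {Q₂.0ᴹ} {m , L₂⊆L₂′ p}
        (L₂.resp (N.≈ᴹ-sym (N.+ᴹ-identityˡ (N.-ᴹ m))) (L₂.has- p)) V.has0

      s : E.Stage
      s = record
        { W = L₂′.member
        ; U = U
        ; W-sub = 𝒪⇒k₁-isSubmodule N L₂′.isSubmodule
        ; U-sub = record
          { resp = λ {m} {m′} e (p , v) → L₂′.resp e p , V.resp {m , p} {m′ , L₂′.resp e p}
              (∼-from-≈ {m , p} {m′ , L₂′.resp e p} e) v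
          ; has0 = L₂′.has0 , V.has0
          ; has+ = λ {m} {m′} (p , v) (q , v′) → L₂′.has+ p q , V.has+ {m , p} {m′ , q} v v′
          ; has* = λ c {m} (p , v) →
              let cm = T₁.ι c Q₂.*ₗ (m , p)
                  r = L₂′.has* (T.ι c , proj₁ (T.ι-integral c)) p in
              r , V.resp {cm} {_ , r} (∼-from-≈ {cm} {_ , r} (N.*ₗ-congʳ (over-k c)))
                (V.has* c {m , p} v)
          }
        ; U⊆W = proj₁
        ; slice = λ {w} p → open-cong T₁.topology
            (λ {c} v → proj₂ (c Q₂.*ₗ (w , p)) , v) (λ (_ , v) → irrelevant v) (V-orb (w , p))
        }

  -- The commutator of `ψ` with `c` is induced by that of `φ` with `σ₁(c)`. The two agree on
  -- underlying elements but come with different membership proofs, which is why `ψ` is tied to `φ`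
  -- by an equation.
  induced-diff : ∀ i {φ : M.Carrierᴹ → N.Carrierᴹ} {ψ : Q₁.Carrierᴹ → Q₂.Carrierᴹ} →
    (∀ x → proj₁ (ψ x) N.≈ᴹ φ (proj₁ x)) → (∀ {x} → L₁′.member x → L₂.member (φ x)) →
    FineDiff T M N i φ → FineDiff (residue T) Q₁ Q₂ i ψ
  induced-diff zero    {φ} {ψ} ψ≈φ _       (lift φ≈0) =
    lift λ x → ∼-from-≈ {ψ x} {Q₂.0ᴹ} (N.≈ᴹ-trans (ψ≈φ x) (φ≈0 (proj₁ x)))
  induced-diff (suc i) {φ} {ψ} ψ≈φ φL₁′⊆L₂ (φ-lin , φ-cont , comm) =
    ψ-lin , induced-continuous {φ} {ψ} ψ≈φ φ-cont ψ-lin , λ c →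
    induced-diff i {commutator T M N (lift₁ c) φ} {commutator (residue T) Q₁ Q₂ c ψ}
      (λ x → N.+ᴹ-cong (N.*ₗ-congˡ (ψ≈φ x)) (N.-ᴹ‿cong (ψ≈φ (c Q₁.*ₗ x))))
      (λ p → L₂.has+ (L₂.has* (lift₁ c , lift₁-integral c) (φL₁′⊆L₂ p))
        (L₂.has- (φL₁′⊆L₂ (L₁′.has* (lift₁ c , lift₁-integral c) p))))
      (comm (lift₁ c))
    where ψ-lin = induced-linear {φ} {ψ} ψ≈φ φ-lin φL₁′⊆L₂

module _ (em : ExcludedMiddle ℓ) {k : Field ℓ} where
  FineDiff⇒BT : ∀ {n} (T : LocalFieldData k n) (σ : SystemOfLiftings T) → Controlled T σ →
    (M N : Mod (LocalFieldData.ring T)) → ∀ i {φ} → FineDiff T M N i φ → BT T σ M N φ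
  FineDiff⇒BT {zero}  T σ        ctrl M N i φ-diff = lift
      (LinearMap.isLinear (FineDiff⇒linear T M N i φ-diff))
  FineDiff⇒BT {suc n} T (σ₁ , σ) ctrl@(_ , crit , ctrl₁) M N i {φ} φ-diff =
    lift (LinearMap.isLinear (FineDiff⇒linear T M N i φ-diff)) ,
    Bounded.refinement em T σ₁ σ ctrl M N i φ-diff ,
    λ {L₁} {L₁′} {L₂} {L₂′} r →
      FineDiff⇒BT (residue T) σ ctrl₁
        (Lifting.rest σ₁ (Lattice.L L₁ / Lattice.L L₁′))
          (Lifting.rest σ₁ (Lattice.L L₂′ / Lattice.L L₂)) i
        (Induced.induced-diff em T σ₁ crit (controlled-isSTRing (residue T) σ ctrl₁) M N L₁ L₁′ L₂ L₂′
          (Refines.L₂⊆L₂′ r) i {φ} {Refines.induced r} (λ _ → LeftModule.≈ᴹ-refl N)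
            (Refines.φL₁′⊆L₂ r) φ-diff)

-- Operators on the field itself

module _ {k : Field ℓ} {n : ℕ} (K : TopologicalLocalField k n) where
  private
    module K = TopologicalLocalField K
    module τ = Topology K.topology
    K-mod : Mod K.ring
    K-mod = regular K.ring
    base = K.overBase K-mod

    regular-finitelyGenerated : IsFinitelyGenerated K-mod
    regular-finitelyGenerated = 1 , (λ _ → K.1#) , λ m → (λ _ → m) ,
      K.sym (K.trans (K.+-identityʳ (m K.* K.1#)) (K.*-identityʳ m))

    -- The orbit condition at `1` is `U` itself, and conversely multiplications are continuous. So
    -- on `K` the fine submodules are exactly the open ones.
    fine⇒open : ∀ {U} → Fine K.localField K-mod U → τ.Open U
    fine⇒open (U-sub , orb) = open-cong K.topology (λ {a} → U.resp (K.*-identityʳ a))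
      (λ {a} → U.resp (K.sym (K.*-identityʳ a))) (orb K.1#)
      where module U = IsSubmodule U-sub

    open⇒fine : ∀ {U} → IsSubmodule base U → τ.Open U → Fine K.localField K-mod U
    open⇒fine U-sub U-open = U-sub , λ m → open-cong K.topology
      (λ {a} → U.resp (K.*-comm m a)) (λ {a} → U.resp (K.*-comm a m)) (IsSTRing.*-continuous K.isSTRing m _ U-open)
      where module U = IsSubmodule U-sub

  continuousEnd⇒fineContinuous : ∀ {φ} → ContinuousEnd K φ → FineContinuous K.localField K-mod K-mod φ
  continuousEnd⇒fineContinuous (φ-lin , φ-cont) U U-fine =
    open⇒fine (LinearMap.preimage (toLinearMap base base φ-lin) (proj₁ U-fine)) (φ-cont U (fine⇒open {U} U-fine))

  differential⇒fineDiff : ∀ i {φ} → DifferentialOrder< K i φ → FineDiff K.localField K-mod K-mod i φ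
  differential⇒fineDiff zero    φ≈0               = φ≈0
  differential⇒fineDiff (suc i) (φ-end , φ-comm) =
    toLinearMap base base (proj₁ φ-end) , continuousEnd⇒fineContinuous φ-end , λ a →
      differential⇒fineDiff i (φ-comm a)

  fineContinuous⇒continuous : ∀ {φ} → LinearMap base base φ → FineContinuous K.localField K-mod K-mod φ →
                              Continuous K.topology K.topology φ
  fineContinuous⇒continuous {φ} φ-lin φ-cont =
    linear-continuous (IsSTRing.isLinear K.isSTRing) (IsSTRing.isLinear K.isSTRing) φ-lin
      λ U U-open U-sub → fine⇒open {U ∘ φ} (φ-cont U (open⇒fine U-sub U-open))

  module _ (em : ExcludedMiddle ℓ) (σ : SystemOfLiftings K.localField) where
    private ctrl = controlled em K.localField K.isTLF σ

    differential⇒BT : ContinuousDifferential K ⊆ LocalBT K σ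
    differential⇒BT (i , φ-diff) = FineDiff⇒BT em K.localField σ ctrl K-mod K-mod i
        (differential⇒fineDiff i φ-diff)

    BT⇒continuous : LocalBT K σ ⊆ ContinuousEnd K
    BT⇒continuous φ-BT =
      LinearMap.isLinear φ-lin ,
      fineContinuous⇒continuous φ-lin (BT⇒fineContinuous em K.localField σ ctrl K-mod K-mod
        regular-finitelyGenerated regular-finitelyGenerated φ-BT)
      where φ-lin = BT⇒linear K.localField σ K-mod K-mod φ-BT

theorem0p5 : (∀ {a : Level} → ExcludedMiddle a) →
    ∀ {ℓ : Level} (k : Field ℓ) → IsPerfect k →
    ∀ (n : ℕ) (K : TopologicalLocalField k n)
    (σ : SystemOfLiftings (TopologicalLocalField.localField K)) →
    (ContinuousDifferential K ⊆ LocalBT K σ) × (LocalBT K σ ⊆ ContinuousEnd K)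
theorem0p5 em k _ n K σ = differential⇒BT K em σ , BT⇒continuous K em σ
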